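{- There exists a function $f : \mathbb{N}^2 \to \mathbb{R}_+$ with $f(k,\ell) = O(\ell \cdot k \log k)$ such that for all $k, \ell \in \mathbb{N}$ and every graph $G$, at least one of the following two assertions holds: (1) $G$ contains $k$ pairwise vertex-disjoint cycles, each of length at least $\ell$; (2) $G$ contains a set of at most $f(k,\ell)$ vertices meeting every cycle of $G$ of length at least $\ell$.
   Context: Graphs are finite. The length of a cycle is its number of edges. The asymptotic bound $f(k,\ell) = O(\ell \cdot k \log k)$ means that there is an absolute constant $c$ with $f(k,\ell) \leqslant c\,\ell\, k \log k$ for all $k \geqslant 2$ and $\ell \geqslant 1$. -}

module Defs where

open import Data.Nat using (ℕ; _≤_; _*_)
open import Data.Nat.Logarithm using (⌈log₂_⌉)
open import Data.Bool using (Bool; true; false; T)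
open import Data.Fin using (Fin)
open import Data.List using (List; []; _∷_; _++_; [_]; length)
open import Data.List.Relation.Unary.Unique.Propositional using (Unique)
open import Data.List.Relation.Unary.Any using (Any)
open import Data.List.Membership.Propositional using (_∈_)
open import Data.Vec using (Vec; lookup)
open import Data.Product using (Σ; _×_)
open import Data.Sum using (_⊎_)
open import Data.Unit using (⊤)
open import Data.Empty using (⊥)
open import Relation.Binary.PropositionalEquality using (_≡_)
open import Relation.Nullary using (¬_)

record Graph (n : ℕ) : Set where
  field
    adj   : Fin n → Fin n → Bool
    sym   : ∀ u v → adj u v ≡ adj v u
    irrefl : ∀ v → adj v v ≡ false

open Graph public

Walk : ∀ {n} → Graph n → List (Fin n) → Set
Walk G []           = ⊤
Walk G (x ∷ [])     = ⊤
Walk G (x ∷ y ∷ xs) = T (adj G x y) × Walk G (y ∷ xs)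

ClosedWalk : ∀ {n} → Graph n → List (Fin n) → Set
ClosedWalk G []       = ⊥
ClosedWalk G (x ∷ xs) = Walk G (x ∷ xs ++ [ x ])

-- A cycle: at least 3 distinct vertices, cyclically consecutive ones adjacent.
-- Its length (number of edges) equals the number of its vertices.
record Cycle {n : ℕ} (G : Graph n) : Set where
  field
    verts    : List (Fin n)
    distinct : Unique verts
    atLeast3 : 3 ≤ length verts
    closed   : ClosedWalk G verts

open Cycle public

cycleLength : ∀ {n} {G : Graph n} → Cycle G → ℕ
cycleLength C = length (verts C)

VertexDisjoint : ∀ {n} {G : Graph n} → Cycle G → Cycle G → Set
VertexDisjoint C D = ∀ v → v ∈ verts C → ¬ (v ∈ verts D)

HasDisjointLongCycles : ∀ {n} → Graph n → ℕ → ℕ → Set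
HasDisjointLongCycles G k ℓ =
  Σ (Vec (Cycle G) k) λ Cs →
    (∀ i → ℓ ≤ cycleLength (lookup Cs i)) ×
    (∀ i j → ¬ (i ≡ j) → VertexDisjoint (lookup Cs i) (lookup Cs j))

HasLongCycleHittingSet : ∀ {n} → Graph n → ℕ → ℕ → Set
HasLongCycleHittingSet {n} G ℓ m =
  Σ (List (Fin n)) λ S →
    (length S ≤ m) ×
    (∀ (C : Cycle G) → ℓ ≤ cycleLength C → Any (λ v → v ∈ S) (verts C))

-- f(k,ℓ) = O(ℓ · k log k), with log replaced by ⌈log₂⌉ (equivalent up to
-- a constant for k ≥ 2).
BigOEllKLogK : (ℕ → ℕ → ℕ) → Set
BigOEllKLogK f = Σ ℕ λ c → ∀ k ℓ → 2 ≤ k → 1 ≤ ℓ → f k ℓ ≤ c * (ℓ * (k * ⌈log₂ k ⌉))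

{-# OPTIONS --safe #-}
module Submission where

-- The argument is Simonovits' one.  A frame is a subgraph H of G with all degrees 0, 2 or 3 in which
-- every cycle is long; it is enlarged until it cannot have more cubic vertices, or equally many and a
-- larger support.
--
-- If H has about k log k cubic vertices, it contains k disjoint cycles: a graph of minimum degree 2
-- has a cycle through O(log k) branch vertices, since the 2 ^ r non-backtracking walks with r
-- branchings cannot all end in different vertices, and deleting such a cycle lowers
-- |E| − |V| by O(log k) only.
--
-- Otherwise let X consist of the vertices within distance L of the cubic vertices and of one marked
-- vertex in each 2-regular component.  H − X is a disjoint union of paths, its segments.  A long
-- cycle C avoiding X that misses H can be added to H.  If C meets two segments, it contains a path
-- between them that can be added to H: every new cycle enters X, so it is long.  If C meets a segment
-- in two vertices, the part of the segment between the extreme ones is replaced by C.  The remaining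
-- C meet H in a single vertex z; two of these with different z are disjoint, as otherwise H could be
-- enlarged in the same ways.  Hence either k of them are disjoint, or X and fewer than k
-- such vertices z meet all long cycles.

open import Defs hiding (sym)
open import Data.Bool using (Bool; true; false; T; _∧_; not; if_then_else_)
open import Data.Bool.Properties using (T-≡; T?; ∧-comm) renaming (_≟_ to _≟ᵇ_)
open import Data.Empty using (⊥; ⊥-elim)
open import Data.Fin using (Fin; zero; suc)
open import Data.Fin.Properties using (_≟_; any?)
open import Data.List using (List; []; _∷_; _++_; [_]; length; reverse; allFin; map; concatMap; _ʳ++_; filterᵇ)
open import Data.List.Properties using (length-tabulate; ++-assoc; length-++; ++-identityʳ; ʳ++-defn; length-map; ∷-injectiveˡ; filter-++)
open import Data.List.Membership.Propositional using (_∈_; _∉_; find; lose)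
open import Data.List.Membership.Propositional.Properties using (∈-++⁺ˡ; ∈-++⁺ʳ; ∈-++⁻; ∈-allFin; ∈-∃++; ∈-map⁺; ∈-map⁻; ∈-filter⁺; ∈-filter⁻; ∈-concatMap⁺; ∈-concatMap⁻)
import Data.List.Membership.DecPropositional as DecMembership
open import Data.List.Relation.Unary.All using (All; []; _∷_)
import Data.List.Relation.Unary.All as All
import Data.List.Relation.Unary.All.Properties as AllP
open import Data.List.Relation.Unary.Any using (Any; here; there)
import Data.List.Relation.Unary.Any as Any
import Data.List.Relation.Unary.Any.Properties as AnyP
open import Data.List.Relation.Unary.AllPairs using (AllPairs; []; _∷_)
import Data.List.Relation.Unary.AllPairs.Properties as AllPairsP
open import Data.List.Relation.Unary.Linked using (Linked; []; [-]; _∷_)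
import Data.List.Relation.Unary.Linked as Linked
open import Data.List.Relation.Unary.Unique.Propositional using (Unique)
import Data.List.Relation.Unary.Unique.Propositional.Properties as UniqueP
open import Data.List.Relation.Unary.Unique.DecPropositional using (unique?)
open import Data.Nat using (ℕ; zero; suc; _+_; _*_; _^_; _⊔_; _∸_; _≤_; _<_; z≤n; s≤s; s≤s⁻¹; _≤?_; _≤ᵇ_; ⌈_/2⌉; ⌊_/2⌋)
open import Data.Nat.Logarithm using (⌈log₂_⌉; ⌈log₂⌉-mono-≤; ⌈log₂2^n⌉≡n; ⌈log₂⌈n/2⌉⌉≡⌈log₂n⌉∸1)
open import Data.Nat.Properties hiding (_≟_)
open import Data.Nat.Tactic.RingSolver using (solve-∀)
open import Data.Product using (Σ; ∃-syntax; _×_; _,_; proj₁; proj₂)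
open import Data.Unit using (⊤; tt)
open import Data.Sum using (_⊎_; inj₁; inj₂)
open import Data.Vec using (Vec; []; _∷_; lookup)
open import Function using (_∘_; id)
open import Function.Bundles using (Equivalence)
open import Relation.Binary.PropositionalEquality using (_≡_; _≢_; refl; sym; trans; cong; cong₂; subst)
open import Relation.Nullary using (¬_; Dec; yes; no; does)
open import Relation.Nullary.Decidable using (dec-true; dec-false; ¬?; _×-dec_; map′)

-- Finite vertex sets

-- The number of cubic vertices has to be controlled from both sides. A cubic vertex contributes one
-- half to |E| - |V|, and deleting a cycle costs `D`, so `k` deletions call for `b = 2 k D` of them.
-- But `D` is logarithmic in the number of branch vertices, so fewer than `2 ^ r` of these may be
-- present, where `r` must depend on `k` alone and not on the order of the graph. This is why an
-- enlargement may create at most two cubic vertices and why the process stops at the first frame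
-- with at least `b` of them. No maximal frame is chosen: each round either yields one of the two
-- outcomes or returns a strictly larger frame. The factor ℓ stays linear because, away from the
-- marks, the frame has degree at most two, so the ball around a mark gains at most three vertices
-- per layer.

VSet : ℕ → Set
VSet n = Fin n → Bool

b2n : Bool → ℕ
b2n true = 1
b2n false = 0

cnt : {A : Set} → (A → Bool) → List A → ℕ
cnt P [] = 0
cnt P (x ∷ xs) = b2n (P x) + cnt P xs

∧-true⁻ : ∀ {a b} → a ∧ b ≡ true → a ≡ true × b ≡ true
∧-true⁻ {true} {true} _ = refl , refl

∧-true⁺ : ∀ {a b} → a ≡ true → b ≡ true → a ∧ b ≡ true
∧-true⁺ refl refl = refl

true≢false : ∀ {b} → b ≡ true → b ≡ false → ⊥
true≢false refl ()

bool-cases : ∀ b → b ≡ true ⊎ b ≡ false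
bool-cases true = inj₁ refl
bool-cases false = inj₂ refl

not-true⁻ : ∀ {b} → not b ≡ true → b ≡ false
not-true⁻ {false} _ = refl

not-true⁺ : ∀ {b} → b ≡ false → not b ≡ true
not-true⁺ refl = refl

b2n-mono : ∀ {a b} → (a ≡ true → b ≡ true) → b2n a ≤ b2n b
b2n-mono {false} f = z≤n
b2n-mono {true} f rewrite f refl = ≤-refl

b2n≤1 : ∀ b → b2n b ≤ 1
b2n≤1 true = ≤-refl
b2n≤1 false = z≤n

cnt-mono : {A : Set} {P Q : A → Bool} (xs : List A) → (∀ x → x ∈ xs → P x ≡ true → Q x ≡ true) → cnt P xs ≤ cnt Q xs
cnt-mono [] f = z≤n
cnt-mono (x ∷ xs) f = +-mono-≤ (b2n-mono (f x (here refl))) (cnt-mono xs (λ y m → f y (there m)))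

cnt-cong : {A : Set} {P Q : A → Bool} (xs : List A) → (∀ x → x ∈ xs → P x ≡ Q x) → cnt P xs ≡ cnt Q xs
cnt-cong [] f = refl
cnt-cong (x ∷ xs) f = cong₂ _+_ (cong b2n (f x (here refl))) (cnt-cong xs (λ y m → f y (there m)))

cnt-++ : {A : Set} (P : A → Bool) (xs ys : List A) → cnt P (xs ++ ys) ≡ cnt P xs + cnt P ys
cnt-++ P [] ys = refl
cnt-++ P (x ∷ xs) ys rewrite cnt-++ P xs ys = sym (+-assoc (b2n (P x)) _ _)

cnt≤length : {A : Set} (P : A → Bool) (xs : List A) → cnt P xs ≤ length xs
cnt≤length P [] = z≤n
cnt≤length P (x ∷ xs) = +-mono-≤ (b2n≤1 (P x)) (cnt≤length P xs)

cnt-all : {A : Set} (P : A → Bool) (xs : List A) → (∀ x → x ∈ xs → P x ≡ true) → cnt P xs ≡ length xs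
cnt-all P [] f = refl
cnt-all P (x ∷ xs) f rewrite f x (here refl) = cong suc (cnt-all P xs (λ y m → f y (there m)))

cnt-none : {A : Set} (P : A → Bool) (xs : List A) → (∀ x → x ∈ xs → P x ≡ false) → cnt P xs ≡ 0
cnt-none P [] f = refl
cnt-none P (x ∷ xs) f rewrite f x (here refl) = cnt-none P xs (λ y m → f y (there m))

cnt-pos : {A : Set} (P : A → Bool) (xs : List A) → 1 ≤ cnt P xs → ∃[ x ] (x ∈ xs × P x ≡ true)
cnt-pos P (x ∷ xs) h with P x in eq
... | true = x , here refl , eq
... | false with y , m , e ← cnt-pos P xs h = y , there m , e

cnt-∈ : {A : Set} (P : A → Bool) {xs : List A} {x : A} → x ∈ xs → P x ≡ true → 1 ≤ cnt P xs
cnt-∈ P (here refl) e rewrite e = s≤s z≤n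
cnt-∈ P {y ∷ xs} (there m) e = ≤-trans (cnt-∈ P m e) (m≤n+m _ (b2n (P y)))

_∈?_ : ∀ {n} (v : Fin n) (xs : List (Fin n)) → Dec (v ∈ xs)
_∈?_ = DecMembership._∈?_ _≟_

abstract
  mem : ∀ {n} → List (Fin n) → VSet n
  mem xs v = does (v ∈? xs)

  mem⁺ : ∀ {n} {v : Fin n} {xs} → v ∈ xs → mem xs v ≡ true
  mem⁺ {v = v} {xs} m = dec-true (v ∈? xs) m

  mem⁻ : ∀ {n} {v : Fin n} {xs} → mem xs v ≡ true → v ∈ xs
  mem⁻ {v = v} {xs} e with v ∈? xs
  ... | yes m = m

  mem-∉⁺ : ∀ {n} {v : Fin n} {xs} → v ∉ xs → mem xs v ≡ false
  mem-∉⁺ {v = v} {xs} m = dec-false (v ∈? xs) m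

  mem-∉⁻ : ∀ {n} {v : Fin n} {xs} → mem xs v ≡ false → v ∉ xs
  mem-∉⁻ e m = true≢false (mem⁺ m) e

size : ∀ {n} → VSet n → ℕ
size {n} W = cnt W (allFin n)

size-mono : ∀ {n} {W W' : VSet n} → (∀ v → W v ≡ true → W' v ≡ true) → size W ≤ size W'
size-mono {n} f = cnt-mono (allFin n) (λ v _ → f v)

rem : ∀ {n} → Fin n → VSet n → VSet n
rem x W y = W y ∧ not (does (y ≟ x))

rem⁺ : ∀ {n} {x y : Fin n} (W : VSet n) → W y ≡ true → y ≢ x → rem x W y ≡ true
rem⁺ {x = x} {y} W w ne rewrite w | dec-false (y ≟ x) ne = refl

rem⁻ : ∀ {n} {x y : Fin n} (W : VSet n) → rem x W y ≡ true → W y ≡ true × y ≢ x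
rem⁻ {x = x} {y} W e with W y | y ≟ x
... | true | no ne = refl , ne

rem-self : ∀ {n} (x : Fin n) (W : VSet n) → rem x W x ≡ false
rem-self x W with W x | x ≟ x
... | true | yes _ = refl
... | true | no ne = ⊥-elim (ne refl)
... | false | _ = refl

rem-other : ∀ {n} {x y : Fin n} (W : VSet n) → y ≢ x → rem x W y ≡ W y
rem-other {x = x} {y} W ne with W y | y ≟ x
... | true | yes e = ⊥-elim (ne e)
... | true | no _ = refl
... | false | _ = refl

cnt-rem-∉ : ∀ {n} {x : Fin n} (W : VSet n) (xs : List (Fin n)) → x ∉ xs → cnt (rem x W) xs ≡ cnt W xs
cnt-rem-∉ W xs x∉ = cnt-cong xs (λ y m → rem-other W (λ { refl → x∉ m }))

cnt-rem : ∀ {n} {x : Fin n} (W : VSet n) {xs : List (Fin n)} → Unique xs → x ∈ xs → W x ≡ true →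
          cnt W xs ≡ suc (cnt (rem x W) xs)
cnt-rem {x = x} W {x ∷ xs} (p ∷ u) (here refl) w
  rewrite rem-self x W | w | cnt-rem-∉ W xs (λ m → All.lookup p m refl) = refl
cnt-rem {x = x} W {y ∷ xs} (p ∷ u) (there m) w
  rewrite rem-other {x = x} {y} W (λ e → All.lookup p m e) | cnt-rem W u m w = +-suc _ _

cnt≤suc-rem : ∀ {n} (x : Fin n) (W : VSet n) {xs : List (Fin n)} → Unique xs →
          cnt W xs ≤ suc (cnt (rem x W) xs)
cnt≤suc-rem x W {xs} u with x ∈? xs | bool-cases (W x)
... | yes m | inj₁ w = ≤-reflexive (cnt-rem W u m w)
... | no m | _ = ≤-trans (≤-reflexive (sym (cnt-rem-∉ W xs m))) (n≤1+n _)
... | yes m | inj₂ w = ≤-trans (cnt-mono xs (λ y _ e → rem⁺ W e (λ { refl → true≢false e w }))) (n≤1+n _)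

size-rem : ∀ {n} {x : Fin n} (W : VSet n) → W x ≡ true → size W ≡ suc (size (rem x W))
size-rem {n} W w = cnt-rem W (UniqueP.allFin⁺ n) (∈-allFin _) w

size≤suc-rem : ∀ {n} (x : Fin n) (W : VSet n) → size W ≤ suc (size (rem x W))
size≤suc-rem {n} x W = cnt≤suc-rem x W (UniqueP.allFin⁺ n)

unique-length≤size : ∀ {n} {xs : List (Fin n)} (W : VSet n) → Unique xs → (∀ x → x ∈ xs → W x ≡ true) → length xs ≤ size W
unique-length≤size {xs = []} W u f = z≤n
unique-length≤size {xs = x ∷ xs} W (p ∷ u) f rewrite size-rem W (f x (here refl)) =
  s≤s (unique-length≤size (rem x W) u (λ y m → rem⁺ W (f y (there m)) (λ { refl → All.lookup p m refl })))

unique-cnt≤ : ∀ {n} {xs ys : List (Fin n)} (W : VSet n) → Unique xs → (∀ x → x ∈ xs → x ∈ ys) → cnt W xs ≤ cnt W ys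
unique-cnt≤ {xs = []} W u f = z≤n
unique-cnt≤ {xs = x ∷ xs} {ys} W (p ∷ u) f with as , bs , refl ← ∈-∃++ (f x (here refl)) =
  ≤-trans (+-monoʳ-≤ (b2n (W x)) (unique-cnt≤ {xs = xs} {as ++ bs} W u (λ y m → move y m (∈-++⁻ as (f y (there m))))))
          (≤-reflexive eq)
  where
  move : ∀ y → y ∈ xs → y ∈ as ⊎ y ∈ x ∷ bs → y ∈ as ++ bs
  move y m (inj₁ q) = ∈-++⁺ˡ q
  move y m (inj₂ (here refl)) = ⊥-elim (All.lookup p m refl)
  move y m (inj₂ (there q)) = ∈-++⁺ʳ as q
  eq : b2n (W x) + cnt W (as ++ bs) ≡ cnt W (as ++ x ∷ bs)
  eq rewrite cnt-++ W as bs | cnt-++ W as (x ∷ bs) = lem (b2n (W x)) (cnt W as) (cnt W bs)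
    where
    lem : ∀ a b c → a + (b + c) ≡ b + (a + c)
    lem = solve-∀

length-allFin : ∀ n → length (allFin n) ≡ n
length-allFin n = length-tabulate {n = n} id

size≤n : ∀ {n} (W : VSet n) → size W ≤ n
size≤n {n} W = ≤-trans (cnt≤length W (allFin n)) (≤-reflexive (length-allFin n))

unique-length≤n : ∀ {n} {xs : List (Fin n)} → Unique xs → length xs ≤ n
unique-length≤n u = ≤-trans (unique-length≤size (λ _ → true) u (λ _ _ → refl)) (size≤n _)

size-pos : ∀ {n} (W : VSet n) → 1 ≤ size W → ∃[ v ] W v ≡ true
size-pos {n} W h with v , _ , e ← cnt-pos W (allFin n) h = v , e

size-∈ : ∀ {n} (W : VSet n) {v} → W v ≡ true → 1 ≤ size W
size-∈ W {v} e = cnt-∈ W (∈-allFin v) e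

-- Edge lists and degrees

Edge : ℕ → Set
Edge n = Fin n × Fin n

inc : ∀ {n} → Edge n → Fin n → List (Fin n)
inc (a , b) v = (if does (a ≟ v) then [ b ] else []) ++ (if does (b ≟ v) then [ a ] else [])

nb : ∀ {n} → List (Edge n) → Fin n → List (Fin n)
nb [] v = []
nb (e ∷ es) v = inc e v ++ nb es v

deg : ∀ {n} → List (Edge n) → Fin n → ℕ
deg es v = length (nb es v)

nb-++ : ∀ {n} (es fs : List (Edge n)) v → nb (es ++ fs) v ≡ nb es v ++ nb fs v
nb-++ [] fs v = refl
nb-++ (e ∷ es) fs v rewrite nb-++ es fs v = sym (++-assoc (inc e v) _ _)

inc⁻ : ∀ {n} (e : Edge n) {v u} → u ∈ inc e v → (e ≡ (v , u)) ⊎ (e ≡ (u , v))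
inc⁻ (a , b) {v} m with a ≟ v | b ≟ v
inc⁻ (a , b) {v} (here refl) | yes refl | yes refl = inj₁ refl
inc⁻ (a , b) {v} (there (here refl)) | yes refl | yes refl = inj₁ refl
inc⁻ (a , b) {v} (here refl) | yes refl | no _ = inj₁ refl
inc⁻ (a , b) {v} (here refl) | no _ | yes refl = inj₂ refl

inc-fst : ∀ {n} (a b : Fin n) → b ∈ inc (a , b) a
inc-fst a b with a ≟ a
... | yes _ = here refl
... | no ne = ⊥-elim (ne refl)

inc-snd : ∀ {n} (a b : Fin n) → a ∈ inc (a , b) b
inc-snd a b with a ≟ b | b ≟ b
... | yes refl | yes _ = here refl
... | no _ | yes _ = here refl
... | _ | no ne = ⊥-elim (ne refl)

nb⁻ : ∀ {n} (es : List (Edge n)) {v u} → u ∈ nb es v → (v , u) ∈ es ⊎ (u , v) ∈ es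
nb⁻ (e ∷ es) {v} m with ∈-++⁻ (inc e v) m
... | inj₁ q with inc⁻ e q
...   | inj₁ refl = inj₁ (here refl)
...   | inj₂ refl = inj₂ (here refl)
nb⁻ (e ∷ es) {v} m | inj₂ q with nb⁻ es q
...   | inj₁ r = inj₁ (there r)
...   | inj₂ r = inj₂ (there r)

nb⁺ˡ : ∀ {n} {es : List (Edge n)} {v u} → (v , u) ∈ es → u ∈ nb es v
nb⁺ˡ {v = v} {u} (here refl) = ∈-++⁺ˡ (inc-fst v u)
nb⁺ˡ {es = e ∷ es} {v} (there m) = ∈-++⁺ʳ (inc e v) (nb⁺ˡ m)

nb⁺ʳ : ∀ {n} {es : List (Edge n)} {v u} → (u , v) ∈ es → u ∈ nb es v
nb⁺ʳ {v = v} {u} (here refl) = ∈-++⁺ˡ (inc-snd u v)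
nb⁺ʳ {es = e ∷ es} {v} (there m) = ∈-++⁺ʳ (inc e v) (nb⁺ʳ m)

nb-sym : ∀ {n} (es : List (Edge n)) {v u} → u ∈ nb es v → v ∈ nb es u
nb-sym es m with nb⁻ es m
... | inj₁ r = nb⁺ʳ r
... | inj₂ r = nb⁺ˡ r

single : ∀ {n} → Fin n → VSet n
single u v = does (v ≟ u)

inc-mult-sym : ∀ {n} (e : Edge n) v u → cnt (single u) (inc e v) ≡ cnt (single v) (inc e u)
inc-mult-sym (a , b) v u with a ≟ v | b ≟ v | a ≟ u | b ≟ u
... | yes p | yes q | yes r | yes s rewrite dec-true (b ≟ u) s | dec-true (a ≟ u) r | dec-true (b ≟ v) q | dec-true (a ≟ v) p = refl
... | yes p | yes q | yes r | no s = ⊥-elim (s (trans q (trans (sym p) r)))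
... | yes p | yes q | no r | yes s = ⊥-elim (r (trans p (trans (sym q) s)))
... | yes p | yes q | no r | no s rewrite dec-false (b ≟ u) s | dec-false (a ≟ u) r = refl
... | yes p | no q | yes r | yes s = ⊥-elim (q (trans s (trans (sym r) p)))
... | yes p | no q | yes r | no s rewrite dec-false (b ≟ u) s | dec-false (b ≟ v) q = refl
... | yes p | no q | no r | yes s rewrite dec-true (b ≟ u) s | dec-true (a ≟ v) p = refl
... | yes p | no q | no r | no s rewrite dec-false (b ≟ u) s = refl
... | no p | yes q | yes r | yes s = ⊥-elim (p (trans r (trans (sym s) q)))
... | no p | yes q | yes r | no s rewrite dec-true (a ≟ u) r | dec-true (b ≟ v) q = refl
... | no p | yes q | no r | yes s rewrite dec-false (a ≟ u) r | dec-false (a ≟ v) p = refl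
... | no p | yes q | no r | no s rewrite dec-false (a ≟ u) r = refl
... | no p | no q | yes r | yes s rewrite dec-false (b ≟ v) q | dec-false (a ≟ v) p = refl
... | no p | no q | yes r | no s rewrite dec-false (b ≟ v) q = refl
... | no p | no q | no r | yes s rewrite dec-false (a ≟ v) p = refl
... | no p | no q | no r | no s = refl

nb-mult-sym : ∀ {n} (es : List (Edge n)) v u → cnt (single u) (nb es v) ≡ cnt (single v) (nb es u)
nb-mult-sym [] v u = refl
nb-mult-sym (e ∷ es) v u
  rewrite cnt-++ (single u) (inc e v) (nb es v) | cnt-++ (single v) (inc e u) (nb es u)
        | inc-mult-sym e v u | nb-mult-sym es v u = refl

Loopless : ∀ {n} → List (Edge n) → Set
Loopless es = ∀ v → v ∉ nb es v

within : ∀ {n} → VSet n → Edge n → Bool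
within A (a , b) = A a ∧ A b

edges : ∀ {n} → List (Edge n) → VSet n → ℕ
edges es A = cnt (within A) es

edge-rem : ∀ {n} {a b x : Fin n} (A : VSet n) → a ≢ b → A x ≡ true →
  b2n (within A (a , b)) ≡ cnt (rem x A) (inc (a , b) x) + b2n (within (rem x A) (a , b))
edge-rem {a = a} {b} {x} A ne w with a ≟ x | b ≟ x
... | yes refl | yes refl = ⊥-elim (ne refl)
... | yes refl | no q rewrite dec-false (b ≟ a) q | w with A b
...   | true = refl
...   | false = refl
edge-rem {a = a} {b} {x} A ne w | no q | yes refl rewrite dec-false (a ≟ b) q | w with A a
...   | true = refl
...   | false = refl
edge-rem {a = a} {b} {x} A ne w | no p | no q with A a | A b
... | true | true = refl
... | true | false = refl
... | false | true = refl
... | false | false = refl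

edges-rem : ∀ {n} (es : List (Edge n)) {x : Fin n} (A : VSet n) → Loopless es → A x ≡ true →
  edges es A ≡ cnt (rem x A) (nb es x) + edges es (rem x A)
edges-rem [] A ll w = refl
edges-rem ((a , b) ∷ es) {x} A ll w
  rewrite edge-rem {a = a} {b} {x} A (λ { refl → ll a (∈-++⁺ˡ (inc-fst a a)) }) w
        | edges-rem es A (λ v m → ll v (∈-++⁺ʳ (inc (a , b) v) m)) w
        | cnt-++ (rem x A) (inc (a , b) x) (nb es x)
  = lem (cnt (rem x A) (inc (a , b) x)) (b2n (within (rem x A) (a , b))) (cnt (rem x A) (nb es x)) _
  where
  lem : ∀ p q r s → p + q + (r + s) ≡ p + r + (q + s)
  lem = solve-∀

Σ[_] : ∀ {n} → VSet n → (Fin n → ℕ) → List (Fin n) → ℕ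
Σ[ A ] f [] = 0
Σ[ A ] f (x ∷ xs) = (if A x then f x else 0) + Σ[ A ] f xs

Σ-+ : ∀ {n} (A : VSet n) (f g : Fin n → ℕ) xs → Σ[ A ] (λ v → f v + g v) xs ≡ Σ[ A ] f xs + Σ[ A ] g xs
Σ-+ A f g [] = refl
Σ-+ A f g (x ∷ xs) rewrite Σ-+ A f g xs with A x
... | true = lem (f x) (g x) (Σ[ A ] f xs) (Σ[ A ] g xs)
  where
  lem : ∀ p q r s → p + q + (r + s) ≡ p + r + (q + s)
  lem = solve-∀
... | false = refl

Σ-mono : ∀ {n} (A : VSet n) {f g : Fin n → ℕ} xs → (∀ v → A v ≡ true → f v ≤ g v) → Σ[ A ] f xs ≤ Σ[ A ] g xs
Σ-mono A [] h = z≤n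
Σ-mono A (x ∷ xs) h with A x in eq
... | true = +-mono-≤ (h x eq) (Σ-mono A xs h)
... | false = Σ-mono A xs h

Σ-0 : ∀ {n} (A : VSet n) {f : Fin n → ℕ} xs → (∀ v → v ∈ xs → A v ≡ true → f v ≡ 0) → Σ[ A ] f xs ≡ 0
Σ-0 A [] h = refl
Σ-0 A (x ∷ xs) h with A x in eq
... | true rewrite h x (here refl) eq = Σ-0 A xs (λ v m → h v (there m))
... | false = Σ-0 A xs (λ v m → h v (there m))

Σ-point : ∀ {n} (A : VSet n) (a : Fin n) (m : ℕ) xs → Unique xs → a ∈ xs →
  Σ[ A ] (λ v → if does (a ≟ v) then m else 0) xs ≡ (if A a then m else 0)
Σ-point A a m (x ∷ xs) (p ∷ u) (here refl) rewrite dec-true (a ≟ a) refl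
  | Σ-0 A {λ v → if does (a ≟ v) then m else 0} xs
      (λ v q _ → cong (λ z → if z then m else 0) (dec-false (a ≟ v) (All.lookup p q))) = +-identityʳ _
Σ-point A a m (x ∷ xs) (p ∷ u) (there q) rewrite dec-false (a ≟ x) (λ { refl → All.lookup p q refl })
  | Σ-point A a m xs u q with A x
... | true = refl
... | false = refl

cnt-inc : ∀ {n} (A : VSet n) (a b v : Fin n) →
  cnt A (inc (a , b) v) ≡ (if does (a ≟ v) then b2n (A b) else 0) + (if does (b ≟ v) then b2n (A a) else 0)
cnt-inc A a b v with a ≟ v | b ≟ v
... | yes _ | yes _ = cong (b2n (A b) +_) (+-identityʳ _)
... | yes _ | no _ = refl
... | no _ | yes _ = +-identityʳ _
... | no _ | no _ = refl

Σ-cong : ∀ {n} (A : VSet n) {f g : Fin n → ℕ} xs → (∀ v → f v ≡ g v) → Σ[ A ] f xs ≡ Σ[ A ] g xs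
Σ-cong A [] h = refl
Σ-cong A (x ∷ xs) h rewrite h x | Σ-cong A xs h = refl

handshake : ∀ {n} (es : List (Edge n)) (A : VSet n) →
  Σ[ A ] (λ v → cnt A (nb es v)) (allFin n) ≡ edges es A + edges es A
handshake {n} [] A = Σ-0 A (allFin n) (λ _ _ _ → refl)
handshake {n} ((a , b) ∷ es) A
  rewrite Σ-cong A {λ v → cnt A (inc (a , b) v ++ nb es v)}
            {λ v → ((if does (a ≟ v) then b2n (A b) else 0) + (if does (b ≟ v) then b2n (A a) else 0)) + cnt A (nb es v)} (allFin n)
            (λ v → trans (cnt-++ A (inc (a , b) v) (nb es v)) (cong (_+ cnt A (nb es v)) (cnt-inc A a b v)))
        | Σ-+ A (λ v → (if does (a ≟ v) then b2n (A b) else 0) + (if does (b ≟ v) then b2n (A a) else 0)) (λ v → cnt A (nb es v)) (allFin n)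
        | Σ-+ A (λ v → if does (a ≟ v) then b2n (A b) else 0) (λ v → if does (b ≟ v) then b2n (A a) else 0) (allFin n)
        | Σ-point A a (b2n (A b)) (allFin n) (UniqueP.allFin⁺ n) (∈-allFin a)
        | Σ-point A b (b2n (A a)) (allFin n) (UniqueP.allFin⁺ n) (∈-allFin b)
        | handshake es A
  with A a | A b
... | true | true = lem (edges es A)
  where
  lem : ∀ e → 1 + 1 + (e + e) ≡ 1 + e + (1 + e)
  lem = solve-∀
... | true | false = refl
... | false | true = refl
... | false | false = refl

Σ-size : ∀ {n} (A B : VSet n) (m : ℕ) xs →
  Σ[ A ] (λ v → m + b2n (B v)) xs ≡ m * cnt A xs + cnt (λ v → A v ∧ B v) xs
Σ-size A B m [] = sym (trans (+-identityʳ _) (*-zeroʳ m))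
Σ-size A B m (x ∷ xs) rewrite Σ-size A B m xs with A x
... | true = lem m (b2n (B x)) (cnt A xs) (cnt (λ v → A v ∧ B v) xs)
  where
  lem : ∀ m b c d → m + b + (m * c + d) ≡ m * (1 + c) + (b + d)
  lem = solve-∀
... | false = refl

-- Reduced walks and short cycles

Rel : ℕ → Set₁
Rel n = Fin n → Fin n → Set

HeadsDiffer : ∀ {n} → List (Fin n) → List (Fin n) → Set
HeadsDiffer (a ∷ _) (b ∷ _) = a ≢ b
HeadsDiffer _ _ = ⊤

-- Non-backtracking walks: `HeadsDiffer [ x ] ys` forbids returning to `x` right after the step to
-- `y`, and holds trivially when the walk stops at `y`.
data Reduced {n} (R : Rel n) : List (Fin n) → Set where
  [-] : ∀ {x} → Reduced R [ x ]
  step : ∀ {x y ys} → R x y → HeadsDiffer [ x ] ys → Reduced R (y ∷ ys) → Reduced R (x ∷ y ∷ ys)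

data EndsAt {n} (e : Fin n) : List (Fin n) → Set where
  stop : EndsAt e [ e ]
  there : ∀ {x xs} → EndsAt e xs → EndsAt e (x ∷ xs)

EndsAt-∈ : ∀ {n} {e : Fin n} {xs} → EndsAt e xs → e ∈ xs
EndsAt-∈ stop = here refl
EndsAt-∈ (there h) = there (EndsAt-∈ h)

Closed : ∀ {n} → Rel n → List (Fin n) → Set
Closed R [] = ⊥
Closed R (x ∷ xs) = Linked R (x ∷ xs ++ [ x ])

record IsCycle {n} (R : Rel n) (c : List (Fin n)) : Set where
  constructor isCycle
  field
    uniq : Unique c
    long : 3 ≤ length c
    clos : Closed R c

CycleWithin : ∀ {n} → Rel n → List (Fin n) → Set
CycleWithin R xs = ∃[ c ] (IsCycle R c × (∀ v → v ∈ c → v ∈ xs))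

CycleWithin-⊆ : ∀ {n} {R : Rel n} {xs ys} → (∀ v → v ∈ xs → v ∈ ys) → CycleWithin R xs → CycleWithin R ys
CycleWithin-⊆ f (c , ic , s) = c , ic , (λ v m → f v (s v m))

Reduced⇒Linked : ∀ {n} {R : Rel n} {xs} → Reduced R xs → Linked R xs
Reduced⇒Linked [-] = [-]
Reduced⇒Linked (step r _ rs) = r ∷ Reduced⇒Linked rs

Linked-prefix : ∀ {n} {R : Rel n} xs {ys} → Linked R (xs ++ ys) → Linked R xs
Linked-prefix [] l = []
Linked-prefix (x ∷ []) l = [-]
Linked-prefix (x ∷ y ∷ xs) (r ∷ l) = r ∷ Linked-prefix (y ∷ xs) l

Linked-suffix : ∀ {n} {R : Rel n} xs {ys} → Linked R (xs ++ ys) → Linked R ys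
Linked-suffix [] l = l
Linked-suffix (x ∷ []) [-] = []
Linked-suffix (x ∷ []) (r ∷ l) = l
Linked-suffix (x ∷ y ∷ xs) (r ∷ l) = Linked-suffix (y ∷ xs) l

Unique-prefix : ∀ {n} xs {ys : List (Fin n)} → Unique (xs ++ ys) → Unique xs
Unique-prefix [] u = []
Unique-prefix (x ∷ xs) (p ∷ u) = AllP.++⁻ˡ xs p ∷ Unique-prefix xs u

Unique-suffix : ∀ {n} xs {ys : List (Fin n)} → Unique (xs ++ ys) → Unique ys
Unique-suffix [] u = u
Unique-suffix (x ∷ xs) (p ∷ u) = Unique-suffix xs u

Unique-disjoint : ∀ {n} xs {ys : List (Fin n)} {e} → Unique (xs ++ ys) → e ∈ xs → e ∈ ys → ⊥
Unique-disjoint (x ∷ xs) (p ∷ u) (here refl) m = All.lookup p (∈-++⁺ʳ xs m) refl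
Unique-disjoint (x ∷ xs) (p ∷ u) (there q) m = Unique-disjoint xs u q m

∉⇒All≢ : ∀ {n} {x : Fin n} {xs} → x ∉ xs → All (x ≢_) xs
∉⇒All≢ x∉ = All.tabulate (λ { m refl → x∉ m })

-- The first repetition of a vertex on a reduced walk closes a cycle.
reduced-unique : ∀ {n} {R : Rel n} → (∀ v → ¬ R v v) → ∀ {xs} → Reduced R xs → Unique xs ⊎ CycleWithin R xs
reduced-unique irr [-] = inj₁ ([] ∷ [])
reduced-unique {R = R} irr {x ∷ y ∷ ys} rw@(step r hd rs) with reduced-unique irr rs
... | inj₂ c = inj₂ (CycleWithin-⊆ (λ _ → there) c)
... | inj₁ u with x ∈? (y ∷ ys)
...   | no x∉ = inj₁ (∉⇒All≢ x∉ ∷ u)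
...   | yes x∈ with ∈-∃++ x∈
-- A return after one step is a loop and a return after two steps backtracks, so the remaining case
-- has at least three vertices.
...     | [] , bs , refl = ⊥-elim (irr x r)
...     | a ∷ [] , bs , refl = ⊥-elim (hd refl)
...     | as@(_ ∷ _ ∷ _) , bs , refl = inj₂ (x ∷ as ,
            isCycle (∉⇒All≢ (λ m → Unique-disjoint as u m (here refl)) ∷ Unique-prefix as u)
                    (s≤s (s≤s (s≤s z≤n)))
                    (Linked-prefix (x ∷ as ++ [ x ]) (subst (Linked R) (cong (x ∷_) (sym (++-assoc as [ x ] bs))) (Reduced⇒Linked rw))) ,
            λ { v (here refl) → here refl ; v (there m) → there (∈-++⁺ˡ m) })

-- Reversing one walk and continuing with the other can backtrack only at the common start `x`,
-- which is what `HeadsDiffer xs ys` excludes.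
reduced-revjoin : ∀ {n} {R : Rel n} → (∀ {u v} → R u v → R v u) → ∀ {x xs ys} →
  Reduced R (x ∷ xs) → Reduced R (x ∷ ys) → HeadsDiffer xs ys → Reduced R (xs ʳ++ (x ∷ ys))
reduced-revjoin sy [-] rys hd = rys
reduced-revjoin sy {ys = ys} (step {y = a} {ys = as} r h rs) rys hd =
  reduced-revjoin sy rs (step (sy r) (flip-hd ys hd) rys) (flip-hd2 as h)
  where
  flip-hd : ∀ ys → HeadsDiffer (a ∷ as) ys → HeadsDiffer [ a ] ys
  flip-hd [] _ = tt
  flip-hd (_ ∷ _) p = p
  flip-hd2 : ∀ {x} {zs} as → HeadsDiffer [ x ] as → HeadsDiffer as (x ∷ zs)
  flip-hd2 [] _ = tt
  flip-hd2 (_ ∷ _) p = λ e → p (sym e)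

∈-ʳ++⁻ : ∀ {n} (xs : List (Fin n)) {ys v} → v ∈ xs ʳ++ ys → v ∈ xs ⊎ v ∈ ys
∈-ʳ++⁻ [] m = inj₂ m
∈-ʳ++⁻ (x ∷ xs) m with ∈-ʳ++⁻ xs m
... | inj₁ q = inj₁ (there q)
... | inj₂ (here refl) = inj₁ (here refl)
... | inj₂ (there q) = inj₂ q

∈-ʳ++⁺ʳ : ∀ {n} (xs : List (Fin n)) {ys v} → v ∈ ys → v ∈ xs ʳ++ ys
∈-ʳ++⁺ʳ [] m = m
∈-ʳ++⁺ʳ (x ∷ xs) m = ∈-ʳ++⁺ʳ xs (there m)

Unique-ʳ++-disjoint : ∀ {n} (xs : List (Fin n)) {ys e} → Unique (xs ʳ++ ys) → e ∈ xs → e ∈ ys → ⊥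
Unique-ʳ++-disjoint xs {ys} u m q = Unique-disjoint (reverse xs) (subst Unique (ʳ++-defn xs) u) (AnyP.reverse⁺ m) q

-- After the common initial part is stripped, the reverse of one walk followed by the other is
-- reduced and visits `e` twice, so a repetition closes a cycle. If one walk stops where they part,
-- the other returns to its own start.
two-reduced-walks : ∀ {n} {R : Rel n} → (∀ {u v} → R u v → R v u) → (∀ v → ¬ R v v) → ∀ {h p q e} →
  Reduced R (h ∷ p) → Reduced R (h ∷ q) → EndsAt e (h ∷ p) → EndsAt e (h ∷ q) → p ≢ q →
  CycleWithin R ((h ∷ p) ++ (h ∷ q))
two-reduced-walks sy irr {p = []} {[]} rp rq ep eq ne = ⊥-elim (ne refl)
two-reduced-walks sy irr {h} {[]} {b ∷ q} rp rq stop (there eq) ne with reduced-unique irr rq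
... | inj₁ (u ∷ _) = ⊥-elim (All.lookup u (EndsAt-∈ eq) refl)
... | inj₂ c = CycleWithin-⊆ (λ _ → there) c
two-reduced-walks sy irr {h} {a ∷ p} {[]} rp rq (there ep) stop ne with reduced-unique irr rp
... | inj₁ (u ∷ _) = ⊥-elim (All.lookup u (EndsAt-∈ ep) refl)
... | inj₂ c = CycleWithin-⊆ (λ _ → ∈-++⁺ˡ) c
two-reduced-walks sy irr {h} {a ∷ p} {b ∷ q} rp@(step _ _ rp') rq@(step _ _ rq') (there ep) (there eq) ne with a ≟ b
... | yes refl = CycleWithin-⊆ (λ v m → sub v (∈-++⁻ (a ∷ p) m)) (two-reduced-walks sy irr rp' rq' ep eq (λ { refl → ne refl }))
  where
  sub : ∀ v → v ∈ a ∷ p ⊎ v ∈ a ∷ q → v ∈ (h ∷ a ∷ p) ++ (h ∷ a ∷ q)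
  sub v (inj₁ m) = ∈-++⁺ˡ {xs = h ∷ a ∷ p} (there m)
  sub v (inj₂ m) = ∈-++⁺ʳ (h ∷ a ∷ p) (there m)
... | no a≢b with reduced-unique irr (reduced-revjoin sy rp rq a≢b)
...   | inj₁ u = ⊥-elim (Unique-ʳ++-disjoint (a ∷ p) u (EndsAt-∈ ep) (there (EndsAt-∈ eq)))
...   | inj₂ c = CycleWithin-⊆ (λ v m → sub v (∈-ʳ++⁻ (a ∷ p) m)) c
  where
  sub : ∀ v → v ∈ a ∷ p ⊎ v ∈ h ∷ b ∷ q → v ∈ (h ∷ a ∷ p) ++ (h ∷ b ∷ q)
  sub v (inj₁ m) = ∈-++⁺ˡ {xs = h ∷ a ∷ p} (there m)
  sub v (inj₂ m) = ∈-++⁺ʳ (h ∷ a ∷ p) m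

module _ {n} (R : Rel n) (sy : ∀ {u v} → R u v → R v u) (irr : ∀ v → ¬ R v v) (U : VSet n)
         (next : ∀ {p v} → R p v → ∃[ w ] (R v w × w ≢ p))
         (next₂ : ∀ {p v} → R p v → U v ≡ true →
                  ∃[ w₁ ] ∃[ w₂ ] (R v w₁ × R v w₂ × w₁ ≢ p × w₂ ≢ p × w₁ ≢ w₂))
         where

  -- A walk entering `v` from `p` that makes `r` branchings and stops at the next vertex of `U`. The
  -- bound `few` counts from `v` on, so that prepending a vertex raises it by at most one.
  record BranchWalk (r : ℕ) (p v : Fin n) : Set where
    constructor branchWalk
    field
      rest : List (Fin n)
      red : Reduced R (p ∷ v ∷ rest)
      end : Fin n
      ends : EndsAt end (v ∷ rest)
      end∈U : U end ≡ true
      few : cnt U (v ∷ rest) ≤ suc r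
  open BranchWalk

  _#_ : ∀ {r p v} → BranchWalk r p v → BranchWalk r p v → Set
  w # w' = rest w ≢ rest w'

  FewCycle : ℕ → Set
  FewCycle B = ∃[ c ] (IsCycle R c × cnt U c ≤ B)

  WalkTree : ℕ → Fin n → Fin n → Set
  WalkTree r p v = Σ (List (BranchWalk r p v)) λ ws → length ws ≡ 2 ^ r × AllPairs _#_ ws

  Escape : ℕ → Fin n → Fin n → Set
  Escape m p v = ∃[ t ] (Reduced R (p ∷ v ∷ t) × length t ≡ m × (∀ x → x ∈ v ∷ t → U x ≡ false))

  -- The `n + 1` vertices after `p` cannot all differ. The resulting cycle meets `U` at most in `p`.
  escape-cycle : ∀ {p v} → Escape n p v → FewCycle 1
  escape-cycle {p} {v} (t , rw , len , nU) with reduced-unique irr rw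
  ... | inj₁ (_ ∷ u) = ⊥-elim (1+n≰n (≤-trans (≤-reflexive (cong suc (sym len))) (unique-length≤n u)))
  ... | inj₂ (c , ic , s) = c , ic , ≤-trans (unique-cnt≤ U (IsCycle.uniq ic) s)
      (≤-trans (≤-reflexive (cong (b2n (U p) +_) (cnt-none U (v ∷ t) nU))) (≤-trans (≤-reflexive (+-identityʳ _)) (b2n≤1 (U p))))

  extend : ∀ {r p v w} → R p v → w ≢ p → U v ≡ false → BranchWalk r v w → BranchWalk r p v
  extend {v = v} {w} rpv ne nU (branchWalk t rw e en eU fw) =
    branchWalk (w ∷ t) (step rpv (λ q → ne (sym q)) rw) e (there en) eU
      (subst (λ b → b2n b + cnt U (w ∷ t) ≤ _) (sym nU) fw)

  branch : ∀ {r p v w} → R p v → w ≢ p → BranchWalk r v w → BranchWalk (suc r) p v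
  branch {v = v} {w} rpv ne (branchWalk t rw e en eU fw) =
    branchWalk (w ∷ t) (step rpv (λ q → ne (sym q)) rw) e (there en) eU
      (+-mono-≤ (b2n≤1 (U v)) fw)

  -- Degree-two stretches are followed with fuel m; running out of fuel n forces a repeated vertex.
  walkTree : ∀ r m {p v} → R p v → FewCycle 1 ⊎ (WalkTree r p v ⊎ Escape m p v)
  walkTree r m {p} {v} rpv with bool-cases (U v)
  walkTree zero m {p} {v} rpv | inj₁ uv =
    inj₂ (inj₁ ([ branchWalk [] (step rpv tt [-]) v stop uv (+-mono-≤ (b2n≤1 (U v)) z≤n) ] , refl , [] ∷ []))
  walkTree (suc r) m {p} {v} rpv | inj₁ uv with next₂ rpv uv
  ... | w₁ , w₂ , r₁ , r₂ , n₁ , n₂ , n₁₂ with walkTree r n r₁ | walkTree r n r₂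
  ...   | inj₁ c | _ = inj₁ c
  ...   | inj₂ (inj₂ x) | _ = inj₁ (escape-cycle x)
  ...   | inj₂ (inj₁ _) | inj₁ c = inj₁ c
  ...   | inj₂ (inj₁ _) | inj₂ (inj₂ x) = inj₁ (escape-cycle x)
  ...   | inj₂ (inj₁ (ws₁ , l₁ , d₁)) | inj₂ (inj₁ (ws₂ , l₂ , d₂)) =
    inj₂ (inj₁ (map (branch rpv n₁) ws₁ ++ map (branch rpv n₂) ws₂ , len ,
      AllPairsP.++⁺ (AllPairsP.map⁺ (mapAP n₁ d₁)) (AllPairsP.map⁺ (mapAP n₂ d₂))
        (AllP.map⁺ (All.tabulate λ _ → AllP.map⁺ (All.tabulate λ _ e → n₁₂ (∷-injectiveˡ e))))))
    where
    mapAP : ∀ {w} {ws : List (BranchWalk r v w)} (ne : w ≢ p) → AllPairs _#_ ws → AllPairs (λ a b → branch rpv ne a # branch rpv ne b) ws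
    mapAP ne [] = []
    mapAP ne (a ∷ as) = All.map (λ { d refl → d refl }) a ∷ mapAP ne as
    len : length (map (branch rpv n₁) ws₁ ++ map (branch rpv n₂) ws₂) ≡ 2 ^ suc r
    len rewrite length-++ (map (branch rpv n₁) ws₁) {map (branch rpv n₂) ws₂} | length-map (branch rpv n₁) ws₁
      | length-map (branch rpv n₂) ws₂ | l₁ | l₂ | +-identityʳ (2 ^ r) = refl
  walkTree r zero {p} {v} rpv | inj₂ nU = inj₂ (inj₂ ([] , step rpv tt [-] , refl , λ { x (here refl) → nU }))
  walkTree r (suc m) {p} {v} rpv | inj₂ nU with next rpv
  ... | w , rvw , ne with walkTree r m rvw
  ...   | inj₁ c = inj₁ c
  ...   | inj₂ (inj₁ (ws , l , d)) = inj₂ (inj₁ (map (extend rpv ne nU) ws , trans (length-map _ ws) l , AllPairsP.map⁺ (mapAP d)))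
    where
    mapAP : ∀ {ws : List (BranchWalk r v w)} → AllPairs _#_ ws → AllPairs (λ a b → extend rpv ne nU a # extend rpv ne nU b) ws
    mapAP [] = []
    mapAP (a ∷ as) = All.map (λ { d refl → d refl }) a ∷ mapAP as
  ...   | inj₂ (inj₂ (t , rw , l , h)) =
    inj₂ (inj₂ (w ∷ t , step rpv (λ q → ne (sym q)) rw , cong suc l , λ { x (here refl) → nU ; x (there q) → h x q }))

  collision : ∀ {r p v} (ws : List (BranchWalk r p v)) → AllPairs _#_ ws →
    (Σ (BranchWalk r p v) λ a → Σ (BranchWalk r p v) λ b → a # b × end a ≡ end b) ⊎ AllPairs (λ a b → end a ≢ end b) ws
  collision [] [] = inj₂ []
  collision (w ∷ ws) (d ∷ ds) with collision ws ds
  ... | inj₁ x = inj₁ x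
  ... | inj₂ y with All.all? (λ b → ¬? (end w ≟ end b)) ws
  ...   | yes z = inj₂ (z ∷ y)
  ...   | no z with AllP.¬All⇒Any¬ (λ b → ¬? (end w ≟ end b)) ws z
  ...     | q with find q
  ...       | b , b∈ , nn with end w ≟ end b
  ...         | yes e = inj₁ (w , b , All.lookup d b∈ , e)
  ...         | no ne = ⊥-elim (nn ne)

  few-cycle : ∀ r {p v} → R p v → size U < 2 ^ r → FewCycle (4 + (r + r))
  few-cycle r {p} {v} rpv h with walkTree r n rpv
  ... | inj₁ (c , ic , f) = c , ic , ≤-trans f (s≤s z≤n)
  ... | inj₂ (inj₂ x) with c , ic , f ← escape-cycle x = c , ic , ≤-trans f (s≤s z≤n)
  ... | inj₂ (inj₁ (ws , l , d)) with collision ws d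
  ...   | inj₂ y = ⊥-elim (<⇒≱ h (subst (_≤ size U) (trans (length-map end ws) l)
             (unique-length≤size U (AllPairsP.map⁺ y) (λ x m → endU (∈-map⁻ end m)))))
    where
    endU : ∀ {x} → ∃[ w ] (w ∈ ws × x ≡ end w) → U x ≡ true
    endU (w , _ , refl) = end∈U w
  ...   | inj₁ (a , b , a#b , e) with two-reduced-walks sy irr (red a) (red b) (there (ends a)) (subst (λ z → EndsAt z _) (sym e) (there (ends b))) (λ { refl → a#b refl })
  -- Each of the two walks contributes `p` and at most `r + 1` further vertices of `U`.
  ...     | c , ic , s = c , ic , ≤-trans (unique-cnt≤ U (IsCycle.uniq ic) s)
      (≤-trans (≤-reflexive (cnt-++ U (p ∷ v ∷ rest a) (p ∷ v ∷ rest b)))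
        (≤-trans (+-mono-≤ (+-mono-≤ (b2n≤1 (U p)) (few a)) (+-mono-≤ (b2n≤1 (U p)) (few b))) (≤-reflexive (lem r))))
    where
    lem : ∀ r → (1 + (1 + r)) + (1 + (1 + r)) ≡ 4 + (r + r)
    lem = solve-∀

-- Disjoint cycles in subcubic graphs

Core : ∀ {n} → List (Edge n) → VSet n → Set
Core es W = ∀ v → W v ≡ true → 2 ≤ cnt W (nb es v)

_⊑_ : ∀ {n} → VSet n → VSet n → Set
A ⊑ B = ∀ v → A v ≡ true → B v ≡ true

rem-⊑ : ∀ {n} (x : Fin n) (A : VSet n) → rem x A ⊑ A
rem-⊑ x A v e = proj₁ (rem⁻ A e)

-- The 2-core of `A`. A deleted vertex takes at most one edge with it, so |E| - |V| does not drop;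
-- `excess` states this without subtraction.
record Pruned {n} (es : List (Edge n)) (A : VSet n) : Set where
  constructor pruned
  field
    kept : VSet n
    kept⊑ : kept ⊑ A
    core : Core es kept
    greatest : ∀ W → Core es W → W ⊑ A → W ⊑ kept
    excess : edges es A + size kept ≤ edges es kept + size A

low-vertex? : ∀ {n} (es : List (Edge n)) (A : VSet n) → Dec (∃[ v ] (A v ≡ true × cnt A (nb es v) ≤ 1))
low-vertex? es A = any? (λ v → (A v ≟ᵇ true) ×-dec (cnt A (nb es v) ≤? 1))

prune : ∀ {n} (es : List (Edge n)) → Loopless es → (m : ℕ) (A : VSet n) → size A ≤ m → Pruned es A
prune es ll m A h with low-vertex? es A
... | no nl = pruned A (λ _ e → e) (λ v e → ≰⇒> (λ q → nl (v , e , q))) (λ _ _ s → s) ≤-refl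
prune es ll zero A h | yes (v , e , q) = ⊥-elim (<⇒≱ (size-∈ A e) h)
prune es ll (suc m) A h | yes (v , e , q)
  with pruned K K⊑ c g x ← prune es ll m (rem v A) (s≤s⁻¹ (subst (_≤ suc m) (size-rem A e) h)) =
  pruned K (λ u w → rem-⊑ v A u (K⊑ u w)) c
    -- A core inside `A` cannot contain `v`, which has at most one neighbour in `A`.
    (λ W cW s → g W cW (λ u w → rem⁺ A (s u w) (λ { refl → <⇒≱ (s≤s q) (≤-trans (cW u w) (cnt-mono (nb es u) (λ y _ → s y))) })))
    bound
  where
  bound : edges es A + size K ≤ edges es K + size A
  bound rewrite edges-rem es A ll e | size-rem A e | +-suc (edges es K) (size (rem v A)) =
    ≤-trans (≤-reflexive (+-assoc (cnt (rem v A) (nb es v)) (edges es (rem v A)) (size K)))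
      (+-mono-≤ (≤-trans (cnt-mono (nb es v) (λ y _ → rem-⊑ v A y)) q) x)

excess-kept : ∀ {n} (es : List (Edge n)) {A K : VSet n} {t} → edges es A + size K ≤ edges es K + size A →
  size A + t ≤ edges es A → size K + t ≤ edges es K
excess-kept es {A} {K} {t} ex x = +-cancelˡ-≤ (size A) _ _ (≤-trans (≤-reflexive (lem (size A) (size K) t))
  (≤-trans (+-monoˡ-≤ (size K) x) (≤-trans ex (≤-reflexive (+-comm (edges es K) (size A))))))
  where
  lem : ∀ a b c → a + (b + c) ≡ a + c + b
  lem = solve-∀

infixl 6 _∖_
_∖_ : ∀ {n} → VSet n → List (Fin n) → VSet n
A ∖ [] = A
A ∖ (x ∷ xs) = rem x A ∖ xs

∖⁻ : ∀ {n} (A : VSet n) xs {v} → (A ∖ xs) v ≡ true → A v ≡ true × v ∉ xs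
∖⁻ A [] e = e , λ ()
∖⁻ A (x ∷ xs) e with ∖⁻ (rem x A) xs e
... | r , v∉ = proj₁ (rem⁻ A r) , λ { (here q) → proj₂ (rem⁻ A r) q ; (there m) → v∉ m }

cnt-strict : {A : Set} {P Q : A → Bool} (xs : List A) → (∀ x → P x ≡ true → Q x ≡ true) →
  ∀ {x} → x ∈ xs → Q x ≡ true → P x ≡ false → suc (cnt P xs) ≤ cnt Q xs
cnt-strict (x ∷ xs) f (here refl) q p rewrite q | p = s≤s (cnt-mono xs (λ y _ → f y))
cnt-strict {P = P} {Q} (x ∷ xs) f (there m) q p =
  ≤-trans (≤-reflexive (sym (+-suc (b2n (P x)) _))) (+-mono-≤ (b2n-mono (f x)) (cnt-strict xs f m q p))

Adj : ∀ {n} → List (Edge n) → Rel n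
Adj es u v = v ∈ nb es u

Disjoint : ∀ {n} → List (Fin n) → List (Fin n) → Set
Disjoint c d = ∀ v → v ∈ c → v ∈ d → ⊥

Closed-map : ∀ {n} {R S : Rel n} → (∀ {u v} → R u v → S u v) → ∀ c → Closed R c → Closed S c
Closed-map f (x ∷ c) l = Linked.map f l

IsCycle-map : ∀ {n} {R S : Rel n} → (∀ {u v} → R u v → S u v) → ∀ {c} → IsCycle R c → IsCycle S c
IsCycle-map f {c} (isCycle u l cl) = isCycle u l (Closed-map f c cl)

module _ {n} (es : List (Edge n)) (A : VSet n) where

  AdjIn : Rel n
  AdjIn u v = A u ≡ true × A v ≡ true × v ∈ nb es u

  linked⊑ : ∀ {x y xs} → Linked AdjIn (x ∷ y ∷ xs) → ∀ v → v ∈ x ∷ y ∷ xs → A v ≡ true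
  linked⊑ ((a , _) ∷ _) v (here refl) = a
  linked⊑ ((_ , b , _) ∷ [-]) v (there (here refl)) = b
  linked⊑ (_ ∷ l@(_ ∷ _)) v (there m) = linked⊑ l v m

  cycle⊑ : ∀ {c} → IsCycle AdjIn c → ∀ v → v ∈ c → A v ≡ true
  cycle⊑ {x ∷ []} (isCycle _ (s≤s ()) _)
  cycle⊑ {x ∷ y ∷ xs} (isCycle _ _ l) v m = linked⊑ l v (∈-++⁺ˡ {xs = x ∷ y ∷ xs} m)

  branching : VSet n
  branching v = 3 ≤ᵇ cnt A (nb es v)

module _ {n} (es : List (Edge n)) (ll : Loopless es) (simple : ∀ v → Unique (nb es v)) where

  another : ∀ {A : VSet n} {v} m p → suc m ≤ cnt A (nb es v) → m ≤ cnt (rem p A) (nb es v)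
  another {A} {v} m p h = s≤s⁻¹ (≤-trans h (cnt≤suc-rem p A (simple v)))

  module _ {A : VSet n} (core : Core es A) where
    private R = AdjIn es A

    R-sym : ∀ {u v} → R u v → R v u
    R-sym (a , b , m) = b , a , nb-sym es m

    R-irr : ∀ v → ¬ R v v
    R-irr v (_ , _ , m) = ll v m

    R-next : ∀ {p v} → R p v → ∃[ w ] (R v w × w ≢ p)
    R-next {p} {v} (_ , b , _) with w , m , e ← cnt-pos (rem p A) (nb es v) (another 1 p (core v b)) =
      w , (b , rem-⊑ p A w e , m) , proj₂ (rem⁻ A e)

    R-next₂ : ∀ {p v} → R p v → branching es A v ≡ true →
      ∃[ w₁ ] ∃[ w₂ ] (R v w₁ × R v w₂ × w₁ ≢ p × w₂ ≢ p × w₁ ≢ w₂)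
    R-next₂ {p} {v} (_ , b , _) br with another {A} {v} 2 p (≤ᵇ⇒≤ 3 _ (Equivalence.from T-≡ br))
    ... | h with w₁ , m₁ , e₁ ← cnt-pos (rem p A) (nb es v) (≤-trans (s≤s z≤n) h)
          with w₂ , m₂ , e₂ ← cnt-pos (rem w₁ (rem p A)) (nb es v) (another 1 w₁ h)
          with e₂' , w₂≢w₁ ← rem⁻ (rem p A) e₂ =
      w₁ , w₂ , (b , rem-⊑ p A w₁ e₁ , m₁) , (b , rem-⊑ p A w₂ e₂' , m₂) ,
      proj₂ (rem⁻ A e₁) , proj₂ (rem⁻ A e₂') , (λ q → w₂≢w₁ (sym q))

    core-cycle : ∀ r {x} → A x ≡ true → size (branching es A) < 2 ^ r →
      ∃[ c ] (IsCycle R c × cnt (branching es A) c ≤ 4 + (r + r))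
    core-cycle r {x} ax h
      with w , m , e ← cnt-pos A (nb es x) (≤-trans (s≤s z≤n) (core x ax)) =
      few-cycle R R-sym R-irr (branching es A) R-next R-next₂ r (ax , e , m) h

  module _ (A : VSet n) (deg≤3 : ∀ v → deg es v ≤ 3) where
    private R = AdjIn es A

    cnt≤2+branching : ∀ v → cnt A (nb es v) ≤ 2 + b2n (branching es A v)
    cnt≤2+branching v with 3 ≤? cnt A (nb es v)
    ... | yes h rewrite Equivalence.to T-≡ (≤⇒≤ᵇ h) = ≤-trans (cnt≤length A (nb es v)) (deg≤3 v)
    ... | no h = ≤-trans (≤-pred (≰⇒> h)) (m≤m+n 2 _)

    -- When `y` is deleted, its edge to the predecessor `p` is already gone. Hence `y` takes at most
    -- one edge, or two if it branches in `A`, and |E| - |V| falls only at branching vertices.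
    delete-path : ∀ (B : VSet n) p ys → B ⊑ A → B p ≡ false → Linked R (p ∷ ys) → Unique ys → (∀ y → y ∈ ys → B y ≡ true) →
      edges es B + size (B ∖ ys) ≤ edges es (B ∖ ys) + size B + cnt (branching es A) ys
    delete-path B p [] s np l u i = ≤-reflexive (sym (+-identityʳ _))
    delete-path B p (y ∷ ys) s np ((pa , ya , m) ∷ l) (u₀ ∷ u) i
      rewrite edges-rem es B ll (i y (here refl)) | size-rem B (i y (here refl)) =
      ≤-trans (≤-reflexive (+-assoc (cnt (rem y B) (nb es y)) _ _))
        (≤-trans (+-mono-≤ small (delete-path (rem y B) y ys (λ v e → s v (rem-⊑ y B v e)) (rem-self y B) l u
            (λ v q → rem⁺ B (i v (there q)) (λ { refl → All.lookup u₀ q refl }))))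
          (≤-reflexive (lem (b2n (branching es A y)) (edges es (rem y B ∖ ys)) (size (rem y B)) (cnt (branching es A) ys))))
      where
      small : cnt (rem y B) (nb es y) ≤ 1 + b2n (branching es A y)
      small = s≤s⁻¹ (≤-trans (cnt-strict {P = rem y B} {A} (nb es y) (λ v e → s v (rem-⊑ y B v e)) (nb-sym es m) pa
                (trans (rem-other B (λ { refl → true≢false (i y (here refl)) np })) np)) (cnt≤2+branching y))
      lem : ∀ b e z c → 1 + b + (e + z + c) ≡ e + suc z + (b + c)
      lem = solve-∀

    -- The first vertex has no deleted predecessor, which accounts for the additional `1`; the rest
    -- of the cycle is a path starting next to it.
    delete-cycle : ∀ {c} → IsCycle R c →
      edges es A + size (A ∖ c) ≤ edges es (A ∖ c) + size A + (1 + cnt (branching es A) c)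
    delete-cycle {x ∷ ys} ic@(isCycle (u₀ ∷ u) lg l)
      rewrite edges-rem es A ll (cycle⊑ es A ic x (here refl)) | size-rem A (cycle⊑ es A ic x (here refl)) =
      ≤-trans (≤-reflexive (+-assoc (cnt (rem x A) (nb es x)) _ _))
        (≤-trans (+-mono-≤ (≤-trans (cnt-mono (nb es x) (λ y _ → rem-⊑ x A y)) (cnt≤2+branching x))
            (delete-path (rem x A) x ys (rem-⊑ x A) (rem-self x A) (Linked-prefix (x ∷ ys) l) u
              (λ v q → rem⁺ A (cycle⊑ es A ic v (there q)) (λ { refl → All.lookup u₀ q refl }))))
          (≤-reflexive (lem (b2n (branching es A x)) (edges es (rem x A ∖ ys)) (size (rem x A)) (cnt (branching es A) ys))))
      where
      lem : ∀ b e z c → 2 + b + (e + z + c) ≡ e + suc z + (1 + (b + c))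
      lem = solve-∀

  record Packing (k : ℕ) (A : VSet n) : Set where
    constructor packing
    field
      cycles : List (List (Fin n))
      number : length cycles ≡ k
      areCycles : All (IsCycle (Adj es)) cycles
      inside : All (λ c → ∀ v → v ∈ c → A v ≡ true) cycles
      disjoint : AllPairs Disjoint cycles

  -- 5 + 2 r: a cycle with at most 4 + 2 r branching vertices lowers edges − vertices by one more at most.
  many-cycles : (∀ v → deg es v ≤ 3) → ∀ r → size {n} (λ v → 3 ≤ᵇ deg es v) < 2 ^ r →
    ∀ k A → size A + k * (5 + (r + r)) ≤ edges es A → Packing k A
  many-cycles deg≤3 r h zero A x = packing [] refl [] [] []
  many-cycles deg≤3 r h (suc k) A x with prune es ll n A (size≤n A)
  ... | pruned K K⊑ co g ex with cnt-pos (within K) es edge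
    where
    edge : 1 ≤ edges es K
    edge = ≤-trans (s≤s z≤n) (≤-trans (m≤n+m (suc k * (5 + (r + r))) (size K)) (excess-kept es ex x))
  ...   | (a , b) , _ , ab with core-cycle co r (proj₁ (∧-true⁻ ab)) few
    where
    few : size (branching es K) < 2 ^ r
    few = ≤-<-trans (size-mono {W = branching es K} (λ v e → Equivalence.to T-≡
      (≤⇒≤ᵇ (≤-trans (≤ᵇ⇒≤ 3 _ (Equivalence.from T-≡ e)) (cnt≤length K (nb es v)))))) h
  ...     | c , ic , cf with many-cycles deg≤3 r h k (K ∖ c) rest
    where
    D = 5 + (r + r)
    rest : size (K ∖ c) + k * D ≤ edges es (K ∖ c)
    rest = +-cancelˡ-≤ (size K + D) _ _ (≤-trans (≤-reflexive (lem (size K) D (size (K ∖ c)) (k * D)))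
        (≤-trans (+-monoˡ-≤ (size (K ∖ c)) (excess-kept es {t = suc k * D} ex x)) (≤-trans (delete-cycle K deg≤3 ic)
          (≤-trans (+-monoʳ-≤ (edges es (K ∖ c) + size K) (s≤s cf)) (≤-reflexive (lem₂ (edges es (K ∖ c)) (size K) D))))))
      where
      lem : ∀ a d b c → a + d + (b + c) ≡ a + (d + c) + b
      lem = solve-∀
      lem₂ : ∀ a b d → a + b + d ≡ b + d + a
      lem₂ = solve-∀
  ...       | packing cs num ac ins dj =
    packing (c ∷ cs) (cong suc num) (IsCycle-map (λ { (_ , _ , m) → m }) ic ∷ ac)
      ((λ v m → K⊑ v (cycle⊑ es K ic v m)) ∷ All.map (λ f v m → K⊑ v (proj₁ (∖⁻ K c (f v m)))) ins)
      (All.map (λ f v m q → proj₂ (∖⁻ K c (f v q)) m) ins ∷ dj)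

nonNull : {A : Set} → List A → Bool
nonNull [] = false
nonNull (_ ∷ _) = true

support : ∀ {n} → List (Edge n) → VSet n
support es v = nonNull (nb es v)

cubic : ∀ {n} → List (Edge n) → VSet n
cubic es v = 3 ≤ᵇ deg es v

nonNull-∈ : {A : Set} {x : A} {xs : List A} → x ∈ xs → nonNull xs ≡ true
nonNull-∈ (here _) = refl
nonNull-∈ (there _) = refl

-- The degree sum is at least `2 |V|` plus the number of cubic vertices, and it equals `2 |E|`.
-- Every cubic vertex thus adds one half to |E| - |V|.
support-excess : ∀ {n} (es : List (Edge n)) → (∀ v → support es v ≡ true → 2 ≤ deg es v) →
  ∀ m → m + m ≤ size (cubic es) → size (support es) + m ≤ edges es (support es)
support-excess {n} es min2 m h = *-cancelˡ-≤ 2 (≤-trans (≤-reflexive (lem (size V) m))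
   (≤-trans (+-monoʳ-≤ (2 * size V) (≤-trans h (cnt-mono (allFin n) (λ v _ e → ∧-true⁺ (cubic⇒ v e) e))))
   (≤-trans (≤-reflexive (sym (Σ-size V (cubic es) 2 (allFin n))))
   (≤-trans (Σ-mono V (allFin n) bound) (≤-reflexive (trans (handshake es V) (cong (edges es V +_) (sym (+-identityʳ _)))))))))
  where
  V = support es
  lem : ∀ a m → 2 * (a + m) ≡ 2 * a + (m + m)
  lem = solve-∀
  cubic⇒ : ∀ v → cubic es v ≡ true → V v ≡ true
  cubic⇒ v e with nb es v | ≤ᵇ⇒≤ 3 (deg es v) (Equivalence.from T-≡ e)
  ... | _ ∷ _ | _ = refl
  bound : ∀ v → V v ≡ true → 2 + b2n (cubic es v) ≤ cnt V (nb es v)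
  bound v e rewrite cnt-all V (nb es v) (λ u q → nonNull-∈ (nb-sym es q)) with bool-cases (cubic es v)
  ... | inj₁ c = ≤-trans (+-monoʳ-≤ 2 (b2n≤1 _)) (≤ᵇ⇒≤ 3 _ (Equivalence.from T-≡ c))
  ... | inj₂ c rewrite c = min2 v e

-- Frames

-- Long cycles are expressed through cores (vertex sets of minimum degree 2), so that the cycles of a
-- modified frame never have to be traced.
record Frame {n} (G : Graph n) (L : ℕ) (es : List (Edge n)) : Set where
  constructor frame
  field
    inG : ∀ u v → v ∈ nb es u → T (adj G u v)
    degrees : ∀ v → deg es v ≡ 0 ⊎ (2 ≤ deg es v × deg es v ≤ 3)
    girth : ∀ W → Core es W → ∀ {w} → W w ≡ true → L ≤ size W

size-mem≤ : ∀ {n} (xs : List (Fin n)) → size (mem xs) ≤ length xs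
size-mem≤ {n} [] = ≤-reflexive (cnt-none (mem []) (allFin n) (λ _ _ → mem-∉⁺ λ ()))
size-mem≤ (x ∷ xs) = ≤-trans (size≤suc-rem x (mem (x ∷ xs)))
  (s≤s (≤-trans (size-mono {W = rem x (mem (x ∷ xs))} (λ v e → mem⁺ (drop v (rem⁻ (mem (x ∷ xs)) e)))) (size-mem≤ xs)))
  where
  drop : ∀ v → mem (x ∷ xs) v ≡ true × v ≢ x → v ∈ xs
  drop v (e , ne) with mem⁻ {xs = x ∷ xs} e
  ... | here q = ⊥-elim (ne q)
  ... | there m = m

single-self : ∀ {n} (x : Fin n) → single x x ≡ true
single-self x = dec-true (x ≟ x) refl

unique-if-mult≤1 : ∀ {n} (xs : List (Fin n)) → (∀ u → cnt (single u) xs ≤ 1) → Unique xs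
unique-if-mult≤1 [] h = []
unique-if-mult≤1 (x ∷ xs) h =
  ∉⇒All≢ (λ m → <⇒≱ (s≤s (cnt-∈ (single x) m (single-self x)))
     (subst (λ b → b2n b + cnt (single x) xs ≤ 1) (single-self x) (h x)))
  ∷ unique-if-mult≤1 xs (λ u → ≤-trans (m≤n+m _ (b2n (single u x))) (h u))

cnt-full : {A : Set} (P : A → Bool) (xs : List A) → length xs ≤ cnt P xs → ∀ {x} → x ∈ xs → P x ≡ true
cnt-full P (x ∷ xs) h m with P x in eq
cnt-full P (x ∷ xs) h (here refl) | true = eq
cnt-full P (x ∷ xs) h (there m) | true = cnt-full P xs (s≤s⁻¹ h) m
cnt-full P (x ∷ xs) h m | false = ⊥-elim (<⇒≱ h (cnt≤length P xs))

length-filterᵇ : {A : Set} (P : A → Bool) (xs : List A) → length (filterᵇ P xs) ≡ cnt P xs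
length-filterᵇ P [] = refl
length-filterᵇ P (x ∷ xs) with P x
... | true = cong suc (length-filterᵇ P xs)
... | false = length-filterᵇ P xs

∈-filterᵇ⁺ : {A : Set} (P : A → Bool) {xs : List A} {x : A} → x ∈ xs → P x ≡ true → x ∈ filterᵇ P xs
∈-filterᵇ⁺ P m e = ∈-filter⁺ (T? ∘ P) m (Equivalence.from T-≡ e)

∈-filterᵇ⁻ : {A : Set} (P : A → Bool) {xs : List A} {x : A} → x ∈ filterᵇ P xs → x ∈ xs × P x ≡ true
∈-filterᵇ⁻ P {xs} m with ∈-filter⁻ (T? ∘ P) {xs = xs} m
... | q , t = q , Equivalence.to T-≡ t

n<2^n : ∀ n → n < 2 ^ n
n<2^n zero = s≤s z≤n
n<2^n (suc n) = ≤-trans (s≤s (n<2^n n)) (≤-trans (+-monoˡ-≤ (2 ^ n) (≤-trans (s≤s z≤n) (n<2^n n))) (≤-reflexive (cong (2 ^ n +_) (sym (+-identityʳ _)))))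

Linked-forward : ∀ {n} {R : Rel n} (P : Fin n → Set) {x xs} → Linked R (x ∷ xs) →
  (∀ {u v} → u ∈ x ∷ xs → R u v → P u → P v) → P x → ∀ {v} → v ∈ x ∷ xs → P v
Linked-forward P l f p (here refl) = p
Linked-forward P (r ∷ l) f p (there m) = Linked-forward P l (λ q → f (there q)) (f (here refl) r p) m

-- The property is carried from `w` to the end of the closed walk, which is its first vertex again,
-- and from there along the whole cycle.
cycle-forward : ∀ {n} {R : Rel n} (P : Fin n → Set) {c} → Closed R c →
  (∀ {u v} → u ∈ c → R u v → P u → P v) → ∀ {w} → w ∈ c → P w → ∀ {v} → v ∈ c → P v
cycle-forward {R = R} P {x ∷ xs} l f w∈ pw m with ∈-∃++ w∈
... | as , bs , e = Linked-forward P l (λ q → f (clean q)) px (∈-++⁺ˡ m)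
  where
  clean : ∀ {u} → u ∈ (x ∷ xs) ++ [ x ] → u ∈ x ∷ xs
  clean q with ∈-++⁻ (x ∷ xs) q
  ... | inj₁ r = r
  ... | inj₂ (here refl) = here refl
  split : (x ∷ xs) ++ [ x ] ≡ as ++ _ ∷ (bs ++ [ x ])
  split = trans (cong (_++ [ x ]) e) (++-assoc as _ [ x ])
  px = Linked-forward P (Linked-suffix as (subst (Linked R) split l))
         (λ q → f (clean (subst (_ ∈_) (sym split) (∈-++⁺ʳ as q)))) pw (there (∈-++⁺ʳ bs (here refl)))

-- A vertex of degree at most two needs all its neighbours to have two inside the core. Cores
-- therefore contain degree-two stretches entirely or not at all.
core-closed : ∀ {n} {es : List (Edge n)} {W} → Core es W → ∀ {u v} → deg es u ≤ 2 → v ∈ nb es u → W u ≡ true → W v ≡ true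
core-closed {es = es} {W} co {u} d m w = cnt-full W (nb es u) (≤-trans d (co u w)) m

module FrameProperties {n} {G : Graph n} {L} (3≤L : 3 ≤ L) {es} (F : Frame G L es) where
  open Frame F

  loopless : Loopless es
  loopless v m = subst T (irrefl G v) (inG v v m)

  -- Edge lists may repeat an edge, but the two ends of a double edge form a core with two vertices,
  -- which the girth condition forbids because `3 ≤ L`.
  simple : ∀ v → Unique (nb es v)
  simple v = unique-if-mult≤1 (nb es v) mult
    where
    mult : ∀ u → cnt (single u) (nb es v) ≤ 1
    mult u with cnt (single u) (nb es v) ≤? 1
    ... | yes h = h
    ... | no h = ⊥-elim (<⇒≱ (≤-trans 3≤L (girth W core (mem⁺ {xs = u ∷ v ∷ []} (here refl)))) (size-mem≤ (u ∷ v ∷ [])))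
      where
      W = mem (u ∷ v ∷ [])
      one : ∀ x → x ∈ u ∷ v ∷ [] → single x ⊑ W
      one x m y e with y ≟ x
      ... | yes refl = mem⁺ {xs = u ∷ v ∷ []} m
      core : Core es W
      core w e with mem⁻ {v = w} {xs = u ∷ v ∷ []} e
      ... | here refl = ≤-trans (≤-trans (≰⇒> h) (≤-reflexive (nb-mult-sym es v u)))
                          (cnt-mono (nb es u) (λ x _ → one v (there (here refl)) x))
      ... | there (here refl) = ≤-trans (≰⇒> h) (cnt-mono (nb es v) (λ x _ → one u (here refl) x))

  deg≤3 : ∀ v → deg es v ≤ 3
  deg≤3 v with degrees v
  ... | inj₁ e = ≤-trans (≤-reflexive e) z≤n
  ... | inj₂ (_ , h) = h

  noncubic-deg≤2 : ∀ {v} → cubic es v ≡ false → deg es v ≤ 2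
  noncubic-deg≤2 {v} e with 3 ≤? deg es v
  ... | yes h = ⊥-elim (true≢false (Equivalence.to T-≡ (≤⇒≤ᵇ h)) e)
  ... | no h = ≤-pred (≰⇒> h)

  support-deg≥2 : ∀ v → support es v ≡ true → 2 ≤ deg es v
  support-deg≥2 v e with nb es v | degrees v
  ... | _ ∷ _ | inj₂ (h , _) = h

  nb-support : ∀ {u v} → v ∈ nb es u → support es v ≡ true
  nb-support m = nonNull-∈ (nb-sym es m)

  core⊑support : ∀ {W} → Core es W → W ⊑ support es
  core⊑support co v e with nb es v | co v e
  ... | _ ∷ _ | _ = refl

  record Transversal (k : ℕ) : Set where
    constructor transversal
    field
      marks : List (Fin n)
      number : length marks ≤ size (cubic es) + k
      hasCubic : ∀ {v} → cubic es v ≡ true → v ∈ marks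
      hits : ∀ W → Core es W → (∀ v → v ∈ marks → W v ≡ false) → ∀ v → W v ≡ false

  -- A core disjoint from the cubic vertices is a union of 2-regular components, so it contains
  -- each of the chosen cycles entirely or not at all: marking one vertex per cycle suffices.
  mark-components : ∀ k cs ms → length ms ≤ length cs → All (IsCycle (Adj es)) cs →
    All (λ c → ∀ v → v ∈ c → support es v ≡ true × cubic es v ≡ false) cs →
    All (Any (_∈ ms)) cs → AllPairs Disjoint cs →
    Packing es loopless simple (k + length cs) (support es) ⊎ Transversal (k + length cs)
  mark-components zero cs ms l ic nc mk dj = inj₁ (packing cs refl ic (All.map (λ f v m → proj₁ (f v m)) nc) dj)
  mark-components (suc k) cs ms l ic nc mk dj with prune es loopless n A₀ (size≤n A₀)
    where
    A₀ : VSet n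
    A₀ = λ v → (support es v ∧ not (cubic es v)) ∧ not (mem ms v)
  ... | pruned K K⊑ co g _ with 1 ≤? size K
  ...   | no emp = inj₂ (transversal (filterᵇ (cubic es) (allFin n) ++ ms)
            (≤-trans (≤-reflexive (length-++ (filterᵇ (cubic es) (allFin n))))
              (+-mono-≤ (≤-reflexive (length-filterᵇ (cubic es) (allFin n))) (≤-trans l (m≤n+m _ (suc k)))))
            (λ {v} e → ∈-++⁺ˡ (∈-filterᵇ⁺ (cubic es) (∈-allFin v) e))
            hit)
    where
    -- A nonempty core free of cubic and marked vertices would lie in `A₀` and survive its pruning,
    -- but nothing survived.
    hit : ∀ W → Core es W → (∀ v → v ∈ filterᵇ (cubic es) (allFin n) ++ ms → W v ≡ false) → ∀ v → W v ≡ false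
    hit W cW av v with bool-cases (W v)
    ... | inj₂ e = e
    ... | inj₁ e = ⊥-elim (emp (size-∈ K (g W cW sub v e)))
      where
      sub : ∀ u → W u ≡ true → (support es u ∧ not (cubic es u)) ∧ not (mem ms u) ≡ true
      sub u w = ∧-true⁺ (∧-true⁺ (core⊑support cW u w) (not-true⁺ nu)) (not-true⁺ (mem-∉⁺ (λ m → true≢false w (av u (∈-++⁺ʳ _ m)))))
        where
        nu : cubic es u ≡ false
        nu with bool-cases (cubic es u)
        ... | inj₂ q = q
        ... | inj₁ q = ⊥-elim (true≢false w (av u (∈-++⁺ˡ (∈-filterᵇ⁺ (cubic es) (∈-allFin u) q))))
  ...   | yes ne with size-pos K ne
  -- `n` can serve as the number of branchings since every vertex set is smaller than `2 ^ n`; here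
  -- any cycle of `K` will do.
  ...     | x , kx with core-cycle es loopless simple co n kx (≤-<-trans (size≤n (branching es K)) (n<2^n n))
  ...       | [] , isCycle _ () _ , _
  ...       | c@(c₀ ∷ _) , icK , _ =
    subst (λ j → Packing es loopless simple j (support es) ⊎ Transversal j) (+-suc k (length cs))
      (mark-components k (c ∷ cs) (c₀ ∷ ms) (s≤s l) (IsCycle-map (λ { (_ , _ , m) → m }) icK ∷ ic)
        ((λ v m → inK v (cycle⊑ es K icK v m)) ∷ nc)
        (here (here refl) ∷ All.map (Any.map there) mk)
        (All.tabulate (λ {d} d∈ v m q → apart d (All.lookup ic d∈) (All.lookup nc d∈) (All.lookup mk d∈) v q (cycle⊑ es K icK v m)) ∷ dj))
    where
    inK : ∀ v → K v ≡ true → support es v ≡ true × cubic es v ≡ false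
    inK v e with ∧-true⁻ (proj₁ (∧-true⁻ (K⊑ v e)))
    ... | s , nq = s , not-true⁻ nq
    apart : ∀ d → IsCycle (Adj es) d → (∀ v → v ∈ d → support es v ≡ true × cubic es v ≡ false) → Any (_∈ ms) d →
      ∀ v → v ∈ d → K v ≡ true → ⊥
    apart d icd nd mkd v v∈ kv with find mkd
    ... | h , h∈ , h∈ms = true≢false
          (mem⁺ h∈ms)
          (not-true⁻ (proj₂ (∧-true⁻ (K⊑ h (cycle-forward (λ u → K u ≡ true) (IsCycle.clos icd)
            (λ u∈ r ku → core-closed {es = es} co (noncubic-deg≤2 (proj₂ (nd _ u∈))) r ku) v∈ kv h∈)))))

  find-transversal : ∀ k → Packing es loopless simple k (support es) ⊎ Transversal k
  find-transversal k = subst (λ j → Packing es loopless simple j (support es) ⊎ Transversal j) (+-identityʳ k)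
    (mark-components k [] [] z≤n [] [] [] [])

  module Layers {k} (tr : Transversal k) where
    open Transversal tr

    -- Breadth-first search in H from the marks: `front j` is the layer at distance `j`, `seen j`
    -- the ball of radius `j`. Repetitions are harmless, as only lengths are bounded.
    front seen : ℕ → List (Fin n)
    front zero = marks
    front (suc j) = concatMap (λ v → filterᵇ (not ∘ mem (seen j)) (nb es v)) (front j)
    seen zero = marks
    seen (suc j) = front (suc j) ++ seen j

    front⁻ : ∀ j {v} → v ∈ front (suc j) → v ∉ seen j × ∃[ u ] (u ∈ front j × u ∈ nb es v)
    front⁻ j m with ∈-concatMap⁻ (λ v → filterᵇ (not ∘ mem (seen j)) (nb es v)) {xs = front j} m
    ... | a with find a
    ...   | u , u∈ , q with ∈-filterᵇ⁻ (not ∘ mem (seen j)) {nb es u} q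
    ...     | r , e = mem-∉⁻ (not-true⁻ e) , u , u∈ , nb-sym es r

    front⊆seen : ∀ j {v} → v ∈ front j → v ∈ seen j
    front⊆seen zero m = m
    front⊆seen (suc j) m = ∈-++⁺ˡ m

    marks⊆seen : ∀ j {v} → v ∈ marks → v ∈ seen j
    marks⊆seen zero m = m
    marks⊆seen (suc j) m = ∈-++⁺ʳ (front (suc j)) (marks⊆seen j m)

    front-nb : ∀ j {v u} → v ∈ front j → u ∈ nb es v → u ∈ seen (suc j)
    front-nb j {v} {u} v∈ m with u ∈? seen j
    ... | yes s = ∈-++⁺ʳ (front (suc j)) s
    ... | no ns = ∈-++⁺ˡ (∈-concatMap⁺ (λ v → filterᵇ (not ∘ mem (seen j)) (nb es v))
                    (lose v∈ (∈-filterᵇ⁺ (not ∘ mem (seen j)) m (not-true⁺ (mem-∉⁺ ns)))))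

    seen-nb : ∀ j {v u} → v ∈ seen j → u ∈ nb es v → u ∈ seen (suc j)
    seen-nb zero v∈ m = front-nb zero v∈ m
    seen-nb (suc j) v∈ m with ∈-++⁻ (front (suc j)) v∈
    ... | inj₁ q = front-nb (suc j) q m
    ... | inj₂ q = ∈-++⁺ʳ (front (suc (suc j))) (seen-nb j q m)

    unseen-deg≤2 : ∀ j {v} → v ∉ seen j → deg es v ≤ 2
    unseen-deg≤2 j {v} v∉ with bool-cases (cubic es v)
    ... | inj₁ e = ⊥-elim (v∉ (marks⊆seen j (hasCubic e)))
    ... | inj₂ e = noncubic-deg≤2 e

    length-concatMap≤ : ∀ {f : Fin n → List (Fin n)} m xs → (∀ v → v ∈ xs → length (f v) ≤ m) → length (concatMap f xs) ≤ length xs * m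
    length-concatMap≤ m [] h = z≤n
    length-concatMap≤ {f} m (x ∷ xs) h = ≤-trans (≤-reflexive (length-++ (f x)))
      (+-mono-≤ (h x (here refl)) (length-concatMap≤ m xs (λ v q → h v (there q))))

    -- Only the first layer can branch. A vertex of a later layer is not cubic and has a neighbour
    -- in the previous layer, so it leads to at most one new vertex.
    front-size : ∀ j → length (front (suc j)) ≤ length marks * 3
    front-size zero = length-concatMap≤ 3 marks (λ v _ → ≤-trans (≤-reflexive (length-filterᵇ (not ∘ mem marks) (nb es v)))
      (≤-trans (cnt≤length (not ∘ mem marks) (nb es v)) (deg≤3 v)))
    front-size (suc j) = ≤-trans (length-concatMap≤ 1 (front (suc j)) small) (≤-trans (≤-reflexive (*-identityʳ _)) (front-size j))
      where
      small : ∀ v → v ∈ front (suc j) → length (filterᵇ (not ∘ mem (seen (suc j))) (nb es v)) ≤ 1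
      small v m with front⁻ j m
      ... | v∉ , u , u∈ , un = ≤-trans (≤-reflexive (length-filterᵇ _ (nb es v)))
        (s≤s⁻¹ (≤-trans (cnt-strict {P = not ∘ mem (seen (suc j))} {λ _ → true} (nb es v) (λ _ _ → refl) un refl
                 (cong not (mem⁺ (∈-++⁺ʳ (front (suc j)) (front⊆seen j u∈)))))
          (≤-trans (cnt≤length (λ _ → true) (nb es v)) (unseen-deg≤2 j v∉))))

    seen-size : ∀ j → length (seen j) ≤ length marks * (1 + 3 * j)
    seen-size zero = ≤-reflexive (sym (*-identityʳ _))
    seen-size (suc j) = ≤-trans (≤-reflexive (length-++ (front (suc j)))) (≤-trans (+-mono-≤ (front-size j) (seen-size j)) (≤-reflexive (lem (length marks) j)))
      where
      lem : ∀ m j → m * 3 + m * (1 + 3 * j) ≡ m * (1 + 3 * suc j)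
      lem = solve-∀

    -- Outside the marks a core contains all neighbours of its vertices, so from a vertex of layer j
    -- it descends through all j + 1 layers.
    descend : ∀ {es' W} → Core es' W → ∀ j → (∀ v → v ∈ seen j → nb es' v ≡ nb es v) → ∀ {w} → w ∈ front j → W w ≡ true →
      ∃[ xs ] (Unique xs × length xs ≡ suc j × (∀ x → x ∈ xs → x ∈ seen j × W x ≡ true))
    descend co zero ag {w} m e = [ w ] , ([] ∷ []) , refl , λ { x (here refl) → m , e }
    descend {es'} co (suc j) ag {w} m e with front⁻ j m
    ... | w∉ , u , u∈ , un with descend {es'} co j (λ v q → ag v (∈-++⁺ʳ (front (suc j)) q)) u∈
              (core-closed {es = es'} co (subst (λ z → length z ≤ 2) (sym (ag w (∈-++⁺ˡ m))) (unseen-deg≤2 j w∉))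
                 (subst (u ∈_) (sym (ag w (∈-++⁺ˡ m))) un) e)
    ...   | xs , uq , l , f = w ∷ xs , (∉⇒All≢ (λ q → w∉ (proj₁ (f w q))) ∷ uq) , cong suc l ,
            λ { x (here refl) → ∈-++⁺ˡ m , e ; x (there q) → ∈-++⁺ʳ (front (suc j)) (proj₁ (f x q)) , proj₂ (f x q) }

    -- A core of es' that enters X is either long because it descends through all the layers,
    -- or has its part in the inner layers as a core of the unmodified es.
    girth-outside : ∀ {L'} → L ≡ suc L' → ∀ {es'} → (∀ v → v ∈ seen L → nb es' v ≡ nb es v) →
      (∀ W → Core es' W → (∀ v → v ∈ seen L → W v ≡ false) → ∀ {w} → W w ≡ true → L ≤ size W) →
      ∀ W → Core es' W → ∀ {w} → W w ≡ true → L ≤ size W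
    girth-outside {L'} refl {es'} ag out W co {w} ww with any? (λ v → (mem (front (suc L')) v ≟ᵇ true) ×-dec (W v ≟ᵇ true))
    ... | yes (v , m , e) with descend {es'} co (suc L') ag (mem⁻ m) e
    ...   | xs , uq , l , f = ≤-trans (n≤1+n _) (≤-trans (≤-reflexive (sym l)) (unique-length≤size W uq (λ x q → proj₂ (f x q))))
    girth-outside {L'} refl {es'} ag out W co {w} ww | no nf with any? (λ v → (W v ∧ mem (seen L') v) ≟ᵇ true)
    ... | yes (v , e) = ≤-trans (girth inner coreInner e) (size-mono {W = inner} (λ u q → proj₁ (∧-true⁻ q)))
      where
      inner : VSet n
      inner u = W u ∧ mem (seen L') u
      coreInner : Core es inner
      coreInner u q with ∧-true⁻ {W u} q
      ... | wu , su = ≤-trans (subst (λ z → 2 ≤ cnt W z) (ag u (∈-++⁺ʳ (front (suc L')) (mem⁻ su))) (co u wu))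
            (cnt-mono (nb es u) (λ x x∈ wx → ∧-true⁺ wx (mem⁺ (stay x wx (∈-++⁻ (front (suc L')) (seen-nb L' (mem⁻ su) x∈))))))
        where
        stay : ∀ x → W x ≡ true → x ∈ front (suc L') ⊎ x ∈ seen L' → x ∈ seen L'
        stay x wx (inj₁ q) = ⊥-elim (nf (x , mem⁺ q , wx))
        stay x wx (inj₂ q) = q
    ... | no ni = out W co off ww
      where
      off : ∀ v → v ∈ seen (suc L') → W v ≡ false
      off v m with bool-cases (W v)
      ... | inj₂ e = e
      ... | inj₁ e with ∈-++⁻ (front (suc L')) m
      ...   | inj₁ q = ⊥-elim (nf (v , mem⁺ q , e))
      ...   | inj₂ q = ⊥-elim (ni (v , ∧-true⁺ e (mem⁺ q)))

-- Paths, cycles and segments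

pathE : ∀ {n} → List (Fin n) → List (Edge n)
pathE (x ∷ y ∷ ys) = (x , y) ∷ pathE (y ∷ ys)
pathE _ = []

cycE : ∀ {n} → List (Fin n) → List (Edge n)
cycE [] = []
cycE (x ∷ xs) = pathE (x ∷ xs ++ [ x ])

length-inc : ∀ {n} (a b v : Fin n) → length (inc (a , b) v) ≡ b2n (single v a) + b2n (single v b)
length-inc a b v with a ≟ v | b ≟ v
... | yes _ | yes _ = refl
... | yes _ | no _ = refl
... | no _ | yes _ = refl
... | no _ | no _ = refl

deg-++ : ∀ {n} (es fs : List (Edge n)) v → deg (es ++ fs) v ≡ deg es v + deg fs v
deg-++ es fs v rewrite nb-++ es fs v = length-++ (nb es v)

-- Each visit to `v` uses two edge ends, except that the first and the last vertex of the walk lack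
-- one each. Adding these back covers paths and closed walks by one formula.
deg-walk : ∀ {n} {x e : Fin n} xs → EndsAt e (x ∷ xs) → ∀ v →
  deg (pathE (x ∷ xs)) v + (b2n (single v x) + b2n (single v e)) ≡ 2 * cnt (single v) (x ∷ xs)
deg-walk {x = x} [] stop v = lem (b2n (single v x))
  where
  lem : ∀ a → a + a ≡ 2 * (a + 0)
  lem = solve-∀
deg-walk [] (there ()) v
deg-walk {x = x} {e} (y ∷ ys) (there en) v
  rewrite length-++ (inc (x , y) v) {nb (pathE (y ∷ ys)) v} | length-inc x y v =
  trans (lem (b2n (single v x)) (b2n (single v y)) (deg (pathE (y ∷ ys)) v) (b2n (single v e)))
    (trans (cong (2 * b2n (single v x) +_) (deg-walk ys en v)) (sym (*-distribˡ-+ 2 (b2n (single v x)) _)))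
  where
  lem : ∀ a b d e → a + b + d + (a + e) ≡ 2 * a + (d + (b + e))
  lem = solve-∀

mult-∉ : ∀ {n} {v : Fin n} {xs} → v ∉ xs → cnt (single v) xs ≡ 0
mult-∉ {v = v} {xs} v∉ = cnt-none (single v) xs (λ x m → dec-false (x ≟ v) (λ { refl → v∉ m }))

mult-∈ : ∀ {n} {v : Fin n} {xs} → Unique xs → v ∈ xs → cnt (single v) xs ≡ 1
mult-∈ {v = v} {x ∷ xs} (p ∷ u) (here refl) rewrite single-self v = cong suc (mult-∉ (λ m → All.lookup p m refl))
mult-∈ {v = v} {x ∷ xs} (p ∷ u) (there m) rewrite dec-false (x ≟ v) (λ { refl → All.lookup p m refl }) = mult-∈ u m

module _ {n} {x e : Fin n} {xs} (en : EndsAt e (x ∷ xs)) (u : Unique (x ∷ xs)) where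

  deg-path-∉ : ∀ {v} → v ∉ x ∷ xs → deg (pathE (x ∷ xs)) v ≡ 0
  deg-path-∉ {v} v∉ = m+n≡0⇒m≡0 _ (trans (deg-walk xs en v) (cong (2 *_) (mult-∉ v∉)))

  deg-path-inner : ∀ {v} → v ∈ x ∷ xs → v ≢ x → v ≢ e → deg (pathE (x ∷ xs)) v ≡ 2
  deg-path-inner {v} m nx ne = trans (sym (+-identityʳ _))
    (trans (cong (deg (pathE (x ∷ xs)) v +_) (sym (cong₂ (λ a b → b2n a + b2n b) (dec-false (x ≟ v) (λ q → nx (sym q))) (dec-false (e ≟ v) (λ q → ne (sym q))))))
    (trans (deg-walk xs en v) (cong (2 *_) (mult-∈ u m))))

  deg-path-first : x ≢ e → deg (pathE (x ∷ xs)) x ≡ 1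
  deg-path-first ne = +-cancelʳ-≡ 1 _ _
    (trans (cong (deg (pathE (x ∷ xs)) x +_) (sym (cong₂ (λ a b → b2n a + b2n b) (single-self x) (dec-false (e ≟ x) (λ q → ne (sym q))))))
    (trans (deg-walk xs en x) (cong (2 *_) (mult-∈ u (here refl)))))

  deg-path-last : x ≢ e → deg (pathE (x ∷ xs)) e ≡ 1
  deg-path-last ne = +-cancelʳ-≡ 1 _ _
    (trans (cong (deg (pathE (x ∷ xs)) e +_) (sym (cong₂ (λ a b → b2n a + b2n b) (dec-false (x ≟ e) ne) (single-self e))))
    (trans (deg-walk xs en e) (cong (2 *_) (mult-∈ u (EndsAt-∈ en)))))

EndsAt-snoc : ∀ {n} (xs : List (Fin n)) {e} → EndsAt e (xs ++ [ e ])
EndsAt-snoc [] = stop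
EndsAt-snoc (x ∷ xs) = there (EndsAt-snoc xs)

deg-cycle : ∀ {n} (c : List (Fin n)) v → deg (cycE c) v ≡ 2 * cnt (single v) c
deg-cycle [] v = refl
deg-cycle (x ∷ xs) v = +-cancelʳ-≡ (b2n (single v x) + b2n (single v x)) _ _
  (trans (deg-walk (xs ++ [ x ]) (there (EndsAt-snoc xs)) v)
  (trans (cong (2 *_) (cnt-++ (single v) (x ∷ xs) [ x ])) (lem (cnt (single v) (x ∷ xs)) (b2n (single v x)))))
  where
  lem : ∀ a b → 2 * (a + (b + 0)) ≡ 2 * a + (b + b)
  lem = solve-∀

nb-path : ∀ {n} (R : Rel n) → (∀ {u v} → R u v → R v u) → ∀ {p} → Linked R p → ∀ {u v} → u ∈ nb (pathE p) v →
  R v u × u ∈ p × v ∈ p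
nb-path R sy {x ∷ y ∷ p} (r ∷ l) {u} {v} m with ∈-++⁻ (inc (x , y) v) m
... | inj₂ q with nb-path R sy l q
...   | r' , a , b = r' , there a , there b
nb-path R sy {x ∷ y ∷ p} (r ∷ l) {u} {v} m | inj₁ q with inc⁻ (x , y) q
...   | inj₁ refl = r , there (here refl) , here refl
...   | inj₂ refl = sy r , here refl , there (here refl)

nb-cycle : ∀ {n} (R : Rel n) → (∀ {u v} → R u v → R v u) → ∀ {c} → Closed R c → ∀ {u v} → u ∈ nb (cycE c) v →
  R v u × u ∈ c × v ∈ c
nb-cycle R sy {x ∷ xs} l m with nb-path R sy l m
... | r , a , b = r , clean (∈-++⁻ (x ∷ xs) a) , clean (∈-++⁻ (x ∷ xs) b)
  where
  clean : ∀ {u} → u ∈ (x ∷ xs) ⊎ u ∈ [ x ] → u ∈ x ∷ xs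
  clean (inj₁ q) = q
  clean (inj₂ (here refl)) = here refl

path-linked : ∀ {n} (p : List (Fin n)) → Linked (Adj (pathE p)) p
path-linked [] = []
path-linked (x ∷ []) = [-]
path-linked (x ∷ y ∷ p) = ∈-++⁺ˡ (inc-fst x y) ∷ Linked.map (λ {u} m → ∈-++⁺ʳ (inc (x , y) u) m) (path-linked (y ∷ p))

cycle-closed : ∀ {n} {x : Fin n} {xs} → Closed (Adj (cycE (x ∷ xs))) (x ∷ xs)
cycle-closed {x = x} {xs} = path-linked (x ∷ xs ++ [ x ])

Unique⇒Linked≢ : ∀ {n} {xs : List (Fin n)} → Unique xs → Linked _≢_ xs
Unique⇒Linked≢ [] = []
Unique⇒Linked≢ (p ∷ []) = [-]
Unique⇒Linked≢ ((p ∷ _) ∷ u@(_ ∷ _)) = p ∷ Unique⇒Linked≢ u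

Linked-join : ∀ {n} {R : Rel n} xs {a ys} → Linked R (xs ++ [ a ]) → Linked R (a ∷ ys) → Linked R (xs ++ a ∷ ys)
Linked-join [] l l' = l'
Linked-join (x ∷ []) (r ∷ l) l' = r ∷ l'
Linked-join (x ∷ y ∷ xs) (r ∷ l) l' = r ∷ Linked-join (y ∷ xs) l l'

Linked-last : ∀ {n} {R : Rel n} {xs z v} → Linked R (xs ++ [ v ]) → EndsAt z xs → R z v
Linked-last (r ∷ _) stop = r
Linked-last {xs = x ∷ y ∷ xs} (_ ∷ l) (there e) = Linked-last l e

Unique-++ : ∀ {n} {xs ys : List (Fin n)} → Unique xs → Unique ys → (∀ v → v ∈ xs → v ∈ ys → ⊥) → Unique (xs ++ ys)
Unique-++ u w d = UniqueP.++⁺ u w (λ { {v} (p , q) → d v p q })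

rotate : ∀ {n} {R : Rel n} as {v bs} → IsCycle R (as ++ v ∷ bs) → IsCycle R (v ∷ bs ++ as)
rotate {R = R} [] {v} {bs} ic = subst (IsCycle R) (cong (v ∷_) (sym (++-identityʳ bs))) ic
rotate {R = R} (a ∷ as) {v} {bs} (isCycle u l cl) =
  isCycle (Unique-++ (Unique-suffix (a ∷ as) u) (Unique-prefix (a ∷ as) u) (λ x p q → Unique-disjoint (a ∷ as) u q p))
    (subst (3 ≤_) (trans (length-++ (a ∷ as) {v ∷ bs}) (trans (+-comm (length (a ∷ as)) _) (sym (length-++ (v ∷ bs) {a ∷ as})))) l)
    (subst (Linked R) (sym (++-assoc (v ∷ bs) (a ∷ as) [ v ]))
      (Linked-join (v ∷ bs) (Linked-suffix (a ∷ as) cl') (Linked-prefix (a ∷ as ++ [ v ]) (subst (Linked R) (sym (++-assoc (a ∷ as) [ v ] (bs ++ [ a ]))) cl'))))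
  where
  cl' : Linked R ((a ∷ as) ++ v ∷ bs ++ [ a ])
  cl' = subst (Linked R) (++-assoc (a ∷ as) (v ∷ bs) [ a ]) cl

rotate-∈ : ∀ {n} (as : List (Fin n)) {v bs x} → x ∈ as ++ v ∷ bs → x ∈ v ∷ bs ++ as
rotate-∈ as {v} {bs} m with ∈-++⁻ as m
... | inj₁ q = ∈-++⁺ʳ (v ∷ bs) q
... | inj₂ q = ∈-++⁺ˡ q

rotate-∈⁻ : ∀ {n} (as : List (Fin n)) {v bs x} → x ∈ v ∷ bs ++ as → x ∈ as ++ v ∷ bs
rotate-∈⁻ as {v} {bs} m with ∈-++⁻ (v ∷ bs) m
... | inj₁ q = ∈-++⁺ʳ as q
... | inj₂ q = ∈-++⁺ˡ q

cnt-two : ∀ {n} (W : VSet n) {xs x y} → x ∈ xs → y ∈ xs → x ≢ y → W x ≡ true → W y ≡ true → 2 ≤ cnt W xs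
cnt-two W {xs} {x} {y} mx my ne wx wy =
  ≤-trans (s≤s (cnt-∈ (rem y W) mx (rem⁺ W wx ne))) (cnt-strict {P = rem y W} {W} xs (rem-⊑ y W) my wy (rem-self y W))

endOf : ∀ {n} (x : Fin n) xs → ∃[ e ] EndsAt e (x ∷ xs)
endOf x [] = x , stop
endOf x (y ∷ xs) with endOf y xs
... | e , p = e , there p

cycle-neighbours : ∀ {n} {R : Rel n} {v d} → IsCycle R (v ∷ d) → ∃[ y ] ∃[ z ] (y ∈ d × z ∈ d × y ≢ z × R v y × R z v)
cycle-neighbours {d = []} (isCycle _ (s≤s ()) _)
cycle-neighbours {d = _ ∷ []} (isCycle _ (s≤s (s≤s ())) _)
cycle-neighbours {d = y ∷ y' ∷ d} (isCycle (_ ∷ (u ∷ _)) _ (r ∷ l)) with endOf y' d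
... | z , en = y , z , here refl , there (EndsAt-∈ en) , (λ { refl → All.lookup u (EndsAt-∈ en) refl }) , r , Linked-last l (there en)

cycle-core : ∀ {n} (es : List (Edge n)) {c} → IsCycle (Adj es) c → Core es (mem c)
cycle-core es {c} ic v e with ∈-∃++ (mem⁻ {xs = c} e)
... | as , bs , refl with cycle-neighbours (rotate as ic)
...   | y , z , y∈ , z∈ , y≢z , r , r' = cnt-two (mem c) r (nb-sym es r') y≢z
  (mem⁺ (rotate-∈⁻ as (there y∈))) (mem⁺ (rotate-∈⁻ as (there z∈)))

Reduced-tail : ∀ {n} {R : Rel n} {x y ys} → Reduced R (x ∷ y ∷ ys) → Reduced R (y ∷ ys)
Reduced-tail (step _ _ r) = r

Reduced-prefix : ∀ {n} {R : Rel n} {x} xs {ys} → Reduced R (x ∷ xs ++ ys) → Reduced R (x ∷ xs)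
Reduced-prefix [] r = [-]
Reduced-prefix (y ∷ []) (step r h rs) = step r tt (Reduced-prefix [] rs)
Reduced-prefix (y ∷ y' ∷ xs) (step r h rs) = step r h (Reduced-prefix (y' ∷ xs) rs)

reduced-inner : ∀ {n} {R : Rel n} as {p v q bs} → Reduced R (as ++ p ∷ v ∷ q ∷ bs) → R p v × R v q × p ≢ q
reduced-inner [] (step r h (step r' _ _)) = r , r' , h
reduced-inner (a ∷ []) (step _ _ rs) = reduced-inner [] rs
reduced-inner (a ∷ b ∷ as) (step _ _ rs) = reduced-inner (b ∷ as) rs

splitLast : ∀ {n} (x : Fin n) xs → ∃[ ys ] ∃[ e ] x ∷ xs ≡ ys ++ [ e ]
splitLast x [] = [] , x , refl
splitLast x (y ∷ xs) with splitLast y xs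
... | ys , e , q = x ∷ ys , e , cong (x ∷_) q

trace : ∀ {n} {R : Rel n} (next : ∀ {p v} → R p v → ∃[ w ] (R v w × w ≢ p)) (X : Fin n → Bool) → ∀ m {p v} → R p v →
  ∃[ t ] (Reduced R (p ∷ v ∷ t) ×
    ((∃[ ys ] ∃[ e ] (v ∷ t ≡ ys ++ [ e ] × X e ≡ true × (∀ y → y ∈ ys → X y ≡ false)))
     ⊎ (length t ≡ m × (∀ y → y ∈ v ∷ t → X y ≡ false))))
trace next X m {p} {v} r with bool-cases (X v)
... | inj₁ e = [] , step r tt [-] , inj₁ ([] , v , refl , e , λ _ ())
trace next X zero {p} {v} r | inj₂ e = [] , step r tt [-] , inj₂ (refl , λ { y (here refl) → e })
trace next X (suc m) {p} {v} r | inj₂ e with next r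
... | w , r' , ne with trace next X m r'
...   | t , rw , inj₁ (ys , e' , q , xe , f) =
  w ∷ t , step r (λ z → ne (sym z)) rw , inj₁ (v ∷ ys , e' , cong (v ∷_) q , xe , λ { y (here refl) → e ; y (there m) → f y m })
...   | t , rw , inj₂ (l , f) =
  w ∷ t , step r (λ z → ne (sym z)) rw , inj₂ (cong suc l , λ { y (here refl) → e ; y (there m) → f y m })

snoc-ʳ++ : ∀ {n} (ys : List (Fin n)) {e zs} → (ys ++ [ e ]) ʳ++ zs ≡ e ∷ (ys ʳ++ zs)
snoc-ʳ++ [] = refl
snoc-ʳ++ (y ∷ ys) = snoc-ʳ++ ys

ʳ++-assoc : ∀ {n} (ys : List (Fin n)) {zs ws} → ys ʳ++ (zs ++ ws) ≡ (ys ʳ++ zs) ++ ws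
ʳ++-assoc [] = refl
ʳ++-assoc (y ∷ ys) {zs} = ʳ++-assoc ys {y ∷ zs}

module Segments {n} {G : Graph n} {L} (3≤L : 3 ≤ L) {es} (F : Frame G L es) (X : List (Fin n))
    (cubic∈X : ∀ {v} → cubic es v ≡ true → v ∈ X)
    (X-hits : ∀ W → Core es W → (∀ v → v ∈ X → W v ≡ false) → ∀ v → W v ≡ false) where
  open Frame F
  open FrameProperties 3≤L F

  ∉X-deg≤2 : ∀ {v} → v ∉ X → deg es v ≤ 2
  ∉X-deg≤2 {v} v∉ with bool-cases (cubic es v)
  ... | inj₁ e = ⊥-elim (v∉ (cubic∈X e))
  ... | inj₂ e = noncubic-deg≤2 e

  no-cycle : ∀ {c} → IsCycle (Adj es) c → (∀ v → v ∈ c → v ∉ X) → ⊥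
  no-cycle {[]} (isCycle _ () _)
  no-cycle {x ∷ c} ic av = true≢false (mem⁺ (here refl)) (X-hits (mem (x ∷ c)) (cycle-core es ic)
    (λ v m → mem-∉⁺ (λ q → av v q m)) x)

  -- The component of `z` in H - X together with its attachments `xl` and `xr`, which may coincide.
  -- `nb-closed` expresses that nothing of the component is missed.
  record Segment (z : Fin n) : Set where
    field
      xl xr : Fin n
      S : List (Fin n)
      z∈S : z ∈ S
      xl∈X : xl ∈ X
      xr∈X : xr ∈ X
      S∉X : ∀ {s} → s ∈ S → s ∉ X
      linked : Linked (Adj es) (xl ∷ S ++ [ xr ])
      uniq : Unique S
      nb-closed : ∀ {s u} → s ∈ S → u ∈ nb es s → u ∈ S ⊎ u ∈ X

  next-edge : ∀ {p v} → Adj es p v → ∃[ w ] (Adj es v w × w ≢ p)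
  next-edge {p} {v} m with cnt-pos (rem p (λ _ → true)) (nb es v) (another es loopless simple {λ _ → true} 1 p
      (≤-trans (support-deg≥2 v (nb-support m)) (≤-reflexive (sym (cnt-all (λ _ → true) (nb es v) (λ _ _ → refl))))))
  ... | w , w∈ , e = w , w∈ , proj₂ (rem⁻ (λ _ → true) e)

  -- A reduced walk in the frame can always be continued. If it avoided `X` for `n` steps, it would
  -- repeat a vertex and close a cycle outside `X`, which is a core that `X` fails to meet.
  walkToX : ∀ {z v} → z ∉ X → Adj es z v →
    ∃[ t ] (Reduced (Adj es) (z ∷ v ∷ t) × ∃[ ys ] ∃[ e ] (v ∷ t ≡ ys ++ [ e ] × e ∈ X × (∀ y → y ∈ ys → y ∉ X)))
  walkToX {z} {v} z∉ r with trace {R = Adj es} next-edge (mem X) n r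
  ... | t , rw , inj₁ (ys , e , q , xe , f) = t , rw , ys , e , q , mem⁻ xe , λ y m → mem-∉⁻ (f y m)
  ... | t , rw , inj₂ (l , f) with reduced-unique loopless rw
  ...   | inj₁ (_ ∷ u) = ⊥-elim (1+n≰n (≤-trans (≤-reflexive (cong suc (sym l))) (unique-length≤n u)))
  ...   | inj₂ (c , ic , s) = ⊥-elim (no-cycle ic (λ y m → off y (s y m)))
    where
    off : ∀ y → y ∈ z ∷ v ∷ t → y ∉ X
    off y (here refl) = z∉
    off y (there m) = mem-∉⁻ (f y m)

  -- Outside `X` the vertex `z` has exactly two neighbours. The walks to `X` through them, one
  -- reversed, form a reduced walk, whose part outside `X` has no repetition because a cycle there
  -- is impossible.
  segment : ∀ {z} → support es z ≡ true → z ∉ X → Segment z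
  segment {z} sz z∉ with nb es z in eqn | support-deg≥2 z sz | ∉X-deg≤2 z∉ | simple z
  ... | _ ∷ [] | s≤s () | _ | _
  ... | _ ∷ _ ∷ _ ∷ _ | _ | s≤s (s≤s ()) | _
  ... | n₁ ∷ n₂ ∷ [] | _ | _ | (n₁≢n₂ ∷ []) ∷ _
    with walkToX z∉ (subst (n₁ ∈_) (sym eqn) (here refl)) | walkToX z∉ (subst (n₂ ∈_) (sym eqn) (there (here refl)))
  ... | t₁ , rw₁ , ys₁ , e₁ , q₁ , x₁ , f₁ | t₂ , rw₂ , ys₂ , e₂ , q₂ , x₂ , f₂ = record
    { xl = e₁ ; xr = e₂ ; S = S ; z∈S = ∈-ʳ++⁺ʳ ys₁ (here refl) ; xl∈X = x₁ ; xr∈X = x₂ ; S∉X = S∉X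
    ; linked = Reduced⇒Linked rw ; uniq = uq ; nb-closed = cl }
    where
    S = ys₁ ʳ++ (z ∷ ys₂)
    S∉X : ∀ {s} → s ∈ S → s ∉ X
    S∉X m with ∈-ʳ++⁻ ys₁ m
    ... | inj₁ q = f₁ _ q
    ... | inj₂ (here refl) = z∉
    ... | inj₂ (there q) = f₂ _ q
    shape : (n₁ ∷ t₁) ʳ++ (z ∷ n₂ ∷ t₂) ≡ e₁ ∷ S ++ [ e₂ ]
    shape = trans (cong₂ (λ a b → a ʳ++ (z ∷ b)) q₁ q₂) (trans (snoc-ʳ++ ys₁) (cong (e₁ ∷_) (ʳ++-assoc ys₁)))
    rw : Reduced (Adj es) (e₁ ∷ S ++ [ e₂ ])
    rw = subst (Reduced (Adj es)) shape (reduced-revjoin (nb-sym es) rw₁ rw₂ n₁≢n₂)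
    uq : Unique S
    uq with S in eqS | ∈-ʳ++⁺ʳ ys₁ {z ∷ ys₂} (here refl)
    ... | s₀ ∷ S' | _ with reduced-unique loopless {s₀ ∷ S'} (Reduced-prefix S' (Reduced-tail (subst (λ q → Reduced (Adj es) (e₁ ∷ q ++ [ e₂ ])) eqS rw)))
    ...   | inj₁ u = u
    ...   | inj₂ (c , ic , s) = ⊥-elim (no-cycle ic (λ y m → S∉X (subst (y ∈_) (sym eqS) (s y m))))
    cl : ∀ {s u} → s ∈ S → u ∈ nb es s → u ∈ S ⊎ u ∈ X
    cl {s} {u} m un with ∈-∃++ m
    ... | as , bs , eqS with splitLast e₁ as | bs ++ [ e₂ ] in eqb
    ...   | _ | [] = ⊥-elim (nonempty bs eqb)
      where
      nonempty : ∀ bs → bs ++ [ e₂ ] ≡ [] → ⊥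
      nonempty [] ()
      nonempty (_ ∷ _) ()
    ...   | cs , p , eqp | q ∷ bs' with reduced-inner cs {p} {s} {q} {bs'} (subst (Reduced (Adj es)) whole rw)
      where
      whole : e₁ ∷ S ++ [ e₂ ] ≡ cs ++ p ∷ s ∷ q ∷ bs'
      whole = trans (cong (λ z → e₁ ∷ z ++ [ e₂ ]) eqS) (trans (cong (e₁ ∷_) (++-assoc as (s ∷ bs) [ e₂ ]))
        (trans (cong₂ (λ a b → a ++ s ∷ b) eqp eqb) (++-assoc cs [ p ] (s ∷ q ∷ bs'))))
    -- The predecessor `p` and the successor `q` of `s` differ since the walk is reduced, so they
    -- exhaust the at most two neighbours of `s`.
    ...     | rp , rq , p≢q = sort (mem⁻ (cnt-full (mem (p ∷ q ∷ [])) (nb es s) (≤-trans (∉X-deg≤2 (S∉X m))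
        (cnt-two (mem (p ∷ q ∷ [])) (nb-sym es rp) rq p≢q (mem⁺ (here refl)) (mem⁺ (there (here refl))))) un))
      where
      inWalk : ∀ {x} → x ∈ e₁ ∷ S ++ [ e₂ ] → x ∈ S ⊎ x ∈ X
      inWalk (here refl) = inj₂ x₁
      inWalk (there m) with ∈-++⁻ S m
      ... | inj₁ r = inj₁ r
      ... | inj₂ (here refl) = inj₂ x₂
      p∈ : p ∈ e₁ ∷ S ++ [ e₂ ]
      p∈ = subst (λ z → p ∈ e₁ ∷ z ++ [ e₂ ]) (sym eqS)
        (∈-++⁺ˡ {xs = e₁ ∷ as ++ s ∷ bs} (∈-++⁺ˡ {xs = e₁ ∷ as} (subst (p ∈_) (sym eqp) (∈-++⁺ʳ cs (here refl)))))
      q∈ : q ∈ e₁ ∷ S ++ [ e₂ ]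
      q∈ = there (subst (λ z → q ∈ z ++ [ e₂ ]) (sym eqS) (subst (q ∈_) (sym (++-assoc as (s ∷ bs) [ e₂ ]))
        (∈-++⁺ʳ as (there (subst (q ∈_) (sym eqb) (here refl))))))
      sort : u ∈ p ∷ q ∷ [] → u ∈ S ⊎ u ∈ X
      sort (here refl) = inWalk p∈
      sort (there (here refl)) = inWalk q∈

-- Enlarging a frame

GAdj : ∀ {n} → Graph n → Rel n
GAdj G u v = T (adj G u v)

GAdj-sym : ∀ {n} (G : Graph n) {u v} → GAdj G u v → GAdj G v u
GAdj-sym G {u} {v} = subst T (Graph.sym G u v)

cubicOf : ∀ {n} {es : List (Edge n)} {v} → 3 ≤ deg es v → cubic es v ≡ true
cubicOf h = Equivalence.to T-≡ (≤⇒≤ᵇ h)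

cubic⁻ : ∀ {n} {es : List (Edge n)} {v} → cubic es v ≡ true → 3 ≤ deg es v
cubic⁻ {es = es} {v} e = ≤ᵇ⇒≤ 3 (deg es v) (Equivalence.from T-≡ e)

unsupported : ∀ {n} {es : List (Edge n)} {v} → support es v ≡ false → deg es v ≡ 0
unsupported {es = es} {v} e with nb es v
... | [] = refl

nb-extra : ∀ {n} (es fs : List (Edge n)) {v} → deg fs v ≡ 0 → nb (es ++ fs) v ≡ nb es v
nb-extra es fs {v} e rewrite nb-++ es fs v with nb fs v
... | [] = ++-identityʳ (nb es v)

cnt-nb-++ : ∀ {n} (W : VSet n) (es fs : List (Edge n)) v → cnt W (nb (es ++ fs) v) ≡ cnt W (nb es v) + cnt W (nb fs v)
cnt-nb-++ W es fs v rewrite nb-++ es fs v = cnt-++ W (nb es v) (nb fs v)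

-- The upper bound `2 + size (cubic es)` keeps the number of cubic vertices below `2 ^ r` in the
-- round that reaches the threshold.
record Improvement {n} (G : Graph n) (L : ℕ) (es : List (Edge n)) : Set where
  constructor improvement
  field
    new : List (Edge n)
    isFrame : Frame G L new
    grows : (size (cubic es) < size (cubic new) × size (cubic new) ≤ 2 + size (cubic es))
            ⊎ (size (cubic new) ≡ size (cubic es) × size (support es) < size (support new))

size-strict : ∀ {n} {P Q : VSet n} → P ⊑ Q → ∀ {x} → Q x ≡ true → P x ≡ false → size P < size Q
size-strict {n} {P} {Q} s {x} q p = cnt-strict {P = P} {Q} (allFin n) s (∈-allFin x) q p

two-more : ∀ {n} {P Q : VSet n} (a b : Fin n) → P ⊑ Q → Q a ≡ true → P a ≡ false →
  (∀ v → Q v ≡ true → v ≡ a ⊎ v ≡ b ⊎ P v ≡ true) → size P < size Q × size Q ≤ 2 + size P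
two-more {P = P} {Q} a b s qa pa f = size-strict s qa pa ,
  ≤-trans (size≤suc-rem a Q) (s≤s (≤-trans (size≤suc-rem b (rem a Q)) (s≤s (size-mono {W = rem b (rem a Q)} sub))))
  where
  sub : rem b (rem a Q) ⊑ P
  sub v e with rem⁻ (rem a Q) e
  ... | e' , nb' with rem⁻ Q e'
  ...   | q , na with f v q
  ...     | inj₁ r = ⊥-elim (na r)
  ...     | inj₂ (inj₁ r) = ⊥-elim (nb' r)
  ...     | inj₂ (inj₂ r) = r

module _ {n} (es : List (Edge n)) {W : VSet n} (core : Core es W) where

  core-false : ∀ {v} → cnt W (nb es v) ≤ 1 → W v ≡ false
  core-false {v} h with bool-cases (W v)
  ... | inj₂ e = e
  ... | inj₁ e = ⊥-elim (<⇒≱ (core v e) h)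

  neighbour-false : ∀ {u v} → u ∈ nb es v → deg es v ≤ 2 → W u ≡ false → W v ≡ false
  neighbour-false {u} {v} m d e = core-false (s≤s⁻¹ (≤-trans
    (cnt-strict {P = W} {λ _ → true} (nb es v) (λ _ _ → refl) m refl e) (≤-trans (cnt≤length (λ _ → true) (nb es v)) d)))

  -- The converse direction of `core-closed`: a vertex of degree at most two with a neighbour
  -- outside the core is itself outside. Absence from a core thus spreads from `X` along a segment.
  forward-false : ∀ {x ys} → Linked (Adj es) (x ∷ ys) → W x ≡ false → (∀ y → y ∈ ys → deg es y ≤ 2) → ∀ {y} → y ∈ ys → W y ≡ false
  forward-false {x} {y ∷ ys} (r ∷ l) e d (here refl) = neighbour-false (nb-sym es r) (d y (here refl)) e
  forward-false {x} {y ∷ ys} (r ∷ l) e d (there m) =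
    forward-false l (neighbour-false (nb-sym es r) (d y (here refl)) e) (λ z q → d z (there q)) m

  backward-false : ∀ ys {x} → Linked (Adj es) (ys ++ [ x ]) → W x ≡ false → (∀ y → y ∈ ys → deg es y ≤ 2) → ∀ {y} → y ∈ ys → W y ≡ false
  backward-false (y ∷ []) (r ∷ l) e d (here refl) = neighbour-false r (d y (here refl)) e
  backward-false (y ∷ y' ∷ ys) (r ∷ l) e d (here refl) = neighbour-false r (d y (here refl))
    (backward-false (y' ∷ ys) l e (λ z q → d z (there q)) (here refl))
  backward-false (y ∷ y' ∷ ys) (r ∷ l) e d (there m) = backward-false (y' ∷ ys) l e (λ z q → d z (there q)) m

Linked-map-∈ : ∀ {n} {R S : Rel n} {xs} → (∀ {u v} → u ∈ xs → R u v → S u v) → Linked R xs → Linked S xs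
Linked-map-∈ f [] = []
Linked-map-∈ f [-] = [-]
Linked-map-∈ f (r ∷ l) = f (here refl) r ∷ Linked-map-∈ (λ m → f (there m)) l

linked-neighbours : ∀ {n} {R : Rel n} x as {v} bs y → Linked R ((x ∷ as) ++ v ∷ bs ++ [ y ]) →
  ∃[ p ] ∃[ q ] (p ∈ x ∷ as × q ∈ bs ++ [ y ] × R p v × R v q)
linked-neighbours x [] [] y (r ∷ r' ∷ _) = x , y , here refl , here refl , r , r'
linked-neighbours x [] (b ∷ bs) y (r ∷ r' ∷ _) = x , b , here refl , here refl , r , r'
linked-neighbours x (a ∷ as) bs y (_ ∷ l) with linked-neighbours a as bs y l
... | p , q , p∈ , q∈ , r , r' = p , q , there p∈ , q∈ , r , r'

linked-targets : ∀ {n} {R : Rel n} {x ys} → Linked R (x ∷ ys) → ∀ {y} → y ∈ ys → ∃[ p ] R p y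
linked-targets (r ∷ l) (here refl) = _ , r
linked-targets (r ∷ l) (there m) = linked-targets l m

cycle-in-core : ∀ {n} {W : VSet n} {c} → IsCycle (Adj (cycE c)) c → (∀ {u v} → u ∈ c → v ∈ nb (cycE c) u → W u ≡ true → W v ≡ true) →
  ∀ {u} → u ∈ c → W u ≡ true → length c ≤ size W
cycle-in-core {W = W} {c} ic f m w = unique-length≤size W (IsCycle.uniq ic)
  (λ x q → cycle-forward (λ u → W u ≡ true) (IsCycle.clos ic) f m w q)

own-cycle : ∀ {n} {R : Rel n} {c} → IsCycle R c → IsCycle (Adj (cycE c)) c
own-cycle {c = []} (isCycle _ () _)
own-cycle {c = x ∷ xs} (isCycle u l _) = isCycle u l (cycle-closed {x = x} {xs})

cycle-vertex : ∀ {n} {R : Rel n} {c} → IsCycle R c → ∃[ x ] x ∈ c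
cycle-vertex {c = []} (isCycle _ () _)
cycle-vertex {c = x ∷ _} _ = x , here refl

deg-cycle-∈ : ∀ {n} {c : List (Fin n)} {v} → Unique c → v ∈ c → deg (cycE c) v ≡ 2
deg-cycle-∈ {c = c} {v} u m = trans (deg-cycle c v) (cong (2 *_) (mult-∈ u m))

deg-cycle-∉ : ∀ {n} {c : List (Fin n)} {v} → v ∉ c → deg (cycE c) v ≡ 0
deg-cycle-∉ {c = c} {v} v∉ = trans (deg-cycle c v) (cong (2 *_) (mult-∉ v∉))

cnt-deg-0 : ∀ {n} (W : VSet n) (es : List (Edge n)) {v} → deg es v ≡ 0 → cnt W (nb es v) ≡ 0
cnt-deg-0 W es {v} e = n≤0⇒n≡0 (≤-trans (cnt≤length W (nb es v)) (≤-reflexive e))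

deg-cong : ∀ {n} {es es' : List (Edge n)} {v} → nb es v ≡ nb es' v → deg es v ≡ deg es' v
deg-cong = cong length

module AddCycle {n} {G : Graph n} {L} (3≤L : 3 ≤ L) {es} (F : Frame G L es)
    {C} (icC : IsCycle (GAdj G) C) (L≤C : L ≤ length C) (apart : ∀ {v} → v ∈ C → support es v ≡ false) where
  open Frame F
  open FrameProperties 3≤L F

  private
    es' = es ++ cycE C

    same : ∀ {v} → v ∉ C → nb es' v ≡ nb es v
    same v∉ = nb-extra es (cycE C) (deg-cycle-∉ v∉)

    degC : ∀ {v} → v ∈ C → deg es' v ≡ 2
    degC {v} m = trans (deg-++ es (cycE C) v) (cong₂ _+_ (unsupported {es = es} (apart m)) (deg-cycle-∈ (IsCycle.uniq icC) m))

    inG' : ∀ u v → v ∈ nb es' u → T (adj G u v)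
    inG' u v m with ∈-++⁻ (nb es u) (subst (v ∈_) (nb-++ es (cycE C) u) m)
    ... | inj₁ q = inG u v q
    ... | inj₂ q = proj₁ (nb-cycle (GAdj G) (GAdj-sym G) (IsCycle.clos icC) q)

    degrees' : ∀ v → deg es' v ≡ 0 ⊎ (2 ≤ deg es' v × deg es' v ≤ 3)
    degrees' v with v ∈? C
    ... | yes m rewrite degC m = inj₂ (≤-refl , s≤s (s≤s z≤n))
    ... | no m rewrite same m = degrees v

    -- On `C` all degrees are two, so a core that meets `C` contains it and is long; any other core
    -- is a core of the old frame.
    girth' : ∀ W → Core es' W → ∀ {w} → W w ≡ true → L ≤ size W
    girth' W co {w} ww with any? (λ v → (mem C v ≟ᵇ true) ×-dec (W v ≟ᵇ true))
    ... | yes (v , m , e) = ≤-trans L≤C (cycle-in-core (own-cycle icC)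
          (λ {u} {v} u∈ r wu → core-closed {es = es'} co (≤-reflexive (degC u∈)) (subst (v ∈_) (sym (nb-++ es (cycE C) u)) (∈-++⁺ʳ (nb es u) r)) wu)
          (mem⁻ m) e)
    ... | no none = girth W (λ v e → subst (λ z → 2 ≤ cnt W z) (same (λ m → none (v , mem⁺ m , e))) (co v e)) ww

    cubic-same : ∀ v → cubic es' v ≡ cubic es v
    cubic-same v with v ∈? C
    ... | yes m rewrite degC m | unsupported {es = es} (apart m) = refl
    ... | no m rewrite same m = refl

    support-grows : ∀ v → support es v ≡ true → support es' v ≡ true
    support-grows v e with v ∈? C
    ... | yes m = ⊥-elim (true≢false e (apart m))
    ... | no m rewrite same m = e

    on-cycle : ∀ {v} → v ∈ C → support es' v ≡ true
    on-cycle {v} m with nb es' v | degC m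
    ... | _ ∷ _ | _ = refl

  addCycle : Improvement G L es
  addCycle with cycle-vertex icC
  ... | x , x∈ = improvement es' (frame inG' degrees' girth')
    (inj₂ (cnt-cong (allFin n) (λ v _ → cubic-same v) ,
      size-strict support-grows (on-cycle x∈) (apart x∈)))

filterᵇ-all : {A : Set} (P : A → Bool) (xs : List A) → (∀ x → x ∈ xs → P x ≡ true) → filterᵇ P xs ≡ xs
filterᵇ-all P [] h = refl
filterᵇ-all P (x ∷ xs) h rewrite h x (here refl) = cong (x ∷_) (filterᵇ-all P xs (λ y m → h y (there m)))

filterᵇ-++ : {A : Set} (P : A → Bool) (xs ys : List A) → filterᵇ P (xs ++ ys) ≡ filterᵇ P xs ++ filterᵇ P ys
filterᵇ-++ P = filter-++ (T? ∘ P)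

cnt-filterᵇ≤ : {A : Set} (W P : A → Bool) (xs : List A) → cnt W (filterᵇ P xs) ≤ cnt W xs
cnt-filterᵇ≤ W P [] = z≤n
cnt-filterᵇ≤ W P (x ∷ xs) with P x
... | true = +-monoʳ-≤ (b2n (W x)) (cnt-filterᵇ≤ W P xs)
... | false = ≤-trans (cnt-filterᵇ≤ W P xs) (m≤n+m _ (b2n (W x)))

-- Each edge is stored in one orientation only but is seen from both ends, hence the symmetry of
-- `K`.
nb-filter : ∀ {n} (K : Fin n → Fin n → Bool) → (∀ u v → K u v ≡ K v u) → (es : List (Edge n)) (v : Fin n) →
  nb (filterᵇ (λ (x , y) → K x y) es) v ≡ filterᵇ (K v) (nb es v)
nb-filter K sy [] v = refl
nb-filter K sy ((x , y) ∷ es) v rewrite filterᵇ-++ (K v) (inc (x , y) v) (nb es v) | sym (nb-filter K sy es v) with K x y in eq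
... | true = cong (_++ nb (filterᵇ (λ (x , y) → K x y) es) v) (sym (filterᵇ-all (K v) (inc (x , y) v) all))
  where
  all : ∀ u → u ∈ inc (x , y) v → K v u ≡ true
  all u m with inc⁻ (x , y) m
  ... | inj₁ refl = eq
  ... | inj₂ refl = trans (sy y x) eq
... | false = cong (_++ nb (filterᵇ (λ (x , y) → K x y) es) v) (sym none)
  where
  none : filterᵇ (K v) (inc (x , y) v) ≡ []
  none with x ≟ v | y ≟ v
  ... | yes refl | yes refl rewrite eq | eq = refl
  ... | yes refl | no _ rewrite eq = refl
  ... | no _ | yes refl rewrite sy v x | eq = refl
  ... | no _ | no _ = refl

-- `X-girth` captures the protective effect of the layers: if the edges at `X` stay untouched, only
-- the cores avoiding `X` remain to be examined.
module Surgery {n} {G : Graph n} {L} (3≤L : 3 ≤ L) {es} (F : Frame G L es) (X : List (Fin n))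
    (cubic∈X : ∀ {v} → cubic es v ≡ true → v ∈ X)
    (X-hits : ∀ W → Core es W → (∀ v → v ∈ X → W v ≡ false) → ∀ v → W v ≡ false)
    (X-girth : ∀ es' → (∀ v → v ∈ X → nb es' v ≡ nb es v) →
      (∀ W → Core es' W → (∀ v → v ∈ X → W v ≡ false) → ∀ {w} → W w ≡ true → L ≤ size W) →
      ∀ W → Core es' W → ∀ {w} → W w ≡ true → L ≤ size W) where
  open Frame F
  open FrameProperties 3≤L F
  open Segments 3≤L F X cubic∈X X-hits

  deg≡2 : ∀ {v} → support es v ≡ true → v ∉ X → deg es v ≡ 2
  deg≡2 s v∉ = ≤-antisym (∉X-deg≤2 v∉) (support-deg≥2 _ s)

  noncubic : ∀ {v} → v ∉ X → cubic es v ≡ false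
  noncubic {v} v∉ with bool-cases (cubic es v)
  ... | inj₂ e = e
  ... | inj₁ e = ⊥-elim (v∉ (cubic∈X e))

  module _ {z} (seg : Segment z) where
    open Segment seg

    S-support : ∀ {s} → s ∈ S → support es s ≡ true
    S-support m with linked-targets linked (∈-++⁺ˡ m)
    ... | _ , r = nb-support r

    -- It is essential that `v` lies outside `S`: an ear with both ends on one segment would close a
    -- cycle that avoids `X` and might be short.
    module Ear (u : Fin n) (ps : List (Fin n)) (v : Fin n) (path : Linked (GAdj G) (u ∷ ps ++ [ v ]))
        (uniqP : Unique (u ∷ ps ++ [ v ])) (P∉X : ∀ {x} → x ∈ u ∷ ps ++ [ v ] → x ∉ X) (u∈S : u ∈ S)
        (v∉S : v ∉ S) (sv : support es v ≡ true) (inner : ∀ {x} → x ∈ ps → support es x ≡ false) where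
      private
        p : List (Fin n)
        p = u ∷ ps ++ [ v ]
        fs es' : List (Edge n)
        fs = pathE p
        es' = es ++ fs

        ends : EndsAt v p
        ends = there (EndsAt-snoc ps)

        u≢v : u ≢ v
        u≢v refl = v∉S u∈S

        deg' : ∀ x → deg es' x ≡ deg es x + deg fs x
        deg' = deg-++ es fs

        same : ∀ {x} → x ∉ p → nb es' x ≡ nb es x
        same x∉ = nb-extra es fs (deg-path-∉ ends uniqP x∉)

        deg-u : deg es' u ≡ 3
        deg-u = trans (deg' u) (cong₂ _+_ (deg≡2 (S-support u∈S) (P∉X (here refl))) (deg-path-first ends uniqP u≢v))

        deg-v : deg es' v ≡ 3
        deg-v = trans (deg' v) (cong₂ _+_ (deg≡2 sv (P∉X (EndsAt-∈ ends))) (deg-path-last ends uniqP u≢v))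

        deg-inner : ∀ {x} → x ∈ ps → deg es' x ≡ 2
        deg-inner {x} m = trans (deg' x) (cong₂ _+_ (unsupported {es = es} (inner m))
          (deg-path-inner ends uniqP (there (∈-++⁺ˡ m)) (λ { refl → true≢false (S-support u∈S) (inner m) }) (λ { refl → true≢false sv (inner m) })))

        data Place (x : Fin n) : Set where
          at-u : x ≡ u → Place x
          at-v : x ≡ v → Place x
          at-inner : x ∈ ps → Place x
          off : x ∉ p → Place x

        place : ∀ x → Place x
        place x with x ∈? p
        ... | no m = off m
        ... | yes (here e) = at-u e
        ... | yes (there m) with ∈-++⁻ ps m
        ...   | inj₁ q = at-inner q
        ...   | inj₂ (here e) = at-v e

        inG' : ∀ x y → y ∈ nb es' x → T (adj G x y)
        inG' x y m with ∈-++⁻ (nb es x) (subst (y ∈_) (nb-++ es fs x) m)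
        ... | inj₁ q = inG x y q
        ... | inj₂ q = proj₁ (nb-path (GAdj G) (GAdj-sym G) path q)

        degrees' : ∀ x → deg es' x ≡ 0 ⊎ (2 ≤ deg es' x × deg es' x ≤ 3)
        degrees' x with place x
        ... | at-u refl rewrite deg-u = inj₂ (s≤s (s≤s z≤n) , ≤-refl)
        ... | at-v refl rewrite deg-v = inj₂ (s≤s (s≤s z≤n) , ≤-refl)
        ... | at-inner m rewrite deg-inner m = inj₂ (≤-refl , s≤s (s≤s z≤n))
        ... | off m rewrite same m = degrees x

        lift : ∀ {xs} → Linked (Adj es) xs → Linked (Adj es') xs
        lift = Linked.map (λ {x} m → subst (_ ∈_) (sym (nb-++ es fs x)) (∈-++⁺ˡ m))

        lift-path : ∀ {xs} → Linked (Adj fs) xs → Linked (Adj es') xs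
        lift-path = Linked.map (λ {x} m → subst (_ ∈_) (sym (nb-++ es fs x)) (∈-++⁺ʳ (nb es x) m))

        -- Absence from `W` spreads from `xl` and `xr` to both sides of `u`. This leaves `u` a
        -- single possible neighbour, on the ear, so `u` is absent too, and so is the ear up to `v`.
        -- No ear edge then counts, and `W` is a core of the old frame that avoids `X`.
        no-core : ∀ W → Core es' W → (∀ x → x ∈ X → W x ≡ false) → ∀ w → W w ≡ false
        no-core W co offX with ∈-∃++ u∈S
        ... | P , Q , eqS = X-hits W (λ x e → subst (2 ≤_) (trans (cnt-nb-++ W es fs x) (trans (cong (cnt W (nb es x) +_) (path-0 x e)) (+-identityʳ _))) (co x e)) offX
          where
          whole : Linked (Adj es) ((xl ∷ P) ++ u ∷ Q ++ [ xr ])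
          whole = subst (Linked (Adj es)) (trans (cong (λ q → xl ∷ q ++ [ xr ]) eqS) (cong (xl ∷_) (++-assoc P (u ∷ Q) [ xr ]))) linked
          uS : Unique (P ++ u ∷ Q)
          uS = subst Unique eqS uniq
          side-deg : ∀ x → x ∈ S → x ≢ u → deg es' x ≤ 2
          side-deg x m ne with place x
          ... | at-u e = ⊥-elim (ne e)
          ... | at-v refl = ⊥-elim (v∉S m)
          ... | at-inner q = ⊥-elim (true≢false (S-support m) (inner q))
          ... | off q rewrite same q = ∉X-deg≤2 (S∉X m)
          P⊆ : ∀ {x} → x ∈ P → x ∈ S
          P⊆ m = subst (_ ∈_) (sym eqS) (∈-++⁺ˡ m)
          Q⊆ : ∀ {x} → x ∈ Q → x ∈ S
          Q⊆ m = subst (_ ∈_) (sym eqS) (∈-++⁺ʳ P (there m))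
          P-false : ∀ {x} → x ∈ P → W x ≡ false
          P-false = forward-false es' co (lift (Linked-prefix (xl ∷ P) whole)) (offX xl xl∈X)
            (λ y m → side-deg y (P⊆ m) (λ { refl → Unique-disjoint P uS m (here refl) }))
          Q-false : ∀ {x} → x ∈ Q → W x ≡ false
          Q-false = backward-false es' co Q (lift (Linked-suffix (xl ∷ P ++ [ u ]) (subst (Linked (Adj es)) (sym (++-assoc (xl ∷ P) [ u ] (Q ++ [ xr ]))) whole)))
            (offX xr xr∈X) (λ y m → side-deg y (Q⊆ m) (λ { refl → Unique-disjoint [ u ] (Unique-suffix P uS) (here refl) m }))
          u-false : W u ≡ false
          u-false = core-false es' co (≤-trans (≤-reflexive (trans (cnt-nb-++ W es fs u) (cong (_+ cnt W (nb fs u)) (cnt-none W (nb es u) nbs))))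
            (≤-trans (cnt≤length W (nb fs u)) (≤-reflexive (deg-path-first ends uniqP u≢v))))
            where
            nbs : ∀ x → x ∈ nb es u → W x ≡ false
            nbs x m with nb-closed u∈S m
            ... | inj₂ q = offX x q
            ... | inj₁ q with ∈-++⁻ P (subst (x ∈_) eqS q)
            ...   | inj₁ r = P-false r
            ...   | inj₂ (here refl) = ⊥-elim (loopless u m)
            ...   | inj₂ (there r) = Q-false r
          ps-false : ∀ {x} → x ∈ ps → W x ≡ false
          ps-false = forward-false es' co (lift-path (Linked-prefix (u ∷ ps) (path-linked p))) u-false (λ y m → ≤-reflexive (deg-inner m))
          path-false : ∀ {x} → x ∈ p → x ≢ v → W x ≡ false
          path-false {x} m ne with place x
          ... | at-u refl = u-false
          ... | at-v e = ⊥-elim (ne e)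
          ... | at-inner q = ps-false q
          ... | off q = ⊥-elim (q m)
          path-0 : ∀ x → W x ≡ true → cnt W (nb fs x) ≡ 0
          path-0 x e = cnt-none W (nb fs x) far
            where
            far : ∀ y → y ∈ nb fs x → W y ≡ false
            far y m with nb-path _≢_ (λ ne q → ne (sym q)) (Unique⇒Linked≢ uniqP) m
            ... | ne , y∈ , x∈ with x ≟ v
            ...   | yes refl = path-false y∈ (λ q → ne (sym q))
            ...   | no nv = ⊥-elim (true≢false e (path-false x∈ nv))

      addEar : Improvement G L es
      addEar = improvement es' (frame inG' degrees'
          (X-girth es' (λ x m → same (λ q → P∉X q m)) (λ W co offX {w} e → ⊥-elim (true≢false e (no-core W co offX w)))))
        (inj₁ (two-more u v keeps (cubicOf {es = es'} (≤-reflexive (sym deg-u))) (noncubic (P∉X (here refl))) new-cubic))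
        where
        keeps : cubic es ⊑ cubic es'
        keeps x e rewrite same (λ q → P∉X q (cubic∈X e)) = e
        new-cubic : ∀ x → cubic es' x ≡ true → x ≡ u ⊎ x ≡ v ⊎ cubic es x ≡ true
        new-cubic x e with place x
        ... | at-u q = inj₁ q
        ... | at-v q = inj₂ (inj₁ q)
        ... | at-inner m = ⊥-elim (<⇒≱ (cubic⁻ {es = es'} e) (≤-reflexive (deg-inner m)))
        ... | off m = inj₂ (inj₂ (subst (λ d → (3 ≤ᵇ length d) ≡ true) (same m) e))

    -- The stretch a … b of the segment is replaced by the long cycle C through a, together with an
    -- arc that leads from b to another vertex w of C (w = b when b itself lies on C).
    module Detour (P : List (Fin n)) (a : Fin n) (M : List (Fin n)) (b : Fin n) (Q : List (Fin n))
        (eqS : S ≡ P ++ (a ∷ M ++ [ b ]) ++ Q)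
        {C} (icC : IsCycle (GAdj G) C) (L≤C : L ≤ length C) (C∉X : ∀ {x} → x ∈ C → x ∉ X)
        (C∩H : ∀ {x} → x ∈ C → support es x ≡ true → x ∈ a ∷ M ++ [ b ]) (a∈C : a ∈ C)
        (rest init : List (Fin n)) (w : Fin n) (eqArc : b ∷ rest ≡ init ++ [ w ])
        (linkA : Linked (GAdj G) (b ∷ rest)) (uniqA : Unique (b ∷ rest)) (A∉X : ∀ {x} → x ∈ b ∷ rest → x ∉ X)
        (A∩H : ∀ {x} → x ∈ b ∷ rest → support es x ≡ true → x ≡ b)
        (A∩C : ∀ {x} → x ∈ b ∷ rest → x ∈ C → x ≡ w) (w∈C : w ∈ C) (w≢a : w ≢ a) where
      private
        B arc : List (Fin n)
        B = a ∷ M ++ [ b ]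
        arc = b ∷ rest

        -- The edges with both ends in `B` are exactly those of the stretch: its inner vertices have
        -- degree two, and `a` and `b` have one neighbour outside `B` each.
        K : Fin n → Fin n → Bool
        K x y = not (mem B x ∧ mem B y)

        keep cs as es' : List (Edge n)
        keep = filterᵇ (λ (x , y) → K x y) es
        cs = cycE C
        as = pathE arc
        es' = keep ++ (cs ++ as)

        ends : EndsAt w arc
        ends = subst (EndsAt w) (sym eqArc) (EndsAt-snoc init)

        nb-keep : ∀ v → nb keep v ≡ filterᵇ (K v) (nb es v)
        nb-keep v = nb-filter K (λ x y → cong not (∧-comm (mem B x) (mem B y))) es v

        keep-∉ : ∀ {v} → v ∉ B → nb keep v ≡ nb es v
        keep-∉ {v} v∉ = trans (nb-keep v) (filterᵇ-all (K v) (nb es v) (λ x _ → cong (λ q → not (q ∧ mem B x)) (mem-∉⁺ v∉)))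

        deg-keep : ∀ v → deg keep v ≡ cnt (K v) (nb es v)
        deg-keep v = trans (cong length (nb-keep v)) (length-filterᵇ (K v) (nb es v))

        K-in : ∀ {v x} → v ∈ B → x ∈ B → K v x ≡ false
        K-in v∈ x∈ rewrite mem⁺ v∈ | mem⁺ x∈ = refl

        K-out : ∀ {v x} → x ∉ B → K v x ≡ true
        K-out {v} x∉ rewrite mem-∉⁺ x∉ with mem B v
        ... | true = refl
        ... | false = refl

        B⊆S : ∀ {x} → x ∈ B → x ∈ S
        B⊆S m = subst (_ ∈_) (sym eqS) (∈-++⁺ʳ P (∈-++⁺ˡ m))
        P⊆S : ∀ {x} → x ∈ P → x ∈ S
        P⊆S m = subst (_ ∈_) (sym eqS) (∈-++⁺ˡ m)
        Q⊆S : ∀ {x} → x ∈ Q → x ∈ S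
        Q⊆S m = subst (_ ∈_) (sym eqS) (∈-++⁺ʳ P (∈-++⁺ʳ B m))

        uS : Unique (P ++ B ++ Q)
        uS = subst Unique eqS uniq
        uB : Unique B
        uB = Unique-prefix B (Unique-suffix P uS)
        P∉B : ∀ {x} → x ∈ P → x ∉ B
        P∉B m q = Unique-disjoint P uS m (∈-++⁺ˡ q)
        Q∉B : ∀ {x} → x ∈ Q → x ∉ B
        Q∉B m q = Unique-disjoint B (Unique-suffix P uS) q m
        X∉B : ∀ {x} → x ∈ X → x ∉ B
        X∉B m q = S∉X (B⊆S q) m
        b∈B : b ∈ B
        b∈B = there (∈-++⁺ʳ M (here refl))

        whole : Linked (Adj es) ((xl ∷ P) ++ B ++ Q ++ [ xr ])
        whole = subst (Linked (Adj es)) (trans (cong (λ q → xl ∷ q ++ [ xr ]) eqS)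
          (cong (xl ∷_) (trans (++-assoc P (B ++ Q) [ xr ]) (cong (P ++_) (++-assoc B Q [ xr ]))))) linked

        linked-B : Linked (Adj es) B
        linked-B = Linked-prefix B (Linked-suffix (xl ∷ P) whole)

        out-l : ∀ {x} → x ∈ xl ∷ P → x ∉ B
        out-l (here refl) = X∉B xl∈X
        out-l (there m) = P∉B m

        out-r : ∀ {x} → x ∈ Q ++ [ xr ] → x ∉ B
        out-r m with ∈-++⁻ Q m
        ... | inj₁ q = Q∉B q
        ... | inj₂ (here refl) = X∉B xr∈X

        keep-one : ∀ {v p q} → v ∈ B → p ∈ nb es v → q ∈ nb es v → p ∈ B → q ∉ B → deg keep v ≡ 1
        keep-one {v} {p} {q} v∈ mp mq p∈ q∉ = trans (deg-keep v) (≤-antisym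
          (s≤s⁻¹ (≤-trans (cnt-strict {P = K v} {λ _ → true} (nb es v) (λ _ _ → refl) mp refl (K-in v∈ p∈))
            (≤-trans (cnt≤length _ (nb es v)) (∉X-deg≤2 (S∉X (B⊆S v∈))))))
          (cnt-∈ (K v) mq (K-out {v} q∉)))

        keep-a : deg keep a ≡ 1
        keep-a with linked-neighbours xl P M b (Linked-prefix ((xl ∷ P) ++ B) (subst (Linked (Adj es)) (sym (++-assoc (xl ∷ P) B (Q ++ [ xr ]))) whole))
        ... | p , q , p∈ , q∈ , r , r' = keep-one (here refl) r' (nb-sym es r) (there q∈) (out-l p∈)

        keep-b : deg keep b ≡ 1
        keep-b with linked-neighbours a M Q xr (subst (Linked (Adj es)) (++-assoc (a ∷ M) [ b ] (Q ++ [ xr ])) (Linked-suffix (xl ∷ P) whole))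
        ... | p , q , p∈ , q∈ , r , r' = keep-one b∈B (nb-sym es r) r' (∈-++⁺ˡ {xs = a ∷ M} p∈) (out-r q∈)

        split-B : ∀ {M₁ x M₂} → M ≡ M₁ ++ x ∷ M₂ → B ≡ (a ∷ M₁) ++ x ∷ M₂ ++ [ b ]
        split-B {M₁} {x} {M₂} eqM = cong (a ∷_) (trans (cong (_++ [ b ]) eqM) (++-assoc M₁ (x ∷ M₂) [ b ]))

        keep-M : ∀ {x} → x ∈ M → deg keep x ≡ 0
        keep-M {x} m with ∈-∃++ m
        ... | M₁ , M₂ , eqM with linked-neighbours a M₁ M₂ b (subst (Linked (Adj es)) (split-B eqM) linked-B)
        ...   | p , q , p∈ , q∈ , r , r' = trans (deg-keep x) (cnt-none (K x) (nb es x) (λ y my → K-in x∈B (mem⁻ (cnt-full (mem B) (nb es x) full my))))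
          where
          eqB = split-B eqM
          x∈B : x ∈ B
          x∈B = there (∈-++⁺ˡ m)
          p∈B : p ∈ B
          p∈B = subst (p ∈_) (sym eqB) (∈-++⁺ˡ p∈)
          q∈B : q ∈ B
          q∈B = subst (q ∈_) (sym eqB) (∈-++⁺ʳ (a ∷ M₁) (there q∈))
          p≢q : p ≢ q
          p≢q refl = Unique-disjoint (a ∷ M₁) (subst Unique eqB uB) p∈ (there q∈)
          full : length (nb es x) ≤ cnt (mem B) (nb es x)
          full = ≤-trans (∉X-deg≤2 (S∉X (B⊆S x∈B))) (cnt-two (mem B) (nb-sym es r) r' p≢q (mem⁺ p∈B) (mem⁺ q∈B))

        B∈support : ∀ {x} → x ∈ B → support es x ≡ true
        B∈support m = S-support (B⊆S m)

        arc-loop : b ≡ w → rest ≡ []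
        arc-loop refl = lem rest ends uniqA
          where
          lem : ∀ rs → EndsAt b (b ∷ rs) → Unique (b ∷ rs) → rs ≡ []
          lem [] _ _ = refl
          lem (r ∷ rs) (there e) (u ∷ _) = ⊥-elim (All.lookup u (EndsAt-∈ e) refl)

        deg' : ∀ x → deg es' x ≡ deg keep x + (deg cs x + deg as x)
        deg' x = trans (deg-++ keep (cs ++ as) x) (cong (deg keep x +_) (deg-++ cs as x))

        sum3 : ∀ {x p q r} → deg keep x ≡ p → deg cs x ≡ q → deg as x ≡ r → deg es' x ≡ p + (q + r)
        sum3 {x} e₁ e₂ e₃ = trans (deg' x) (cong₂ _+_ e₁ (cong₂ _+_ e₂ e₃))

        uC = IsCycle.uniq icC

        same : ∀ {x} → x ∉ B → x ∉ C → x ∉ arc → nb es' x ≡ nb es x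
        same {x} x∉B x∉C x∉A = trans (nb-extra keep (cs ++ as) (trans (deg-++ cs as x)
          (cong₂ _+_ (deg-cycle-∉ x∉C) (deg-path-∉ ends uniqA x∉A)))) (keep-∉ x∉B)

        deg-a : deg es' a ≡ 3
        deg-a = sum3 keep-a (deg-cycle-∈ uC a∈C) (deg-path-∉ ends uniqA (λ m → w≢a (sym (A∩C m a∈C))))

        -- For `b = w` the third edge is the one of the segment kept at `b`; otherwise `w` is off H
        -- and the third edge is the last one of the arc.
        deg-w : deg es' w ≡ 3
        deg-w with b ≟ w
        ... | yes refl = sum3 keep-b (deg-cycle-∈ uC w∈C) (trivial rest (arc-loop refl))
          where
          trivial : ∀ rs → rs ≡ [] → deg (pathE (b ∷ rs)) b ≡ 0
          trivial [] refl = refl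
        ... | no b≢w = sum3 (trans (deg-cong {es = keep} {es} (keep-∉ (λ m → true≢false (B∈support m) ns))) (unsupported {es = es} ns))
                         (deg-cycle-∈ uC w∈C) (deg-path-last ends uniqA b≢w)
          where
          ns : support es w ≡ false
          ns with bool-cases (support es w)
          ... | inj₂ e = e
          ... | inj₁ e = ⊥-elim (b≢w (sym (A∩H (EndsAt-∈ ends) e)))

        -- The inner vertices of the stretch that are off `C` become isolated, so the support may
        -- shrink. The gain is the new cubic vertices `a` and `w`.
        data Place (x : Fin n) : Set where
          at-a : x ≡ a → Place x
          at-w : x ≡ w → Place x
          isolated : deg es' x ≡ 0 → Place x
          through : deg es' x ≡ 2 → Place x
          off : x ∉ B → x ∉ C → x ∉ arc → Place x

        no-support : ∀ {x} → x ∉ B → x ∈ C → support es x ≡ false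
        no-support {x} x∉ x∈ with bool-cases (support es x)
        ... | inj₂ e = e
        ... | inj₁ e = ⊥-elim (x∉ (C∩H x∈ e))

        place : ∀ x → Place x
        place x with x ≟ a | x ≟ w
        ... | yes e | _ = at-a e
        ... | no _ | yes e = at-w e
        ... | no x≢a | no x≢w with x ∈? B
        place x | no x≢a | no x≢w | yes (here e) = ⊥-elim (x≢a e)
        place x | no x≢a | no x≢w | yes (there m) with ∈-++⁻ M m
        ... | inj₂ (here refl) = through (sum3 keep-b (deg-cycle-∉ (λ q → x≢w (A∩C (here refl) q))) (deg-path-first ends uniqA x≢w))
        ... | inj₁ q with x ∈? C
        ...   | yes c = through (sum3 (keep-M q) (deg-cycle-∈ uC c) (deg-path-∉ ends uniqA (λ m → x≢w (A∩C m c))))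
        ...   | no c = isolated (sum3 (keep-M q) (deg-cycle-∉ c) (deg-path-∉ ends uniqA x∉arc))
          where
          x∉arc : x ∉ arc
          x∉arc m with A∩H m (B∈support (there (∈-++⁺ˡ q)))
          ... | refl = Unique-disjoint (a ∷ M) uB (there q) (here refl)
        place x | no x≢a | no x≢w | no x∉B with x ∈? C | x ∈? arc
        ... | yes c | yes m = ⊥-elim (x≢w (A∩C m c))
        ... | yes c | no m = through (sum3 (trans (deg-cong {es = keep} {es} (keep-∉ x∉B)) (unsupported {es = es} (no-support x∉B c))) (deg-cycle-∈ uC c) (deg-path-∉ ends uniqA m))
        ... | no c | no m = off x∉B c m
        ... | no c | yes m = through (sum3 (trans (deg-cong {es = keep} {es} (keep-∉ x∉B)) (unsupported {es = es} ns)) (deg-cycle-∉ c)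
                (deg-path-inner ends uniqA m (λ { refl → x∉B b∈B }) x≢w))
          where
          ns : support es x ≡ false
          ns with bool-cases (support es x)
          ... | inj₂ e = e
          ... | inj₁ e = ⊥-elim (x∉B (subst (_∈ B) (sym (A∩H m e)) b∈B))

        in-parts : ∀ {x y} → y ∈ nb es' x → y ∈ nb keep x ⊎ y ∈ nb cs x ⊎ y ∈ nb as x
        in-parts {x} {y} m with ∈-++⁻ (nb keep x) (subst (y ∈_) (nb-++ keep (cs ++ as) x) m)
        ... | inj₁ q = inj₁ q
        ... | inj₂ q with ∈-++⁻ (nb cs x) (subst (y ∈_) (nb-++ cs as x) q)
        ...   | inj₁ r = inj₂ (inj₁ r)
        ...   | inj₂ r = inj₂ (inj₂ r)

        keep⁻ : ∀ {x y} → y ∈ nb keep x → y ∈ nb es x × K x y ≡ true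
        keep⁻ {x} {y} m = ∈-filterᵇ⁻ (K x) (subst (y ∈_) (nb-keep x) m)

        inG' : ∀ x y → y ∈ nb es' x → T (adj G x y)
        inG' x y m with in-parts m
        ... | inj₁ q = inG x y (proj₁ (keep⁻ q))
        ... | inj₂ (inj₁ q) = proj₁ (nb-cycle (GAdj G) (GAdj-sym G) (IsCycle.clos icC) q)
        ... | inj₂ (inj₂ q) = proj₁ (nb-path (GAdj G) (GAdj-sym G) linkA q)

        degrees' : ∀ x → deg es' x ≡ 0 ⊎ (2 ≤ deg es' x × deg es' x ≤ 3)
        degrees' x with place x
        ... | at-a refl rewrite deg-a = inj₂ (s≤s (s≤s z≤n) , ≤-refl)
        ... | at-w refl rewrite deg-w = inj₂ (s≤s (s≤s z≤n) , ≤-refl)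
        ... | isolated e = inj₁ e
        ... | through e rewrite e = inj₂ (≤-refl , s≤s (s≤s z≤n))
        ... | off p q r rewrite same p q r = degrees x

        low : ∀ x → x ∉ X → x ≢ a → x ≢ w → deg es' x ≤ 2
        low x x∉ na nw with place x
        ... | at-a e = ⊥-elim (na e)
        ... | at-w e = ⊥-elim (nw e)
        ... | isolated e = ≤-trans (≤-reflexive e) z≤n
        ... | through e = ≤-reflexive e
        ... | off p q r rewrite same p q r = ∉X-deg≤2 x∉

        cnt-parts : ∀ (W : VSet n) x → cnt W (nb es' x) ≡ cnt W (nb keep x) + (cnt W (nb cs x) + cnt W (nb as x))
        cnt-parts W x = trans (cnt-nb-++ W keep (cs ++ as) x) (cong (cnt W (nb keep x) +_) (cnt-nb-++ W cs as x))

        w∈S⇒w∈B : w ∈ S → w ∈ B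
        w∈S⇒w∈B m = subst (_∈ B) (sym (A∩H (EndsAt-∈ ends) (S-support m))) b∈B

        -- Absence spreads from `X` along `P` and `Q`, so at `B` no kept edge counts. If `b` differs
        -- from `w`, then `b` has only the arc left and is absent, and with it the arc up to `w`. A
        -- vertex of `C` in `W` hence has only its two cycle edges to rely on, which forces all of
        -- `C` into `W`.
        long-core : ∀ W → Core es' W → (∀ x → x ∈ X → W x ≡ false) → ∀ {y} → W y ≡ true → L ≤ size W
        long-core W co offX {y} wy = split
          where
          lift : ∀ {xs} → (∀ {x} → x ∈ xs → x ∉ B) → Linked (Adj es) xs → Linked (Adj es') xs
          lift f = Linked-map-∈ (λ {u} m r → subst (_ ∈_) (sym (nb-++ keep (cs ++ as) u)) (∈-++⁺ˡ (subst (_ ∈_) (sym (keep-∉ (f m))) r)))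
          side-low : ∀ x → x ∈ S → x ∉ B → deg es' x ≤ 2
          side-low x m x∉ = low x (S∉X m) (λ { refl → x∉ (here refl) }) (λ { refl → x∉ (w∈S⇒w∈B m) })
          P-false : ∀ {x} → x ∈ P → W x ≡ false
          P-false = forward-false es' co (lift out-l (Linked-prefix (xl ∷ P) whole)) (offX xl xl∈X) (λ x m → side-low x (P⊆S m) (P∉B m))
          Q-false : ∀ {x} → x ∈ Q → W x ≡ false
          Q-false = backward-false es' co Q (lift out-r (Linked-suffix B (Linked-suffix (xl ∷ P) whole))) (offX xr xr∈X) (λ x m → side-low x (Q⊆S m) (Q∉B m))
          keep-0 : ∀ {x} → x ∈ B → cnt W (nb keep x) ≡ 0
          keep-0 {x} x∈ = cnt-none W (nb keep x) far
            where
            far : ∀ u → u ∈ nb keep x → W u ≡ false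
            far u m with keep⁻ m
            ... | un , ku with nb-closed (B⊆S x∈) un
            ...   | inj₂ q = offX u q
            ...   | inj₁ q with ∈-++⁻ P (subst (u ∈_) eqS q)
            ...     | inj₁ r = P-false r
            ...     | inj₂ r with ∈-++⁻ B r
            ...       | inj₁ t = ⊥-elim (true≢false ku (K-in x∈ t))
            ...       | inj₂ t = Q-false t
          b-false : b ≢ w → W b ≡ false
          b-false b≢w = core-false es' co (≤-trans (≤-reflexive (trans (cnt-parts W b)
            (cong₂ _+_ (keep-0 b∈B) (cong (_+ cnt W (nb as b)) (cnt-deg-0 W cs (deg-cycle-∉ (λ q → b≢w (A∩C (here refl) q))))))))
            (≤-trans (cnt≤length W (nb as b)) (≤-reflexive (deg-path-first ends uniqA b≢w))))
          arc-false : ∀ {x} → x ∈ arc → x ≢ w → W x ≡ false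
          arc-false {x} m x≢w = lem init eqArc m
            where
            lem : ∀ i → arc ≡ i ++ [ w ] → x ∈ arc → W x ≡ false
            lem [] eq m with subst (x ∈_) eq m
            ... | here e = ⊥-elim (x≢w e)
            lem (i₀ ∷ i) eq m with ∷-injectiveˡ eq | ∈-++⁻ (i₀ ∷ i) (subst (x ∈_) eq m)
            ... | _ | inj₂ (here e) = ⊥-elim (x≢w e)
            ... | refl | inj₁ (here refl) = b-false x≢w
            ... | refl | inj₁ (there q) = forward-false es' co
                  (Linked.map (λ {u} r → subst (_ ∈_) (sym (nb-++ keep (cs ++ as) u)) (∈-++⁺ʳ (nb keep u)
                    (subst (_ ∈_) (sym (nb-++ cs as u)) (∈-++⁺ʳ (nb cs u) r))))
                    (Linked-prefix (b ∷ i) (subst (Linked (Adj as)) eq (path-linked arc))))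
                  (b-false (λ b≡w → Unique-disjoint (b ∷ i) (subst Unique eq uniqA) (here refl) (here b≡w)))
                  (λ u m → low u (A∉X (inArc m)) (λ u≡a → w≢a (sym (A∩C (subst (_∈ arc) u≡a (inArc m)) a∈C)))
                    (λ u≡w → Unique-disjoint (b ∷ i) (subst Unique eq uniqA) (there m) (here u≡w))) q
              where
              inArc : ∀ {u} → u ∈ i → u ∈ arc
              inArc {u} m = subst (u ∈_) (sym eq) (there (∈-++⁺ˡ m))
          arc-0 : ∀ {x} → W x ≡ true → cnt W (nb as x) ≡ 0
          arc-0 {x} e = cnt-none W (nb as x) far
            where
            far : ∀ u → u ∈ nb as x → W u ≡ false
            far u m with nb-path _≢_ (λ ne q → ne (sym q)) (Unique⇒Linked≢ uniqA) m
            ... | ne , u∈ , x∈ with x ≟ w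
            ...   | yes refl = arc-false u∈ (λ q → ne (sym q))
            ...   | no nw = ⊥-elim (true≢false e (arc-false x∈ nw))
          keep-C-0 : ∀ {x} → x ∈ C → cnt W (nb keep x) ≡ 0
          keep-C-0 {x} x∈ with x ∈? B
          ... | yes q = keep-0 q
          ... | no q = trans (cong (cnt W) (keep-∉ q)) (cnt-deg-0 W es (unsupported {es = es} (no-support q x∈)))
          along : ∀ {u v} → u ∈ C → v ∈ nb cs u → W u ≡ true → W v ≡ true
          along {u} u∈ m e = cnt-full W (nb cs u) (≤-trans (≤-reflexive (deg-cycle-∈ uC u∈))
            (subst (2 ≤_) (trans (cnt-parts W u) (trans (cong₂ (λ p q → p + (cnt W (nb cs u) + q)) (keep-C-0 u∈) (arc-0 e)) (+-identityʳ _))) (co u e))) m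
          split : L ≤ size W
          split with any? (λ v → (mem C v ≟ᵇ true) ×-dec (W v ≟ᵇ true))
          ... | yes (v , m , e) = ≤-trans L≤C (cycle-in-core (own-cycle icC) along (mem⁻ m) e)
          -- If `W` misses `C`, only kept edges count, so `W` is a core of the old frame avoiding
          -- `X` and must be empty.
          ... | no none = ⊥-elim (true≢false wy (X-hits W (λ v e → ≤-trans (subst (2 ≤_) (trans (cnt-parts W v)
                  (trans (cong₂ (λ p q → cnt W (nb keep v) + (p + q)) (cnt-deg-0 W cs (deg-cycle-∉ (λ m → none (v , mem⁺ m , e)))) (arc-0 e)) (+-identityʳ _))) (co v e))
                  (≤-trans (≤-reflexive (cong (cnt W) (nb-keep v))) (cnt-filterᵇ≤ W (K v) (nb es v)))) offX y))

      detour : Improvement G L es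
      detour = improvement es' (frame inG' degrees' (X-girth es' (λ x m → offX-same m) long-core))
        (inj₁ (two-more a w keeps (cubicOf {es = es'} (≤-reflexive (sym deg-a))) (noncubic (C∉X a∈C)) new-cubic))
        where
        offX-same : ∀ {x} → x ∈ X → nb es' x ≡ nb es x
        offX-same m = same (X∉B m) (λ q → C∉X q m) (λ q → A∉X q m)
        keeps : cubic es ⊑ cubic es'
        keeps x e rewrite offX-same (cubic∈X e) = e
        new-cubic : ∀ x → cubic es' x ≡ true → x ≡ a ⊎ x ≡ w ⊎ cubic es x ≡ true
        new-cubic x e with place x
        ... | at-a q = inj₁ q
        ... | at-w q = inj₂ (inj₁ q)
        ... | isolated q = ⊥-elim (<⇒≱ (cubic⁻ {es = es'} e) (≤-trans (≤-reflexive q) z≤n))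
        ... | through q = ⊥-elim (<⇒≱ (cubic⁻ {es = es'} e) (≤-reflexive q))
        ... | off p q r = inj₂ (inj₂ (subst (λ d → (3 ≤ᵇ length d) ≡ true) (same p q r) e))

-- Searching for long cycles and cutting lists at hits

list? : ∀ {n} (m : ℕ) {P : List (Fin n) → Set} → (∀ xs → Dec (P xs)) → Dec (∃[ xs ] (length xs ≤ m × P xs))
list? zero P? with P? []
... | yes p = yes ([] , z≤n , p)
... | no np = no λ { ([] , _ , p) → np p }
list? (suc m) P? with P? []
... | yes p = yes ([] , z≤n , p)
... | no np with any? (λ x → list? m (λ xs → P? (x ∷ xs)))
...   | yes (x , xs , l , p) = yes (x ∷ xs , s≤s l , p)
...   | no nq = no λ { ([] , _ , p) → np p ; (x ∷ xs , s≤s l , p) → nq (x , xs , l , p) }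

isCycle? : ∀ {n} (G : Graph n) c → Dec (IsCycle (GAdj G) c)
isCycle? G [] = no λ { (isCycle _ () _) }
isCycle? G (x ∷ xs) = map′ (λ (u , l , k) → isCycle u l k) (λ { (isCycle u l k) → u , l , k })
  (unique? _≟_ (x ∷ xs) ×-dec (3 ≤? length (x ∷ xs)) ×-dec Linked.linked? (λ u v → T? (adj G u v)) (x ∷ xs ++ [ x ]))

LongCycleAvoiding : ∀ {n} → Graph n → ℕ → List (Fin n) → List (Fin n) → Set
LongCycleAvoiding G L Y C = IsCycle (GAdj G) C × L ≤ length C × All (_∉ Y) C

longCycle? : ∀ {n} (G : Graph n) L Y → Dec (∃[ C ] LongCycleAvoiding G L Y C)
longCycle? {n} G L Y = map′ (λ (C , _ , p) → C , p) (λ (C , p) → C , unique-length≤n (IsCycle.uniq (proj₁ p)) , p)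
  (list? n (λ C → isCycle? G C ×-dec (L ≤? length C) ×-dec All.all? (λ v → ¬? (v ∈? Y)) C))

first-hit : ∀ {n} (P : VSet n) {xs y} → y ∈ xs → P y ≡ true →
  ∃[ i ] ∃[ w ] ∃[ post ] (xs ≡ i ++ w ∷ post × P w ≡ true × (∀ x → x ∈ i → P x ≡ false))
first-hit P {x ∷ xs} m e with bool-cases (P x)
... | inj₁ q = [] , x , xs , refl , q , λ _ ()
first-hit P {x ∷ xs} (here refl) e | inj₂ q = ⊥-elim (true≢false e q)
first-hit P {x ∷ xs} (there m) e | inj₂ q with first-hit P m e
... | i , w , post , eq , pw , f = x ∷ i , w , post , cong (x ∷_) eq , pw , λ { y (here refl) → q ; y (there r) → f y r }

last-hit : ∀ {n} (P : VSet n) {xs y} → y ∈ xs → P y ≡ true →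
  ∃[ i ] ∃[ w ] ∃[ post ] (xs ≡ i ++ w ∷ post × P w ≡ true × (∀ x → x ∈ post → P x ≡ false))
last-hit P {x ∷ xs} m e with any? (λ v → (mem xs v ≟ᵇ true) ×-dec (P v ≟ᵇ true))
... | yes (v , q , pv) with last-hit P (mem⁻ q) pv
...   | i , w , post , eq , pw , f = x ∷ i , w , post , cong (x ∷_) eq , pw , f
last-hit P {x ∷ xs} (there m) e | no nq = ⊥-elim (nq (_ , mem⁺ m , e))
last-hit P {x ∷ xs} (here refl) e | no nq = [] , x , xs , refl , e , off
  where
  off : ∀ y → y ∈ xs → P y ≡ false
  off y m with bool-cases (P y)
  ... | inj₂ q = q
  ... | inj₁ q = ⊥-elim (nq (y , mem⁺ m , q))

-- Taking the outermost hits confines everything that `D` has on `S` to the stretch between `a` and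
-- `b`, as the detour requires.
outer-hits : ∀ {n} (D : VSet n) {S x y} → x ∈ S → y ∈ S → x ≢ y → D x ≡ true → D y ≡ true →
  ∃[ P ] ∃[ a ] ∃[ M ] ∃[ b ] ∃[ Q ] (S ≡ P ++ (a ∷ M ++ [ b ]) ++ Q × D a ≡ true × D b ≡ true
    × (∀ z → z ∈ P → D z ≡ false) × (∀ z → z ∈ Q → D z ≡ false))
outer-hits D {S} {x} {y} mx my ne dx dy with first-hit D mx dx
... | P , a , post , eq , da , f with other
  where
  later : ∀ {z} → z ∈ S → z ≢ a → D z ≡ true → z ∈ post
  later m ne dz with ∈-++⁻ P (subst (_ ∈_) eq m)
  ... | inj₁ q = ⊥-elim (true≢false dz (f _ q))
  ... | inj₂ (here q) = ⊥-elim (ne q)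
  ... | inj₂ (there q) = q
  other : ∃[ z ] (z ∈ post × D z ≡ true)
  other with x ≟ a
  ... | yes refl = y , later my (λ q → ne (sym q)) dy , dy
  ... | no xa = x , later mx xa dx , dx
...   | z , mz , dz with last-hit D mz dz
...     | M , b , Q , eq' , db , g = P , a , M , b , Q ,
          trans eq (cong (λ q → P ++ a ∷ q) (trans eq' (sym (++-assoc M [ b ] Q)))) , da , db , f , g

-- On a list from a P-vertex to a Q-vertex, the stretch from the last P-vertex before the first Q-vertex.
crossing : ∀ {n} (P Q : VSet n) u ps rest → P u ≡ true → (∀ x → x ∈ ps → P x ≡ false × Q x ≡ false) →
  (∀ x → P x ≡ true → Q x ≡ false) → ∀ {y} → y ∈ rest → Q y ≡ true →
  ∃[ as ] ∃[ u' ] ∃[ ps' ] ∃[ v ] ∃[ bs ] (u ∷ ps ++ rest ≡ as ++ (u' ∷ ps' ++ [ v ]) ++ bs × P u' ≡ true × Q v ≡ true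
    × (∀ x → x ∈ ps' → P x ≡ false × Q x ≡ false))
crossing P Q u ps (r ∷ rs) pu f d m qy with bool-cases (Q r)
... | inj₁ qr = [] , u , ps , r , rs , cong (u ∷_) (sym (++-assoc ps [ r ] rs)) , pu , qr , f
crossing P Q u ps (r ∷ rs) pu f d (here refl) qy | inj₂ qr = ⊥-elim (true≢false qy qr)
crossing P Q u ps (r ∷ rs) pu f d (there m) qy | inj₂ qr with bool-cases (P r)
... | inj₁ pr with crossing P Q r [] rs pr (λ _ ()) d m qy
...   | as , u' , ps' , v , bs , eq , pu' , qv , g = (u ∷ ps) ++ as , u' , ps' , v , bs ,
        trans (cong ((u ∷ ps) ++_) eq) (sym (++-assoc (u ∷ ps) as _)) , pu' , qv , g
crossing P Q u ps (r ∷ rs) pu f d (there m) qy | inj₂ qr | inj₂ pr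
  with crossing P Q u (ps ++ [ r ]) rs pu snoc d m qy
  where
  snoc : ∀ x → x ∈ ps ++ [ r ] → P x ≡ false × Q x ≡ false
  snoc x q with ∈-++⁻ ps q
  ... | inj₁ t = f x t
  ... | inj₂ (here refl) = pr , qr
...   | as , u' , ps' , v , bs , eq , rest' = as , u' , ps' , v , bs , trans (cong (u ∷_) (sym (++-assoc ps [ r ] rs))) eq , rest'

Linked-infix : ∀ {n} {R : Rel n} as {bs} cs → Linked R (as ++ bs ++ cs) → Linked R bs
Linked-infix as {bs} cs l = Linked-prefix bs (Linked-suffix as l)

Unique-infix : ∀ {n} as {bs : List (Fin n)} cs → Unique (as ++ bs ++ cs) → Unique bs
Unique-infix as {bs} cs u = Unique-prefix bs (Unique-suffix as u)

rotate-to : ∀ {n} {R : Rel n} {C z} → IsCycle R C → z ∈ C →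
  ∃[ rest ] (IsCycle R (z ∷ rest) × (∀ {x} → x ∈ C → x ∈ z ∷ rest) × (∀ {x} → x ∈ z ∷ rest → x ∈ C))
rotate-to ic m with ∈-∃++ m
... | as , bs , refl = bs ++ as , rotate as ic , rotate-∈ as , rotate-∈⁻ as

-- Long cycles outside X and their contacts with the frame

module Improve {n} {G : Graph n} {L} (3≤L : 3 ≤ L) {es} (F : Frame G L es) (X : List (Fin n))
    (cubic∈X : ∀ {v} → cubic es v ≡ true → v ∈ X)
    (X-hits : ∀ W → Core es W → (∀ v → v ∈ X → W v ≡ false) → ∀ v → W v ≡ false)
    (X-girth : ∀ es' → (∀ v → v ∈ X → nb es' v ≡ nb es v) →
      (∀ W → Core es' W → (∀ v → v ∈ X → W v ≡ false) → ∀ {w} → W w ≡ true → L ≤ size W) →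
      ∀ W → Core es' W → ∀ {w} → W w ≡ true → L ≤ size W) where
  open Segments 3≤L F X cubic∈X X-hits
  open Surgery 3≤L F X cubic∈X X-hits X-girth

  record LongCycle (C : List (Fin n)) : Set where
    constructor longCycle
    field
      isCyc : IsCycle (GAdj G) C
      isLong : L ≤ length C
      avoids : ∀ {x} → x ∈ C → x ∉ X

  module _ {z} (seg : Segment z) where
    open Segment seg

    -- Going around `C` from `z`, the stretch between `S` and the first frame vertex outside `S` has
    -- an interior disjoint from H, hence is an ear.
    leaving : ∀ {C} → LongCycle C → z ∈ C → ∀ {y} → y ∈ C → support es y ≡ true → y ∉ S → Improvement G L es
    leaving (longCycle ic lc av) zC {y} yC sy y∉ with rotate-to ic zC
    ... | rest , isCycle uq _ lk , to , from with to yC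
    ...   | here refl = ⊥-elim (y∉ z∈S)
    ...   | there m with crossing (mem S) (λ x → support es x ∧ not (mem S x)) z [] rest (mem⁺ z∈S) (λ _ ())
              (λ x e → out x e) m (∧-true⁺ sy (not-true⁺ (mem-∉⁺ y∉)))
      where
      out : ∀ x → mem S x ≡ true → support es x ∧ not (mem S x) ≡ false
      out x e rewrite e with support es x
      ... | true = refl
      ... | false = refl
    ...     | as , u , ps , v , bs , eq , pu , qv , inner with ∧-true⁻ qv
    ...       | sv , nv = Ear.addEar seg u ps v
      (Linked-infix as bs (subst (Linked (GAdj G)) eq (Linked-prefix (z ∷ rest) lk)))
      (Unique-infix as bs (subst Unique eq uq))
      (λ q → av (from (subst (_ ∈_) (sym eq) (∈-++⁺ʳ as (∈-++⁺ˡ q)))))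
      (mem⁻ pu) (mem-∉⁻ (not-true⁻ nv)) sv (λ q → un (inner _ q))
      where
      un : ∀ {x} → mem S x ≡ false × (support es x ∧ not (mem S x)) ≡ false → support es x ≡ false
      un {x} (e , e') rewrite e with support es x
      ... | false = refl

    staying : ∀ {C} → LongCycle C → (∀ {x} → x ∈ C → support es x ≡ true → x ∈ S) → z ∈ C →
      ∀ {y} → y ∈ C → support es y ≡ true → y ≢ z → Improvement G L es
    staying {C} (longCycle ic lc av) CS zC {y} yC sy y≢z
      with outer-hits (mem C) (CS yC sy) z∈S y≢z (mem⁺ yC) (mem⁺ zC)
    ... | P , a , M , b , Q , eq , da , db , fP , fQ =
      -- Here `b` is itself on `C`, so the arc is the single vertex `b` and `w = b`.
      Detour.detour seg P a M b Q eq ic lc av inB (mem⁻ da) [] [] b refl [-] ([] ∷ [])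
        (λ { (here refl) → av (mem⁻ db) }) (λ { (here refl) _ → refl }) (λ { (here refl) _ → refl }) (mem⁻ db)
        (λ b≡a → Unique-disjoint [ a ] (Unique-infix P Q (subst Unique eq uniq)) (here refl) (∈-++⁺ʳ M (here (sym b≡a))))
      where
      inB : ∀ {x} → x ∈ C → support es x ≡ true → x ∈ a ∷ M ++ [ b ]
      inB {x} m s with ∈-++⁻ P (subst (x ∈_) eq (CS m s))
      ... | inj₁ q = ⊥-elim (true≢false (mem⁺ m) (fP x q))
      ... | inj₂ q with ∈-++⁻ (a ∷ M ++ [ b ]) q
      ...   | inj₁ r = r
      ...   | inj₂ r = ⊥-elim (true≢false (mem⁺ m) (fQ x r))

  two-contacts : ∀ {C} → LongCycle C → ∀ {z y} → z ∈ C → y ∈ C → support es z ≡ true → support es y ≡ true → y ≢ z →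
    Improvement G L es
  two-contacts {C} lc {z} {y} zC yC sz sy y≢z with segment sz (LongCycle.avoids lc zC)
  ... | seg with any? (λ x → (mem C x ≟ᵇ true) ×-dec ((support es x ≟ᵇ true) ×-dec ¬? (x ∈? Segment.S seg)))
  ...   | yes (x , m , s , x∉) = leaving seg lc zC (mem⁻ m) s x∉
  ...   | no none = staying seg lc inside zC yC sy y≢z
    where
    inside : ∀ {x} → x ∈ C → support es x ≡ true → x ∈ Segment.S seg
    inside {x} m s with x ∈? Segment.S seg
    ... | yes q = q
    ... | no q = ⊥-elim (none (x , mem⁺ m , s , q))

  record Pinned : Set where
    constructor pinned
    field
      C : List (Fin n)
      z : Fin n
      isLongCycle : LongCycle C
      z∈C : z ∈ C
      z∈H : support es z ≡ true
      only : ∀ {x} → x ∈ C → support es x ≡ true → x ≡ z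

  -- Following `C` from `z` to its first vertex `w` on `C'` and then `C'` to `z'` gives a path: the
  -- first part avoids `C'` before `w`. It meets H only in `z` and `z'`, so it is an ear.
  bridge : ∀ (p q : Pinned) → Pinned.z p ≢ Pinned.z q → ∀ {m} → m ∈ Pinned.C p → m ∈ Pinned.C q →
    (seg : Segment (Pinned.z p)) → Pinned.z q ∉ Segment.S seg → Improvement G L es
  bridge (pinned C z (longCycle ic _ av) zC zH only) (pinned C' z' (longCycle ic' _ av') zC' zH' only') z≢z' {m} mC mC' seg z'∉S
    with rotate-to ic zC
  ... | R , isCycle uR _ lR , to , from with first-hit (mem C') (to mC) (mem⁺ mC')
  -- If `z` were on `C'`, it would be a frame vertex there and thus equal to `z'`.
  ...   | [] , w , post , eq , dw , f = ⊥-elim (z≢z' (only' (subst (_∈ C') (sym (∷-injectiveˡ eq)) (mem⁻ dw)) zH))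
  ...   | _ ∷ i , w , post , refl , dw , f with rotate-to ic' (mem⁻ dw)
  ...     | R' , isCycle uR' _ lR' , to' , from' with to' zC'
  ...       | here refl = ⊥-elim (z≢z' (sym (only (from (∈-++⁺ʳ (z ∷ i) (here refl))) zH')))
  ...       | there mz with ∈-∃++ mz
  ...         | j , post' , refl = Ear.addEar seg z (i ++ w ∷ j) z'
    (subst (Linked (GAdj G)) (sym shape) (Linked-join (z ∷ i)
      (Linked-prefix (z ∷ i ++ [ w ]) (subst (Linked (GAdj G)) (sym (++-assoc (z ∷ i) [ w ] (post ++ [ z ]))) (subst (Linked (GAdj G)) (++-assoc (z ∷ i) (w ∷ post) [ z ]) lR)))
      (Linked-prefix (w ∷ j ++ [ z' ]) (subst (Linked (GAdj G)) (sym (++-assoc (w ∷ j) [ z' ] (post' ++ [ w ]))) (subst (Linked (GAdj G)) (++-assoc (w ∷ j) (z' ∷ post') [ w ]) lR')))))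
    (subst Unique (sym shape) (Unique-++ (Unique-prefix (z ∷ i) uR) uA'
      (λ x p q → true≢false (mem⁺ (inC' q)) (f x p))))
    (λ {x} p → offX (∈-++⁻ (z ∷ i) (subst (x ∈_) shape p)))
    (Segment.z∈S seg) z'∉S zH' inner
    where
    shape : z ∷ (i ++ w ∷ j) ++ [ z' ] ≡ (z ∷ i) ++ (w ∷ j ++ [ z' ])
    shape = ++-assoc (z ∷ i) (w ∷ j) [ z' ]
    uA' : Unique (w ∷ j ++ [ z' ])
    uA' = Unique-prefix (w ∷ j ++ [ z' ]) (subst Unique (sym (++-assoc (w ∷ j) [ z' ] post')) uR')
    inC' : ∀ {x} → x ∈ w ∷ j ++ [ z' ] → x ∈ C'
    inC' {x} p = from' (subst (x ∈_) (++-assoc (w ∷ j) [ z' ] post') (∈-++⁺ˡ p))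
    offX : ∀ {x} → x ∈ z ∷ i ⊎ x ∈ w ∷ j ++ [ z' ] → x ∉ X
    offX (inj₁ p) = av (from (∈-++⁺ˡ p))
    offX (inj₂ p) = av' (inC' p)
    inner : ∀ {x} → x ∈ i ++ w ∷ j → support es x ≡ false
    inner {x} p with bool-cases (support es x)
    ... | inj₂ e = e
    ... | inj₁ e with ∈-++⁻ i p
    ...   | inj₁ q = ⊥-elim (Unique-disjoint [ z ] uR (here (only (from (there (∈-++⁺ˡ q))) e)) (∈-++⁺ˡ q))
    ...   | inj₂ q = ⊥-elim (Unique-disjoint (w ∷ j) uA' q (here (only' (inC' (∈-++⁺ˡ q)) e)))

  -- z precedes z' on the segment: reroute through C and reach it from z' along C'.
  pinch : ∀ (p q : Pinned) → Pinned.z p ≢ Pinned.z q → ∀ {m} → m ∈ Pinned.C p → m ∈ Pinned.C q → ∀ {y} (seg : Segment y) → ∀ P M Q →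
    Segment.S seg ≡ P ++ (Pinned.z p ∷ M ++ [ Pinned.z q ]) ++ Q → Improvement G L es
  pinch (pinned C z (longCycle ic lc av) zC zH only) (pinned C' z' (longCycle ic' _ av') zC' zH' only') z≢z' mC mC' seg P M Q eqS
    with rotate-to ic' zC'
  ... | R , isCycle uR _ lR , to , from with first-hit (mem C) (to mC') (mem⁺ mC)
  ...   | [] , w , post , eq , dw , f = ⊥-elim (z≢z' (sym (only (subst (_∈ C) (sym (∷-injectiveˡ eq)) (mem⁻ dw)) zH')))
  ...   | _ ∷ i , w , post , refl , dw , f = Detour.detour seg P z M z' Q eqS ic lc av
    (λ x∈ s → here (only x∈ s)) zC (i ++ [ w ]) (z' ∷ i) w refl
    (Linked-prefix (z' ∷ i ++ [ w ]) (subst (Linked (GAdj G)) (sym (++-assoc (z' ∷ i) [ w ] (post ++ [ z' ])))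
      (subst (Linked (GAdj G)) (++-assoc (z' ∷ i) (w ∷ post) [ z' ]) lR)))
    (Unique-prefix (z' ∷ i ++ [ w ]) (subst Unique (sym (++-assoc (z' ∷ i) [ w ] post)) uR))
    (λ p → av' (inC' p)) (λ p s → only' (inC' p) s) meets (mem⁻ dw)
    (λ w≡z → z≢z' (only' (subst (_∈ C') w≡z (inC' (∈-++⁺ʳ (z' ∷ i) (here refl)))) zH))
    where
    inC' : ∀ {x} → x ∈ (z' ∷ i) ++ [ w ] → x ∈ C'
    inC' {x} p = from (subst (x ∈_) (++-assoc (z' ∷ i) [ w ] post) (∈-++⁺ˡ p))
    meets : ∀ {x} → x ∈ (z' ∷ i) ++ [ w ] → x ∈ C → x ≡ w
    meets {x} p c with ∈-++⁻ (z' ∷ i) p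
    ... | inj₂ (here e) = e
    ... | inj₁ q = ⊥-elim (true≢false (mem⁺ c) (f x q))

  two-pinned : ∀ (p q : Pinned) → Pinned.z p ≢ Pinned.z q → ∀ {m} → m ∈ Pinned.C p → m ∈ Pinned.C q → Improvement G L es
  two-pinned p q z≢z' mp mq with segment (Pinned.z∈H p) (LongCycle.avoids (Pinned.isLongCycle p) (Pinned.z∈C p))
  ... | seg with Pinned.z q ∈? Segment.S seg
  ...   | no z'∉ = bridge p q z≢z' mp mq seg z'∉
  -- The outermost hits of the pair reveal which of the two contact vertices comes first on the
  -- segment; that one receives its whole cycle in the detour.
  ...   | yes z'∈ with outer-hits (mem (Pinned.z p ∷ Pinned.z q ∷ [])) (Segment.z∈S seg) z'∈ z≢z' (mem⁺ (here refl)) (mem⁺ (there (here refl)))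
  ...     | P , a , M , b , Q , eq , da , db , _ , _ with mem⁻ da | mem⁻ db
  ...       | here refl | there (here refl) = pinch p q z≢z' mp mq seg P M Q eq
  ...       | there (here refl) | here refl = pinch q p (λ e → z≢z' (sym e)) mq mp seg P M Q eq
  ...       | here refl | here refl = ⊥-elim (Unique-disjoint [ a ] (Unique-infix P Q (subst Unique eq (Segment.uniq seg))) (here refl) (∈-++⁺ʳ M (here refl)))
  ...       | there (here refl) | there (here refl) = ⊥-elim (Unique-disjoint [ a ] (Unique-infix P Q (subst Unique eq (Segment.uniq seg))) (here refl) (∈-++⁺ʳ M (here refl)))

-- The dichotomy

record LongPacking {n} (G : Graph n) (L k : ℕ) : Set where
  constructor longPacking
  field
    cycles : List (List (Fin n))
    number : length cycles ≡ k
    areLong : All (λ C → IsCycle (GAdj G) C × L ≤ length C) cycles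
    disjoint : AllPairs Disjoint cycles

record HittingSet {n} (G : Graph n) (L m : ℕ) : Set where
  constructor hittingSet
  field
    vertices : List (Fin n)
    small : length vertices ≤ m
    hitsAll : ¬ (∃[ C ] LongCycleAvoiding G L vertices C)

frame-packing : ∀ {n} {G : Graph n} {L es} {ll : Loopless es} {si k A} → Frame G L es → Packing es ll si k A → LongPacking G L k
frame-packing {G = G} {L} {es} F (packing cs num ac _ dj) = longPacking cs num (All.map (λ {c} → long {c}) ac) dj
  where
  open Frame F
  long : ∀ {c} → IsCycle (Adj es) c → IsCycle (GAdj G) c × L ≤ length c
  long {c} ic = IsCycle-map (λ {u} {v} → inG u v) ic ,
    ≤-trans (girth (mem c) (cycle-core es ic) (mem⁺ (proj₂ (cycle-vertex ic)))) (size-mem≤ c)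

module Step {n} {G : Graph n} {L'} (3≤L : 3 ≤ suc L') {es} (F : Frame G (suc L') es) (k : ℕ) where
  private
    L : ℕ
    L = suc L'

  open FrameProperties 3≤L F

  -- There are at most `size (cubic es) + k` marks, each accounting for `1 + 3 * L` vertices of the
  -- ball; the last `k` covers the contact vertices of the collected cycles.
  bound : ℕ
  bound = (size (cubic es) + k) * (1 + 3 * L) + k

  module _ (tr : Transversal k) where
    open Transversal tr
    open Layers tr

    X : List (Fin n)
    X = seen L

    open Improve 3≤L F X (λ e → marks⊆seen L (hasCubic e))
      (λ W co off → hits W co (λ v m → off v (marks⊆seen L m)))
      (λ es' ag out → girth-outside refl {es'} ag out)

    meeting? : ∀ C (ps : List Pinned) → (∃[ p ] (p ∈ ps × ∃[ m ] (m ∈ C × m ∈ Pinned.C p))) ⊎ All (λ p → Disjoint C (Pinned.C p)) ps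
    meeting? C [] = inj₂ []
    meeting? C (p ∷ ps) with any? (λ m → (m ∈? C) ×-dec (m ∈? Pinned.C p))
    ... | yes (m , a , b) = inj₁ (p , here refl , m , a , b)
    ... | no none with meeting? C ps
    ...   | inj₁ (q , q∈ , r) = inj₁ (q , there q∈ , r)
    ...   | inj₂ ds = inj₂ ((λ v a b → none (v , a , b)) ∷ ds)

    pin : ∀ C z → LongCycle C → z ∈ C → support es z ≡ true → ¬ (∃[ y ] (y ∈ C × support es y ≡ true × y ≢ z)) →
      Σ Pinned λ p → Pinned.C p ≡ C × Pinned.z p ≡ z
    pin C z lc zC sz none = pinned C z lc zC sz only , refl , refl
      where
      only : ∀ {x} → x ∈ C → support es x ≡ true → x ≡ z
      only {x} m s with x ≟ z
      ... | yes q = q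
      ... | no q = ⊥-elim (none (x , m , s , q))

    collect : ∀ j ps → j + length ps ≡ k → AllPairs (λ p q → Disjoint (Pinned.C p) (Pinned.C q)) ps →
      LongPacking G L k ⊎ HittingSet G L bound ⊎ Improvement G L es
    collect zero ps e dj = inj₁ (longPacking (map Pinned.C ps) (trans (length-map Pinned.C ps) e)
      (AllP.map⁺ (All.tabulate (λ {p} _ → LongCycle.isCyc (Pinned.isLongCycle p) , LongCycle.isLong (Pinned.isLongCycle p))))
      (AllPairsP.map⁺ dj))
    -- Avoiding the earlier contact vertices makes the next one new, which is the hypothesis
    -- `two-pinned` has to be given when the cycles intersect.
    collect (suc j) ps e dj with longCycle? G L (X ++ map Pinned.z ps)
    ... | no none = inj₂ (inj₁ (hittingSet (X ++ map Pinned.z ps) small none))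
      where
      small : length (X ++ map Pinned.z ps) ≤ bound
      small = ≤-trans (≤-reflexive (length-++ X)) (+-mono-≤ (≤-trans (seen-size L) (*-monoˡ-≤ (1 + 3 * L) number))
        (≤-trans (≤-reflexive (length-map Pinned.z ps)) (≤-trans (m≤n+m (length ps) (suc j)) (≤-reflexive e))))
    ... | yes (C , ic , lc , av) with any? (λ z → (z ∈? C) ×-dec (support es z ≟ᵇ true))
    ...   | no none = inj₂ (inj₂ (AddCycle.addCycle 3≤L F ic lc apart))
      where
      apart : ∀ {v} → v ∈ C → support es v ≡ false
      apart {v} m with bool-cases (support es v)
      ... | inj₂ q = q
      ... | inj₁ q = ⊥-elim (none (v , m , q))
    ...   | yes (z , zC , sz) with any? (λ y → (y ∈? C) ×-dec ((support es y ≟ᵇ true) ×-dec ¬? (y ≟ z)))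
    ...     | yes (y , yC , sy , y≢z) = inj₂ (inj₂ (two-contacts (longCycle ic lc (λ m q → All.lookup av m (∈-++⁺ˡ q))) zC yC sz sy y≢z))
    ...     | no none with pin C z (longCycle ic lc (λ m q → All.lookup av m (∈-++⁺ˡ q))) zC sz none | meeting? C ps
    ...       | new , refl , refl | inj₂ ds = collect j (new ∷ ps) (trans (+-suc j (length ps)) e) (ds ∷ dj)
    ...       | new , refl , refl | inj₁ (q , q∈ , m , mC , mq) = inj₂ (inj₂ (two-pinned new q
                  (λ e → All.lookup av zC (∈-++⁺ʳ X (subst (_∈ map Pinned.z ps) (sym e) (∈-map⁺ Pinned.z q∈)))) mC mq))

  improve : LongPacking G L k ⊎ HittingSet G L bound ⊎ Improvement G L es
  improve with find-transversal k
  ... | inj₁ p = inj₁ (frame-packing F p)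
  ... | inj₂ tr = collect tr k [] (+-identityʳ k) []

module _ {n} (G : Graph n) {L'} (3≤L : 3 ≤ suc L') (k r : ℕ) where
  private
    -- `D` is the loss in |E| - |V| per deleted cycle, `b` is twice `k * D` because a cubic vertex
    -- contributes one half, and `B` is the size bound of a hitting set when fewer than `b` vertices
    -- are cubic.
    L D b B : ℕ
    L = suc L'
    D = 5 + (r + r)
    b = k * D + k * D
    B = (b + k) * (1 + 3 * L) + k

  Outcome : Set
  Outcome = LongPacking G L k ⊎ HittingSet G L B

  -- `f` bounds the number of cubic vertices still missing. The condition `< b + 2` persists, as an
  -- improvement starts below `b` and adds at most two.
  FromLevel : ℕ → Set
  FromLevel f = ∀ {es} → Frame G L es → b ≤ f + size (cubic es) → size (cubic es) < b + 2 → Outcome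

  module _ (h : b + 2 ≤ 2 ^ r) where

    enough-cubic : ∀ {es} → Frame G L es → b ≤ size (cubic es) → size (cubic es) < b + 2 → Outcome
    enough-cubic {es} F big h₁ = inj₁ (frame-packing F (many-cycles es loopless simple deg≤3 r (≤-trans h₁ h) k (support es)
      (support-excess es support-deg≥2 (k * D) big)))
      where open FrameProperties 3≤L F

    -- An improvement either adds cubic vertices, which lowers the level, or covers new vertices.
    at-level : ∀ f → FromLevel f → ∀ f₂ {es} → Frame G L es → b ≤ suc f + size (cubic es) → size (cubic es) < b + 2 →
      n ≤ f₂ + size (support es) → Outcome
    at-level f rec f₂ {es} F h₁ h₁' h₂ with b ≤? size (cubic es)
    ... | yes big = enough-cubic F big h₁'
    ... | no small with Step.improve 3≤L F k
    ...   | inj₁ p = inj₁ p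
    ...   | inj₂ (inj₁ (hittingSet S s hit)) =
      inj₂ (hittingSet S (≤-trans s (+-monoˡ-≤ k (*-monoˡ-≤ (1 + 3 * L) (+-monoˡ-≤ k (<⇒≤ (≰⇒> small)))))) hit)
    ...   | inj₂ (inj₂ (improvement es' F' (inj₁ (lo , hi)))) =
      rec F' (≤-trans h₁ (≤-trans (≤-reflexive (sym (+-suc f _))) (+-monoʳ-≤ f lo)))
        (≤-trans (s≤s hi) (≤-trans (≤-reflexive (+-comm 3 (size (cubic es)))) (≤-trans (≤-reflexive (+-suc _ 2)) (+-monoˡ-≤ 2 (≰⇒> small)))))
    -- `f₂` bounds the number of vertices outside the support; at zero the support is everything and
    -- cannot grow.
    at-level f rec zero F h₁ h₁' h₂ | no small | inj₂ (inj₂ (improvement es' F' (inj₂ (eq , lt)))) =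
      ⊥-elim (<⇒≱ (≤-<-trans h₂ lt) (size≤n (support es')))
    at-level f rec (suc f₂) F h₁ h₁' h₂ | no small | inj₂ (inj₂ (improvement es' F' (inj₂ (eq , lt)))) =
      at-level f rec f₂ F' (subst (λ s → b ≤ suc f + s) (sym eq) h₁) (subst (_< b + 2) (sym eq) h₁')
        (≤-trans h₂ (≤-trans (≤-reflexive (sym (+-suc f₂ _))) (+-monoʳ-≤ f₂ lt)))

    from-level : ∀ f → FromLevel f
    from-level zero F h₁ h₁' = enough-cubic F h₁ h₁'
    from-level (suc f) F h₁ h₁' = at-level f (from-level f) n F h₁ h₁' (m≤m+n n _)

    erdos-posa : Outcome
    -- The process starts from the empty frame, where no nonempty core exists and all `b` cubic
    -- vertices are missing.
    erdos-posa = from-level b {[]} (frame (λ _ _ ()) (λ _ → inj₁ refl) (λ W co {w} e → ⊥-elim (<⇒≱ (s≤s z≤n) (co w e))))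
      (m≤m+n b _) (≤-<-trans (≤-reflexive (cnt-none (cubic {n} []) (allFin n) (λ _ _ → refl))) (≤-trans (s≤s z≤n) (m≤n+m 2 b)))


-- Translation to the cycles of the statement

walk⇒linked : ∀ {n} (G : Graph n) xs → Walk G xs → Linked (GAdj G) xs
walk⇒linked G [] w = []
walk⇒linked G (x ∷ []) w = [-]
walk⇒linked G (x ∷ y ∷ xs) (a , w) = a ∷ walk⇒linked G (y ∷ xs) w

linked⇒walk : ∀ {n} (G : Graph n) {xs} → Linked (GAdj G) xs → Walk G xs
linked⇒walk G [] = tt
linked⇒walk G [-] = tt
linked⇒walk G (a ∷ l) = a , linked⇒walk G l

closed⇒isCycle : ∀ {n} (G : Graph n) c → Unique c → 3 ≤ length c → ClosedWalk G c → IsCycle (GAdj G) c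
closed⇒isCycle G (x ∷ xs) u l w = isCycle u l (walk⇒linked G (x ∷ xs ++ [ x ]) w)

toCycle : ∀ {n} {G : Graph n} {c} → IsCycle (GAdj G) c → Cycle G
toCycle {c = []} (isCycle _ () _)
toCycle {G = G} {x ∷ xs} (isCycle u l k) = record { verts = x ∷ xs ; distinct = u ; atLeast3 = l ; closed = linked⇒walk G k }

verts-toCycle : ∀ {n} {G : Graph n} {c} (ic : IsCycle (GAdj G) c) → verts (toCycle {G = G} ic) ≡ c
verts-toCycle {c = []} (isCycle _ () _)
verts-toCycle {c = x ∷ xs} (isCycle _ _ _) = refl

vectorise : ∀ {n} {G : Graph n} {L} (cs : List (List (Fin n))) → All (λ C → IsCycle (GAdj G) C × L ≤ length C) cs → AllPairs Disjoint cs →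
  Σ (Vec (Cycle G) (length cs)) λ Cs →
    (∀ i → verts (lookup Cs i) ∈ cs) × (∀ i → L ≤ cycleLength (lookup Cs i)) ×
    (∀ i j → ¬ (i ≡ j) → VertexDisjoint (lookup Cs i) (lookup Cs j))
vectorise [] [] [] = [] , (λ ()) , (λ ()) , λ ()
vectorise {G = G} (c ∷ cs) ((ic , l) ∷ ac) (d ∷ dj) with vectorise {G = G} cs ac dj
... | Cs , m , lg , ds = toCycle ic ∷ Cs , mems , longs , disj
  where
  mems : ∀ i → verts (lookup (toCycle ic ∷ Cs) i) ∈ c ∷ cs
  mems zero = here (verts-toCycle {G = G} ic)
  mems (suc i) = there (m i)
  longs : ∀ i → _ ≤ cycleLength (lookup (toCycle ic ∷ Cs) i)
  longs zero = ≤-trans l (≤-reflexive (cong length (sym (verts-toCycle {G = G} ic))))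
  longs (suc i) = lg i
  disj : ∀ i j → ¬ (i ≡ j) → VertexDisjoint (lookup (toCycle ic ∷ Cs) i) (lookup (toCycle ic ∷ Cs) j)
  disj zero zero ne = ⊥-elim (ne refl)
  disj zero (suc j) ne v p q = All.lookup d (m j) v (subst (v ∈_) (verts-toCycle {G = G} ic) p) q
  disj (suc i) zero ne v p q = All.lookup d (m i) v (subst (v ∈_) (verts-toCycle {G = G} ic) q) p
  disj (suc i) (suc j) ne = ds i j (λ e → ne (cong suc e))


-- The explicit bound and its growth

-- Rounding up in the halving loses nothing, and each halving lowers the logarithm by one; `m`
-- bounds the depth of the recursion.
n≤2^⌈log₂n⌉ : ∀ m n → n ≤ m → n ≤ 2 ^ ⌈log₂ n ⌉
n≤2^⌈log₂n⌉ _ zero _ = z≤n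
n≤2^⌈log₂n⌉ _ (suc zero) _ = ≤-trans (s≤s z≤n) (n<2^n ⌈log₂ 1 ⌉)
n≤2^⌈log₂n⌉ (suc m) n@(suc (suc n')) (s≤s h) = ≤-trans (≤-reflexive (sym (⌊n/2⌋+⌈n/2⌉≡n n)))
  (≤-trans (+-mono-≤ (≤-trans (⌊n/2⌋≤⌈n/2⌉ n) half) half) (≤-reflexive double))
  where
  t = ⌈log₂ n ⌉
  1≤t : 1 ≤ t
  1≤t = ≤-trans (≤-reflexive (sym (⌈log₂2^n⌉≡n 1))) (⌈log₂⌉-mono-≤ {2} {n} (s≤s (s≤s z≤n)))
  half : ⌈ n /2⌉ ≤ 2 ^ (t ∸ 1)
  half = subst (λ e → ⌈ n /2⌉ ≤ 2 ^ e) (⌈log₂⌈n/2⌉⌉≡⌈log₂n⌉∸1 n)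
    (n≤2^⌈log₂n⌉ m ⌈ n /2⌉ (≤-trans (≤-pred (⌈n/2⌉<n n')) h))
  double : 2 ^ (t ∸ 1) + 2 ^ (t ∸ 1) ≡ 2 ^ t
  double = trans (cong (2 ^ (t ∸ 1) +_) (sym (+-identityʳ _))) (cong (2 ^_) (m+[n∸m]≡n 1≤t))

-- With t = ⌈log₂ k ⌉, frameBound k = k (8 t + 34) and 2 ^ radius k = 64 · 4 ^ t.
radius : ℕ → ℕ
radius k = ⌈log₂ k ⌉ + (⌈log₂ k ⌉ + 6)

frameBound : ℕ → ℕ
frameBound k = k * (5 + (radius k + radius k)) + k * (5 + (radius k + radius k))

-- One factor `2 ^ t` of `2 ^ radius k` pays for `k`, the other one together with 64 pays for the
-- linear term: `8 t + 36 ≤ 64 (t + 1) ≤ 64 * 2 ^ t`.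
frameBound-radius : ∀ k → frameBound k + 2 ≤ 2 ^ radius k
frameBound-radius k = ≤-trans (≤-reflexive (cong (_+ 2) (lem k t)))
  (≤-trans (+-monoˡ-≤ 2 (*-monoˡ-≤ (8 * t + 34) (n≤2^⌈log₂n⌉ k k ≤-refl)))
  (≤-trans (+-monoʳ-≤ (2 ^ t * (8 * t + 34)) (≤-trans (≤-reflexive (sym (*-identityˡ 2))) (*-monoˡ-≤ 2 (≤-trans (s≤s z≤n) (n<2^n t)))))
  (≤-trans (≤-reflexive (sym (*-distribˡ-+ (2 ^ t) (8 * t + 34) 2)))
  (≤-trans (*-monoʳ-≤ (2 ^ t) (≤-trans (m≤m+n (8 * t + 34 + 2) (56 * t + 28)) (≤-trans (≤-reflexive (lem₂ t)) (*-monoˡ-≤ 64 (n<2^n t)))))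
  (≤-reflexive (sym (trans (^-distribˡ-+-* 2 t (t + 6)) (cong (2 ^ t *_) (^-distribˡ-+-* 2 t 6)))))))))
  where
  t = ⌈log₂ k ⌉
  lem : ∀ k t → k * (5 + (t + (t + 6) + (t + (t + 6)))) + k * (5 + (t + (t + 6) + (t + (t + 6)))) ≡ k * (8 * t + 34)
  lem = solve-∀
  lem₂ : ∀ t → 8 * t + 34 + 2 + (56 * t + 28) ≡ suc t * 64
  lem₂ = solve-∀

-- Cycles have at least three vertices, so asking for length at least 3 ⊔ ℓ loses nothing.
epBound : ℕ → ℕ → ℕ
epBound k ℓ = (frameBound k + k) * (1 + 3 * (3 ⊔ ℓ)) + k


-- With `1 ≤ t`, `1 ≤ ℓ` and `3 ⊔ ℓ ≤ 3 ℓ`, the three summands become multiples of `ℓ k t`, and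
-- `431 = (8 + 35) * (1 + 9) + 1`.
epBound-asymptotics : BigOEllKLogK epBound
epBound-asymptotics = 431 , λ k ℓ 2≤k 1≤ℓ → asymp k ℓ ⌈log₂ k ⌉ (≤-trans (≤-reflexive (sym (⌈log₂2^n⌉≡n 1))) (⌈log₂⌉-mono-≤ 2≤k)) 1≤ℓ
  where
  lem : ∀ k t → k * (5 + (t + (t + 6) + (t + (t + 6)))) + k * (5 + (t + (t + 6) + (t + (t + 6)))) + k ≡ k * (8 * t + 35 * 1)
  lem = solve-∀
  lem₂ : ∀ k t ℓ → k * (8 * t + 35 * t) * (1 * ℓ + 3 * (3 * ℓ)) + k * (ℓ * t) ≡ 431 * (ℓ * (k * t))
  lem₂ = solve-∀
  3⊔ℓ≤3ℓ : ∀ ℓ → 1 ≤ ℓ → 3 ⊔ ℓ ≤ 3 * ℓ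
  3⊔ℓ≤3ℓ ℓ h = ⊔-lub (*-monoʳ-≤ 3 h) (m≤m+n ℓ _)
  asymp : ∀ k ℓ t → 1 ≤ t → 1 ≤ ℓ →
    (k * (5 + (t + (t + 6) + (t + (t + 6)))) + k * (5 + (t + (t + 6) + (t + (t + 6)))) + k) * (1 + 3 * (3 ⊔ ℓ)) + k ≤ 431 * (ℓ * (k * t))
  asymp k ℓ t 1≤t 1≤ℓ = ≤-trans (+-mono-≤ (*-mono-≤ (≤-trans (≤-reflexive (lem k t)) (*-monoʳ-≤ k (+-monoʳ-≤ (8 * t) (*-monoʳ-≤ 35 1≤t))))
      (+-mono-≤ (*-monoʳ-≤ 1 1≤ℓ) (*-monoʳ-≤ 3 (3⊔ℓ≤3ℓ ℓ 1≤ℓ))))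
      (≤-trans (≤-reflexive (sym (*-identityʳ k))) (*-monoʳ-≤ k (*-mono-≤ 1≤ℓ 1≤t))))
    (≤-reflexive (lem₂ k t ℓ))


translate : ∀ {n} {G : Graph n} {k ℓ L m} → ℓ ≤ L → (∀ {j} → 3 ≤ j → ℓ ≤ j → L ≤ j) →
  LongPacking G L k ⊎ HittingSet G L m → HasDisjointLongCycles G k ℓ ⊎ HasLongCycleHittingSet G ℓ m
translate {G = G} ℓ≤L lub (inj₁ (longPacking cs refl al dj)) with vectorise {G = G} cs al dj
... | Cs , _ , lg , ds = inj₁ (Cs , (λ i → ≤-trans ℓ≤L (lg i)) , ds)
translate {n} {G} {ℓ = ℓ} ℓ≤L lub (inj₂ (hittingSet S small hit)) = inj₂ (S , small , meets)
  where
  meets : ∀ (C : Cycle G) → ℓ ≤ cycleLength C → Any (λ v → v ∈ S) (verts C)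
  meets C h with Any.any? (λ v → v ∈? S) (verts C)
  ... | yes a = a
  ... | no na = ⊥-elim (hit (verts C , closed⇒isCycle G (verts C) (distinct C) (atLeast3 C) (closed C) ,
          lub (atLeast3 C) h , AllP.¬Any⇒All¬ (verts C) na))

dichotomy : ∀ {n} (G : Graph n) k L → 3 ≤ L → LongPacking G L k ⊎ HittingSet G L ((frameBound k + k) * (1 + 3 * L) + k)
dichotomy G k zero ()
dichotomy G k (suc L') 3≤L = erdos-posa G 3≤L k (radius k) (frameBound-radius k)

theorem1 : Σ (ℕ → ℕ → ℕ) λ f → BigOEllKLogK f × (∀ (k ℓ n : ℕ) (G : Graph n) → HasDisjointLongCycles G k ℓ ⊎ HasLongCycleHittingSet G ℓ (f k ℓ))
theorem1 = epBound , epBound-asymptotics ,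
  λ k ℓ n G → translate (m≤n⊔m 3 ℓ) ⊔-lub (dichotomy G k (3 ⊔ ℓ) (m≤m⊔n 3 ℓ))
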